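{- Let $\lambda=(\lambda_1,\dots,\lambda_\ell)$ be a partition (with $\lambda_{\ell+1}=0$), and let $\mathcal{B}(\lambda)$ be the set of all plane overpartitions $\Pi$ (of any shape, the empty one included) such that for every $i\ge1$ the $i$-th row of $\Pi$ has at most $\lambda_i$ entries and at least $\lambda_{i+1}$ entries (where $\lambda_i=0$ for $i>\ell$). Then $$\sum_{\Pi \in \mathcal{B}(\lambda)} a^{o(\Pi)}q^{|\Pi|}=q^{\sum_i (i-1)\lambda_i}\prod_{(i,j)\in\lambda}\frac{1+aq^{c_{i,j}+1}}{1-q^{h_{i,j}}}.$$
   Context: A partition $\lambda$ is identified with its Ferrers diagram, the set of cells $(i,j)$ with $1\le j\le\lambda_i$; $\lambda'$ is the conjugate partition; hook length $h_{i,j}=\lambda_i+\lambda'_j-i-j+1$ and content $c_{i,j}=j-i$. A plane overpartition of shape $\mu$ is a filling of the cells of the Ferrers diagram of a partition $\mu$ with positive integers, weakly decreasing along each row (left to right) and each column (top to bottom), in which some entries are overlined subject to: (1) in each row, only the last (rightmost) occurrence of a given integer may be overlined; (2) in each column, the first (topmost) occurrence of a given integer may be overlined or not, and all other occurrences of that integer in the column are overlined. $|\Pi|$ is the sum of all entries (ignoring overlines), $o(\Pi)$ the number of overlined entries. -}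

module Defs where

open import Data.Nat using (ℕ; zero; suc; _+_; _*_; _∸_; _≤_; _<_; _≡ᵇ_)
open import Data.Nat.Divisibility using (_∣?_)
open import Data.Bool using (Bool; true; false; _∧_; _∨_; if_then_else_)
open import Data.Nat.ListAction using (sum)
open import Data.List using (List; []; _∷_; length; map; concatMap; upTo; filter)
open import Data.List.Membership.Propositional using (_∈_)
open import Data.List.Relation.Unary.Unique.Propositional using (Unique)
open import Data.List.Relation.Unary.All using (All)
open import Data.Maybe using (Maybe; just; nothing)
open import Data.Product using (_×_; _,_; proj₁; proj₂; Σ)
open import Relation.Nullary.Decidable using (⌊_⌋)
open import Relation.Binary.PropositionalEquality using (_≡_; _≢_)
open import Data.Unit using (⊤)
open import Data.Empty using (⊥)

-- Partitions, given as lists of parts.  Indices are 0-based below: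
-- row i (0-based) is row i+1 of the paper, same for columns.

part : List ℕ → ℕ → ℕ
part []       _       = 0
part (x ∷ xs) zero    = x
part (x ∷ xs) (suc i) = part xs i

IsPartition : List ℕ → Set
IsPartition μ = All (λ x → 0 < x) μ × (∀ i → part μ (suc i) ≤ part μ i)

conj : List ℕ → ℕ → ℕ
conj μ j = length (filter (λ x → suc j Data.Nat.≤? x) μ)

cells : List ℕ → List (ℕ × ℕ)
cells μ = go 0 μ
  where
  go : ℕ → List ℕ → List (ℕ × ℕ)
  go i []       = []
  go i (x ∷ xs) = map (λ j → (i , j)) (upTo x) Data.List.++ go (suc i) xs

-- hook length at the (0-based) cell (i , j):  arm + leg + 1
-- (equals λ_{i+1} + λ'_{j+1} - (i+1) - (j+1) + 1 in the paper's 1-based notation)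
hookPred : List ℕ → ℕ × ℕ → ℕ
hookPred μ (i , j) = (part μ i ∸ suc j) + (conj μ j ∸ suc i)

-- Formal power series in q and a with natural-number coefficients:
-- f n k = coefficient of q^n a^k.

PS : Set
PS = ℕ → ℕ → ℕ

sumTo : ℕ → (ℕ → ℕ) → ℕ
sumTo zero    f = f 0
sumTo (suc n) f = sumTo n f + f (suc n)

_⊛_ : PS → PS → PS
(f ⊛ g) n k = sumTo n (λ n₁ → sumTo k (λ k₁ → f n₁ k₁ * g (n ∸ n₁) (k ∸ k₁)))

onePS : PS
onePS n k = if (n ≡ᵇ 0) ∧ (k ≡ᵇ 0) then 1 else 0

geomPS : ℕ → PS
geomPS h n k = if (k ≡ᵇ 0) ∧ ⌊ suc h ∣? n ⌋ then 1 else 0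

binomPS : ℕ → ℕ → PS
binomPS u v n k = if ((k ≡ᵇ 0) ∧ (n ≡ᵇ u)) ∨ ((k ≡ᵇ 1) ∧ (n ≡ᵇ v)) then 1 else 0

prodPS : List PS → PS
prodPS []       = onePS
prodPS (f ∷ fs) = f ⊛ prodPS fs

-- Right-hand side:
--   q^{Σ_i (i-1) λ_i} ∏_{(i,j)∈λ} (1 + a q^{c_{ij}+1}) / (1 - q^{h_{ij}})
-- written as ∏_{(i,j)∈λ} q^{i-1}(1 + a q^{j-i+1}) · ∏ 1/(1-q^{h_{ij}})
-- (1-based), i.e. per 0-based cell (i,j) the factor q^i + a q^{j+1}.
rhs : List ℕ → PS
rhs μ = prodPS (map (λ c → binomPS (proj₁ c) (suc (proj₂ c))) (cells μ))
      ⊛ prodPS (map (λ c → geomPS (hookPred μ c)) (cells μ))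

-- Fillings: a list of rows, each a list of (value , overlined?) cells.

Cell : Set
Cell = ℕ × Bool

Filling : Set
Filling = List (List Cell)

rowAt : Filling → ℕ → List Cell
rowAt []       _       = []
rowAt (r ∷ rs) zero    = r
rowAt (r ∷ rs) (suc i) = rowAt rs i

cellAt : List Cell → ℕ → Maybe Cell
cellAt []       _       = nothing
cellAt (c ∷ cs) zero    = just c
cellAt (c ∷ cs) (suc j) = cellAt cs j

rowLen : Filling → ℕ → ℕ
rowLen Π i = length (rowAt Π i)

InShape : Filling → ℕ → ℕ → Set
InShape Π i j = j < rowLen Π i

val : Filling → ℕ → ℕ → ℕ
val Π i j with cellAt (rowAt Π i) j
... | just (v , _) = v
... | nothing      = 0

over : Filling → ℕ → ℕ → Bool
over Π i j with cellAt (rowAt Π i) j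
... | just (_ , b) = b
... | nothing      = false

record IsPlaneOverpartition (Π : Filling) : Set where
  field
    -- rows nonempty (so the representation of the shape is unique)
    rowsNonempty : All (λ r → 0 < length r) Π
    shapeDecr    : ∀ i → rowLen Π (suc i) ≤ rowLen Π i
    positive     : ∀ i j → InShape Π i j → 1 ≤ val Π i j
    rowDecr      : ∀ i j → InShape Π i (suc j) → val Π i (suc j) ≤ val Π i j
    colDecr      : ∀ i j → InShape Π (suc i) j → val Π (suc i) j ≤ val Π i j
    rowOver      : ∀ i j j′ → j < j′ → InShape Π i j′ → over Π i j ≡ true →
                   val Π i j′ ≢ val Π i j
    colOver      : ∀ i i′ j → i′ < i → InShape Π i j → val Π i′ j ≡ val Π i j →
                   over Π i j ≡ true

weight : Filling → ℕ
weight Π = sum (map (λ r → sum (map proj₁ r)) Π)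

countOver : Filling → ℕ
countOver Π = sum (map (λ r → length (filter (λ c → Data.Bool._≟_ (proj₂ c) true) r)) Π)

InB : List ℕ → Filling → Set
InB μ Π = IsPlaneOverpartition Π × (∀ i → part μ (suc i) ≤ rowLen Π i × rowLen Π i ≤ part μ i)

{-# OPTIONS --safe #-}
module Submission where

-- Extend a filling by zeros to all of λ.  The zeros form a horizontal strip λ/μ, the overlined 1s a
-- vertical strip μ/ν, and subtracting 1 from all entries in ν leaves a filling of the same kind.  So the
-- generating function satisfies
--   F λ = Σ_μ q^|μ| Σ_ν a^(|μ| − |ν|) F ν,
-- and this determines it coefficientwise.
--
-- The Jacobi–Trudi determinant det (h_{λ_i − i + j}), with h_m = ∏_{t = 1}^{m} (1 + a qᵗ) / (1 − qᵗ),
-- satisfies the same recursion by multilinearity in the rows, because h_m − h_{m−1} = q^m (h_m + a h_{m−1});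
-- the superfluous terms vanish or cancel since determinants alternate.
--
-- It equals the product side row by row: subtracting from each column a multiple of the next one so as to
-- kill the first row leaves, up to row factors 1 − q^(l₁ − l_i), the same determinant without the first row
-- and with 1 + a qᵗ replaced by q + a qᵗ.

open import Defs hiding (sumTo)
open import Algebra using (CommutativeRing)
open import Data.Bool as Bool using (Bool; true; false; not; if_then_else_)
open import Data.Empty using (⊥; ⊥-elim)
open import Data.Integer as ℤ using (ℤ; +_; -[1+_]; _⊖_; 0ℤ; 1ℤ)
import Data.Integer.Properties as ℤₚ
open import Data.List using (List; []; _∷_; _++_; _∷ʳ_; length; map; concatMap; filter; replicate; zipWith; upTo; downFrom)
open import Data.List.Membership.Propositional using (_∈_; lose)
open import Data.List.Membership.Propositional.Properties
  using (∈-map⁺; ∈-map⁻; ∈-downFrom⁺; ∈-downFrom⁻; ∈-concatMap⁺; ∈-++⁺ˡ; ∈-++⁺ʳ; ∈-++⁻)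
open import Data.List.Properties
  using (filter-accept; filter-reject; length-++; length-map; map-++; map-∘; upTo-∷ʳ; ∷-injectiveˡ; ∷-injectiveʳ)
open import Data.List.Relation.Unary.All as All using (All; []; _∷_)
import Data.List.Relation.Unary.All.Properties as Allₚ
open import Data.List.Relation.Unary.AllPairs as AllPairs using (AllPairs; []; _∷_)
import Data.List.Relation.Unary.AllPairs.Properties as AllPairsₚ
open import Data.List.Relation.Unary.Any using (here; there)
open import Data.List.Relation.Unary.Linked as Linked using (Linked; []; [-]; _∷_)
open import Data.List.Relation.Unary.Linked.Properties using (Linked⇒AllPairs)
open import Data.List.Relation.Unary.Unique.Propositional using (Unique)
import Data.List.Relation.Unary.Unique.Propositional.Properties as Unique
open import Data.Maybe as Maybe using (Maybe; just; nothing)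
open import Data.Nat as ℕ using (ℕ; zero; suc; _≤_; _<_; _∸_; z≤n; s≤s; _≤?_; _≡ᵇ_)
open import Data.Nat.Divisibility using (_∣?_; ∣⇒≤; _∣0; ∣m+n∣m⇒∣n; ∣m∣n⇒∣m+n; ∣-refl)
open import Data.Nat.Induction using (<-rec)
open import Data.Nat.ListAction using (sum)
import Data.Nat.Properties as ℕₚ
open import Data.Nat.Solver using (module +-*-Solver)
open import Data.Product using (Σ; _×_; _,_; proj₁; proj₂)
open import Data.Sum using (_⊎_; inj₁; inj₂; [_,_]′)
open import Data.Unit using (⊤; tt)
open import Function using (_∘_)
open import Function.Bundles using (_⇔_; mk⇔; module Equivalence)
open import Level using (_⊔_)
open import Relation.Binary.PropositionalEquality as ≡ using (_≡_; _≢_)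
open import Relation.Nullary using (¬_; yes; no)
open import Relation.Nullary.Decidable using (⌊_⌋; dec⇒maybe)

-- The recursion cannot be run by induction on the shape, since `μ = ν = λ` occurs on its right-hand
-- side. Only the power of `q` drops, by |μ|; so the coefficients of degree `n` in `q` are
-- determined by those of smaller degree, except where μ is empty, and there the inner sum is simply
-- 1. Hence the counting is done coefficient by coefficient.
--
-- The product side has no evident recursion of its own. The determinant is the bridge because
-- removing a strip acts on one row at a time. The price is that the rows are treated independently,
-- so that the sums also run over shapes that are not partitions; these have to contribute zero both
-- to the determinants and to the counts. Shapes keep their zero parts throughout, so that all
-- determinants in the recursion have the same size.
--
-- The factor q^(Σ (i-1) λ_i) is spread over the numerators, as q^i + a q^(j+1) in row i and column
-- j counted from 0. Splitting off a row of the determinant raises i by one, which is the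
-- replacement of 1 + a qᵗ by q + a qᵗ, iterated.

-- A ring solver with integer coefficients over an arbitrary commutative ring.

module IntegerSolver {c ℓ} (R : CommutativeRing c ℓ) where

  open CommutativeRing R hiding (zero)
  open import Algebra.Properties.Ring ring using (-‿distribˡ-*; -‿distribʳ-*; -0#≈0#; -‿involutive; -‿+-comm)
  open import Algebra.Properties.Semiring.Mult.TCOptimised semiring using (1+×; ×-homo-+; ×1-homo-*) renaming (_×_ to _·_)
  open import Relation.Binary.Reasoning.Setoid setoid
  open import Algebra.Solver.Ring.AlmostCommutativeRing using (fromCommutativeRing; _-Raw-AlmostCommutative⟶_)

  -- With the optimised multiple, `1 · 1#` reduces to `1#`; the solver constants `con 0ℤ` and
  -- `con 1ℤ` therefore are `0#` and `1#` by computation.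
  fromℤ : ℤ → Carrier
  fromℤ (+ n)    = n · 1#
  fromℤ -[1+ n ] = - (suc n · 1#)

  fromℤ-⊖ : ∀ m n → fromℤ (m ⊖ n) ≈ m · 1# + - (n · 1#)
  fromℤ-⊖ zero    zero    = sym (-‿inverseʳ 0#)
  fromℤ-⊖ zero    (suc n) = sym (+-identityˡ _)
  fromℤ-⊖ (suc m) zero    = sym (trans (+-congˡ -0#≈0#) (+-identityʳ _))
  fromℤ-⊖ (suc m) (suc n) = begin
    fromℤ (suc m ⊖ suc n)                   ≡⟨ ≡.cong fromℤ (ℤₚ.[1+m]⊖[1+n]≡m⊖n m n) ⟩
    fromℤ (m ⊖ n)                           ≈⟨ fromℤ-⊖ m n ⟩
    m · 1# + - (n · 1#)                     ≈⟨ +-identityˡ _ ⟨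
    0# + (m · 1# + - (n · 1#))              ≈⟨ +-congʳ (-‿inverseʳ 1#) ⟨
    (1# + - 1#) + (m · 1# + - (n · 1#))     ≈⟨ +-assoc _ _ _ ⟩
    1# + (- 1# + (m · 1# + - (n · 1#)))     ≈⟨ +-congˡ (+-assoc _ _ _) ⟨
    1# + ((- 1# + m · 1#) + - (n · 1#))     ≈⟨ +-congˡ (+-congʳ (+-comm _ _)) ⟩
    1# + ((m · 1# + - 1#) + - (n · 1#))     ≈⟨ +-congˡ (+-assoc _ _ _) ⟩
    1# + (m · 1# + (- 1# + - (n · 1#)))     ≈⟨ +-assoc _ _ _ ⟨
    (1# + m · 1#) + (- 1# + - (n · 1#))     ≈⟨ +-congˡ (-‿+-comm _ _) ⟩
    (1# + m · 1#) + - (1# + n · 1#)         ≈⟨ +-cong (1+× m 1#) (-‿cong (1+× n 1#)) ⟨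
    suc m · 1# + - (suc n · 1#)             ∎

  fromℤ-+ : ∀ i j → fromℤ (i ℤ.+ j) ≈ fromℤ i + fromℤ j
  fromℤ-+ (+ m)    (+ n)    = ×-homo-+ 1# m n
  fromℤ-+ (+ m)    -[1+ n ] = fromℤ-⊖ m (suc n)
  fromℤ-+ -[1+ m ] (+ n)    = trans (fromℤ-⊖ n (suc m)) (+-comm _ _)
  fromℤ-+ -[1+ m ] -[1+ n ] = begin
    - (suc (suc (m ℕ.+ n)) · 1#)      ≡⟨ ≡.cong (λ k → - (k · 1#)) (≡.sym (ℕₚ.+-suc (suc m) n)) ⟩
    - ((suc m ℕ.+ suc n) · 1#)        ≈⟨ -‿cong (×-homo-+ 1# (suc m) (suc n)) ⟩
    - (suc m · 1# + suc n · 1#)       ≈⟨ -‿+-comm _ _ ⟨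
    - (suc m · 1#) + - (suc n · 1#)   ∎

  fromℤ-neg : ∀ i → fromℤ (ℤ.- i) ≈ - fromℤ i
  fromℤ-neg (+ zero)  = sym -0#≈0#
  fromℤ-neg (+ suc n) = refl
  fromℤ-neg -[1+ n ]  = sym (-‿involutive _)

  fromℤ-*₊ : ∀ m j → fromℤ (+ m ℤ.* j) ≈ m · 1# * fromℤ j
  fromℤ-*₊ m (+ n)    = trans (reflexive (≡.cong fromℤ (≡.sym (ℤₚ.pos-* m n)))) (×1-homo-* m n)
  fromℤ-*₊ m -[1+ n ] = begin
    fromℤ (+ m ℤ.* -[1+ n ])        ≡⟨ ≡.cong fromℤ (ℤₚ.neg-distribʳ-* (+ m) (+ suc n)) ⟨
    fromℤ (ℤ.- (+ m ℤ.* + suc n))   ≈⟨ fromℤ-neg (+ m ℤ.* + suc n) ⟩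
    - fromℤ (+ m ℤ.* + suc n)       ≈⟨ -‿cong (fromℤ-*₊ m (+ suc n)) ⟩
    - (m · 1# * (suc n · 1#))       ≈⟨ -‿distribʳ-* _ _ ⟩
    m · 1# * - (suc n · 1#)         ∎

  fromℤ-* : ∀ i j → fromℤ (i ℤ.* j) ≈ fromℤ i * fromℤ j
  fromℤ-* (+ m)    j = fromℤ-*₊ m j
  fromℤ-* -[1+ m ] j = begin
    fromℤ (-[1+ m ] ℤ.* j)          ≡⟨ ≡.cong fromℤ (ℤₚ.neg-distribˡ-* (+ suc m) j) ⟨
    fromℤ (ℤ.- (+ suc m ℤ.* j))     ≈⟨ fromℤ-neg (+ suc m ℤ.* j) ⟩
    - fromℤ (+ suc m ℤ.* j)         ≈⟨ -‿cong (fromℤ-*₊ (suc m) j) ⟩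
    - (suc m · 1# * fromℤ j)        ≈⟨ -‿distribˡ-* _ _ ⟩
    - (suc m · 1#) * fromℤ j        ∎

  ℤ⟶R : ℤ.+-*-rawRing -Raw-AlmostCommutative⟶ fromCommutativeRing R
  ℤ⟶R = record
    { ⟦_⟧    = fromℤ
    ; +-homo = fromℤ-+
    ; *-homo = fromℤ-*
    ; -‿homo = fromℤ-neg
    ; 0-homo = refl
    ; 1-homo = refl
    }

  -- Equality of power series is not decidable. Like terms are cancelled by deciding equality of
  -- their integer coefficients instead.
  coeff≟ : (i j : ℤ) → Maybe (fromℤ i ≈ fromℤ j)
  coeff≟ i j = Maybe.map (λ eq → reflexive (≡.cong fromℤ eq)) (dec⇒maybe (i ℤ.≟ j))

  open import Algebra.Solver.Ring ℤ.+-*-rawRing (fromCommutativeRing R) ℤ⟶R coeff≟ public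
    using (solve; _:=_; _:+_; _:*_; _:-_; :-_; con)

-- Determinants as alternating functionals on lists of row indices.

module Alternant {c ℓ i} (R : CommutativeRing c ℓ) (I : Set i) where

  open CommutativeRing R hiding (zero)
  open import Algebra.Properties.Ring ring using (-0#≈0#)
  open import Relation.Binary.Reasoning.Setoid setoid
  open IntegerSolver R

  Functional : Set _
  Functional = List I → Carrier

  -- Laplace expansion along a column `u`: the alternating sum, over the positions in the list, of
  -- the entry of `u` there times `T` of the list without that position. In other words, the
  -- exterior product of `u` with `T`; the recursion carries the sign, so neither positions nor
  -- permutations appear.
  δ : (I → Carrier) → Functional → Functional
  δ u T []       = 0#
  δ u T (i ∷ is) = u i * T is - δ u (T ∘ (i ∷_)) is

  ε : Functional
  ε []      = 1#
  ε (_ ∷ _) = 0#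

  -- The determinant with columns `u (n − 1)`, ..., `u 0` from left to right and with the listed
  -- rows. On lists of any other length than `n` it is zero.
  alternant : (ℕ → I → Carrier) → ℕ → Functional
  alternant u zero    = ε
  alternant u (suc n) = δ (u n) (alternant u n)

  δ-cong : ∀ {u u′ T T′} → (∀ i → u i ≈ u′ i) → (∀ is → T is ≈ T′ is) → ∀ is → δ u T is ≈ δ u′ T′ is
  δ-cong u≈ T≈ []       = refl
  δ-cong u≈ T≈ (i ∷ is) = +-cong (*-cong (u≈ i) (T≈ is)) (-‿cong (δ-cong u≈ (λ is → T≈ (i ∷ is)) is))

  δ-congʳ : ∀ u {T T′} → (∀ is → T is ≈ T′ is) → ∀ is → δ u T is ≈ δ u T′ is
  δ-congʳ u = δ-cong (λ _ → refl)

  δ-0 : ∀ u is → δ u (λ _ → 0#) is ≈ 0#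
  δ-0 u []       = refl
  δ-0 u (i ∷ is) = trans (+-cong (zeroʳ _) (-‿cong (δ-0 u is))) (-‿inverseʳ 0#)

  δ-+ : ∀ u T T′ is → δ u (λ js → T js + T′ js) is ≈ δ u T is + δ u T′ is
  δ-+ u T T′ []       = sym (+-identityˡ 0#)
  δ-+ u T T′ (i ∷ is) = trans (+-congˡ (-‿cong (δ-+ u _ _ is)))
    (solve 5 (λ a b c d e → a :* (b :+ c) :- (d :+ e) := (a :* b :- d) :+ (a :* c :- e)) refl (u i) (T is) (T′ is) _ _)

  δ-* : ∀ u w T is → δ u (λ js → w * T js) is ≈ w * δ u T is
  δ-* u w T []       = sym (zeroʳ w)
  δ-* u w T (i ∷ is) = trans (+-congˡ (-‿cong (δ-* u w _ is)))
    (solve 4 (λ a b c d → a :* (b :* c) :- b :* d := b :* (a :* c :- d)) refl (u i) w (T is) _)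

  δ-neg : ∀ u T is → δ u (λ js → - T js) is ≈ - δ u T is
  δ-neg u T []       = sym -0#≈0#
  δ-neg u T (i ∷ is) = trans (+-congˡ (-‿cong (δ-neg u _ is)))
    (solve 3 (λ a c d → a :* (:- c) :- (:- d) := :- (a :* c :- d)) refl (u i) (T is) _)

  δ-linearˡ : ∀ u v α β T is → δ (λ i → α * u i - β * v i) T is ≈ α * δ u T is - β * δ v T is
  δ-linearˡ u v α β T []       = solve 2 (λ a b → con 0ℤ := a :* con 0ℤ :- b :* con 0ℤ) refl α β
  δ-linearˡ u v α β T (i ∷ is) = trans (+-congˡ (-‿cong (δ-linearˡ u v α β _ is)))
    (solve 7 (λ a b x y t d e → (a :* x :- b :* y) :* t :- (a :* d :- b :* e) := a :* (x :* t :- d) :- b :* (y :* t :- e))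
      refl α β (u i) (v i) (T is) _ _)

  -- This is `u ∧ u = 0`: the terms in which the head row is taken by the outer `u` and those in
  -- which it is taken by the inner one cancel. No division by 2 is involved.
  δ-δ : ∀ u T is → δ u (δ u T) is ≈ 0#
  δ-δ u T []       = refl
  δ-δ u T (i ∷ is) = begin
    u i * δ u T is - δ u (λ js → u i * T js - δ u (T ∘ (i ∷_)) js) is
      ≈⟨ +-congˡ (-‿cong (δ-+ u _ _ is)) ⟩
    u i * δ u T is - (δ u (λ js → u i * T js) is + δ u (λ js → - δ u (T ∘ (i ∷_)) js) is)
      ≈⟨ +-congˡ (-‿cong (+-cong (δ-* u (u i) T is) (trans (δ-neg u _ is) (-‿cong (δ-δ u _ is))))) ⟩
    u i * δ u T is - (u i * δ u T is - 0#)
      ≈⟨ solve 1 (λ x → x :- (x :- con 0ℤ) := con 0ℤ) refl _ ⟩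
    0# ∎

  -- Both fields are required. `T` is a function of indices and not a multilinear form, so `swap`
  -- does not follow from `vanish`; and `vanish` follows from `swap` only where 2 can be cancelled.
  record Alternating (T : Functional) : Set (c ⊔ ℓ ⊔ i) where
    field
      vanish : ∀ pre j post → T (pre ++ j ∷ j ∷ post) ≈ 0#
      swap   : ∀ pre j k post → T (pre ++ j ∷ k ∷ post) ≈ - T (pre ++ k ∷ j ∷ post)
  open Alternating public

  alternating-∷ : ∀ {T} j → Alternating T → Alternating (T ∘ (j ∷_))
  alternating-∷ j alt .vanish pre = alt .vanish (j ∷ pre)
  alternating-∷ j alt .swap pre   = alt .swap (j ∷ pre)

  -- Expanding over two adjacent indices, the term that takes the first and the term that takes the
  -- second exchange their roles with opposite signs; in all other terms both indices reach `T`,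
  -- which is alternating itself.
  δ-alternating : ∀ u {T} → Alternating T → Alternating (δ u T)
  δ-alternating u {T} alt .vanish [] j post = begin
    u j * T (j ∷ post) - (u j * T (j ∷ post) - δ u (T ∘ (j ∷_) ∘ (j ∷_)) post)
      ≈⟨ +-congˡ (-‿cong (+-congˡ (-‿cong (trans (δ-congʳ u (alt .vanish [] j) post) (δ-0 u post))))) ⟩
    u j * T (j ∷ post) - (u j * T (j ∷ post) - 0#)
      ≈⟨ solve 1 (λ x → x :- (x :- con 0ℤ) := con 0ℤ) refl _ ⟩
    0# ∎
  δ-alternating u {T} alt .vanish (i ∷ pre) j post = begin
    u i * T (pre ++ j ∷ j ∷ post) - δ u (T ∘ (i ∷_)) (pre ++ j ∷ j ∷ post)
      ≈⟨ +-cong (*-congˡ (alt .vanish pre j post)) (-‿cong (δ-alternating u (alternating-∷ i alt) .vanish pre j post)) ⟩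
    u i * 0# - 0#
      ≈⟨ solve 1 (λ x → x :* con 0ℤ :- con 0ℤ := con 0ℤ) refl _ ⟩
    0# ∎
  δ-alternating u {T} alt .swap [] j k post = begin
    u j * T (k ∷ post) - (u k * T (j ∷ post) - δ u (T ∘ (j ∷_) ∘ (k ∷_)) post)
      ≈⟨ +-congˡ (-‿cong (+-congˡ (-‿cong (trans (δ-congʳ u (alt .swap [] j k) post) (δ-neg u _ post))))) ⟩
    u j * T (k ∷ post) - (u k * T (j ∷ post) - - δ u (T ∘ (k ∷_) ∘ (j ∷_)) post)
      ≈⟨ solve 3 (λ x y z → x :- (y :- :- z) := :- (y :- (x :- z))) refl _ _ _ ⟩
    - (u k * T (j ∷ post) - (u j * T (k ∷ post) - δ u (T ∘ (k ∷_) ∘ (j ∷_)) post)) ∎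
  δ-alternating u {T} alt .swap (i ∷ pre) j k post = begin
    u i * T (pre ++ j ∷ k ∷ post) - δ u (T ∘ (i ∷_)) (pre ++ j ∷ k ∷ post)
      ≈⟨ +-cong (*-congˡ (alt .swap pre j k post)) (-‿cong (δ-alternating u (alternating-∷ i alt) .swap pre j k post)) ⟩
    u i * - T (pre ++ k ∷ j ∷ post) - - δ u (T ∘ (i ∷_)) (pre ++ k ∷ j ∷ post)
      ≈⟨ solve 3 (λ x y z → x :* :- y :- :- z := :- (x :* y :- z)) refl _ _ _ ⟩
    - (u i * T (pre ++ k ∷ j ∷ post) - δ u (T ∘ (i ∷_)) (pre ++ k ∷ j ∷ post)) ∎

  ε-alternating : Alternating ε
  ε-alternating .vanish []      j post = refl
  ε-alternating .vanish (_ ∷ _) j post = refl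
  ε-alternating .swap []      j k post = sym -0#≈0#
  ε-alternating .swap (_ ∷ _) j k post = sym -0#≈0#

  alternant-alternating : ∀ u n → Alternating (alternant u n)
  alternant-alternating u zero    = ε-alternating
  alternant-alternating u (suc n) = δ-alternating (u n) (alternant-alternating u n)

  alternant-cong : ∀ {u v} → (∀ k i → u k i ≈ v k i) → ∀ n is → alternant u n is ≈ alternant v n is
  alternant-cong u≈v zero    is = refl
  alternant-cong u≈v (suc n) is = δ-cong (u≈v n) (alternant-cong u≈v n) is

  δ-zeroRow : ∀ {u T j} → u j ≈ 0# → (∀ pre is → T (pre ++ j ∷ is) ≈ 0#) →
              ∀ pre is → δ u T (pre ++ j ∷ is) ≈ 0#
  δ-zeroRow {u} {T} {j} u≈0 T≈0 [] is = begin
    u j * T is - δ u (T ∘ (j ∷_)) is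
      ≈⟨ +-cong (*-congʳ u≈0) (-‿cong (trans (δ-congʳ u (T≈0 []) is) (δ-0 u is))) ⟩
    0# * T is - 0#
      ≈⟨ solve 1 (λ x → con 0ℤ :* x :- con 0ℤ := con 0ℤ) refl _ ⟩
    0# ∎
  δ-zeroRow {u} {T} {j} u≈0 T≈0 (i ∷ pre) is = begin
    u i * T (pre ++ j ∷ is) - δ u (T ∘ (i ∷_)) (pre ++ j ∷ is)
      ≈⟨ +-cong (*-congˡ (T≈0 pre is)) (-‿cong (δ-zeroRow u≈0 (λ pre → T≈0 (i ∷ pre)) pre is)) ⟩
    u i * 0# - 0#
      ≈⟨ solve 1 (λ x → x :* con 0ℤ :- con 0ℤ := con 0ℤ) refl _ ⟩
    0# ∎

  alternant-zeroRow : ∀ {u j} → (∀ k → u k j ≈ 0#) → ∀ n pre is → alternant u n (pre ++ j ∷ is) ≈ 0#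
  alternant-zeroRow u≈0 zero    []        is = refl
  alternant-zeroRow u≈0 zero    (_ ∷ _)   is = refl
  alternant-zeroRow u≈0 (suc n) = δ-zeroRow (u≈0 n) (alternant-zeroRow u≈0 n)

  product∷ : (I → Carrier) → List I → Carrier
  product∷ w []       = 1#
  product∷ w (i ∷ is) = w i * product∷ w is

  -- The predicate `P` confines the scaling to the row indices that occur. In the evaluation these
  -- are bounded beta numbers, for which the truncated subtractions are exact.
  δ-scaleˡ : ∀ {p} {P : I → Set p} {u v w} {T T′} → (∀ {i} → P i → u i ≈ w i * v i) →
             (∀ {is} → All P is → T is ≈ product∷ w is * T′ is) →
             ∀ {is} → All P is → δ u T is ≈ product∷ w is * δ v T′ is
  δ-scaleˡ hu hT []                   = sym (zeroʳ 1#)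
  δ-scaleˡ {P = P} {u} {v} {w} {T} {T′} hu hT {i ∷ is} (pi ∷ pis) = begin
    u i * T is - δ u (T ∘ (i ∷_)) is
      ≈⟨ +-cong (*-cong (hu pi) (hT pis)) (-‿cong
           -- The head row is now an argument of `T` and brings its factor `w i` along; it is
           -- absorbed into the functional before the recursive call.
           (δ-scaleˡ {w = w} {T′ = λ js → w i * T′ (i ∷ js)} hu
             (λ {js} pjs → trans (hT (pi ∷ pjs)) (solve 3 (λ x y z → x :* y :* z := y :* (x :* z)) refl _ _ _)) pis)) ⟩
    w i * v i * (product∷ w is * T′ is) - product∷ w is * δ v (λ js → w i * T′ (i ∷ js)) is
      ≈⟨ +-congˡ (-‿cong (*-congˡ (δ-* v (w i) _ is))) ⟩
    w i * v i * (product∷ w is * T′ is) - product∷ w is * (w i * δ v (T′ ∘ (i ∷_)) is)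
      ≈⟨ solve 5 (λ a b x y z → a :* b :* (x :* y) :- x :* (a :* z) := a :* x :* (b :* y :- z)) refl _ _ _ _ _ ⟩
    w i * product∷ w is * (v i * T′ is - δ v (T′ ∘ (i ∷_)) is) ∎

  alternant-rowScale : ∀ {p} {P : I → Set p} {u v w} → (∀ k {i} → P i → u k i ≈ w i * v k i) →
                       ∀ n {is} → All P is → alternant u n is ≈ product∷ w is * alternant v n is
  alternant-rowScale hu zero    []       = sym (*-identityˡ 1#)
  alternant-rowScale hu zero    (_ ∷ _)  = sym (zeroʳ _)
  alternant-rowScale {w = w} hu (suc n) pis = δ-scaleˡ {w = w} (hu n) (alternant-rowScale hu n) pis

  productTo : (ℕ → Carrier) → ℕ → Carrier
  productTo f zero    = 1#
  productTo f (suc n) = productTo f n * f n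

  alternant-columnScale : ∀ w u n is → alternant (λ k i → w k * u k i) n is ≈ productTo w n * alternant u n is
  alternant-columnScale w u zero    is = sym (*-identityˡ _)
  alternant-columnScale w u (suc n) is = begin
    δ (λ i → w n * u n i) (alternant (λ k i → w k * u k i) n) is
      -- `δ-linearˡ` speaks of differences, hence the second term with coefficient `0#`.
      ≈⟨ δ-cong {u′ = λ i → w n * u n i - 0# * u n i} (λ i → solve 2 (λ x y → x := x :- con 0ℤ :* y) refl _ _) (alternant-columnScale w u n) is ⟩
    δ (λ i → w n * u n i - 0# * u n i) (λ js → productTo w n * alternant u n js) is
      ≈⟨ δ-linearˡ (u n) (u n) (w n) 0# _ is ⟩
    w n * δ (u n) (λ js → productTo w n * alternant u n js) is - 0# * δ (u n) (λ js → productTo w n * alternant u n js) is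
      ≈⟨ +-cong (*-congˡ (δ-* (u n) (productTo w n) (alternant u n) is)) refl ⟩
    w n * (productTo w n * δ (u n) (alternant u n) is) - 0# * δ (u n) (λ js → productTo w n * alternant u n js) is
      ≈⟨ solve 4 (λ a b x y → a :* (b :* x) :- con 0ℤ :* y := b :* a :* x) refl _ _ _ _ ⟩
    productTo w n * w n * δ (u n) (alternant u n) is ∎

  -- The column operations v k = α k · u k − β k · u (k + 1), for k < n, leave the last column alone.
  alternant-columnOperation : ∀ u α (β : ℕ → Carrier) n is →
    δ (u n) (alternant (λ k i → α k * u k i - β k * u (suc k) i) n) is ≈ productTo α n * alternant u (suc n) is
  alternant-columnOperation u α β zero    is = sym (*-identityˡ _)
  alternant-columnOperation u α β (suc n) is = begin
    δ (u (suc n)) (δ (v n) V) is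
      ≈⟨ δ-congʳ (u (suc n)) (δ-linearˡ (u n) (u (suc n)) (α n) (β n) V) is ⟩
    δ (u (suc n)) (λ js → α n * δ (u n) V js - β n * δ (u (suc n)) V js) is
      ≈⟨ δ-+ (u (suc n)) _ _ is ⟩
    δ (u (suc n)) (λ js → α n * δ (u n) V js) is + δ (u (suc n)) (λ js → - (β n * δ (u (suc n)) V js)) is
      ≈⟨ +-cong (δ-* (u (suc n)) (α n) _ is) (trans (δ-neg (u (suc n)) _ is) (-‿cong (δ-* (u (suc n)) (β n) _ is))) ⟩
    α n * δ (u (suc n)) (δ (u n) V) is - β n * δ (u (suc n)) (δ (u (suc n)) V) is
      ≈⟨ +-cong (*-congˡ (trans (δ-congʳ (u (suc n)) (alternant-columnOperation u α β n) is) (δ-* (u (suc n)) _ _ is)))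
                (-‿cong (*-congˡ (δ-δ (u (suc n)) V is))) ⟩
    α n * (productTo α n * alternant u (suc (suc n)) is) - β n * 0#
      ≈⟨ solve 4 (λ a b x y → a :* (b :* x) :- y :* con 0ℤ := b :* a :* x) refl _ _ _ _ ⟩
    productTo α n * α n * alternant u (suc (suc n)) is ∎
    where
    v = λ k i → α k * u k i - β k * u (suc k) i
    V = alternant v n

  -- A rule replacing each row by a finite linear combination of rows. `integrate` expands the
  -- result by summing over all choices, one for each row.
  Kernel : Set _
  Kernel = I → List (Carrier × I)

  weighted : List (Carrier × I) → (I → Carrier) → Carrier
  weighted []             f = 0#
  weighted ((w , j) ∷ ws) f = w * f j + weighted ws f

  integrate : Kernel → Functional → Functional
  integrate κ T []       = T []
  integrate κ T (i ∷ is) = weighted (κ i) (λ j → integrate κ (T ∘ (j ∷_)) is)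

  weighted-cong : ∀ ws {f g} → (∀ j → f j ≈ g j) → weighted ws f ≈ weighted ws g
  weighted-cong []             f≈g = refl
  weighted-cong ((w , j) ∷ ws) f≈g = +-cong (*-congˡ (f≈g j)) (weighted-cong ws f≈g)

  weighted-+ : ∀ ws f g → weighted ws (λ j → f j + g j) ≈ weighted ws f + weighted ws g
  weighted-+ []             f g = sym (+-identityˡ 0#)
  weighted-+ ((w , j) ∷ ws) f g = trans (+-congˡ (weighted-+ ws f g))
    (solve 5 (λ w x y s t → w :* (x :+ y) :+ (s :+ t) := (w :* x :+ s) :+ (w :* y :+ t)) refl _ _ _ _ _)

  weighted-* : ∀ ws x f → weighted ws (λ j → x * f j) ≈ x * weighted ws f
  weighted-* []             x f = sym (zeroʳ x)
  weighted-* ((w , j) ∷ ws) x f = trans (+-congˡ (weighted-* ws x f))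
    (solve 4 (λ w x y s → w :* (x :* y) :+ x :* s := x :* (w :* y :+ s)) refl _ _ _ _)

  weighted-neg : ∀ ws f → weighted ws (λ j → - f j) ≈ - weighted ws f
  weighted-neg []             f = sym -0#≈0#
  weighted-neg ((w , j) ∷ ws) f = trans (+-congˡ (weighted-neg ws f))
    (solve 3 (λ w y s → w :* (:- y) :+ (:- s) := :- (w :* y :+ s)) refl _ _ _)

  weighted-0 : ∀ ws → weighted ws (λ _ → 0#) ≈ 0#
  weighted-0 []             = refl
  weighted-0 ((w , j) ∷ ws) = trans (+-cong (zeroʳ w) (weighted-0 ws)) (+-identityˡ 0#)

  integrate-cong : ∀ κ {T T′} → (∀ is → T is ≈ T′ is) → ∀ is → integrate κ T is ≈ integrate κ T′ is
  integrate-cong κ T≈ []       = T≈ []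
  integrate-cong κ T≈ (i ∷ is) = weighted-cong (κ i) (λ j → integrate-cong κ (λ js → T≈ (j ∷ js)) is)

  integrate-+ : ∀ κ T T′ is → integrate κ (λ js → T js + T′ js) is ≈ integrate κ T is + integrate κ T′ is
  integrate-+ κ T T′ []       = refl
  integrate-+ κ T T′ (i ∷ is) = trans (weighted-cong (κ i) (λ j → integrate-+ κ _ _ is)) (weighted-+ (κ i) _ _)

  integrate-* : ∀ κ w T is → integrate κ (λ js → w * T js) is ≈ w * integrate κ T is
  integrate-* κ w T []       = refl
  integrate-* κ w T (i ∷ is) = trans (weighted-cong (κ i) (λ j → integrate-* κ w _ is)) (weighted-* (κ i) w _)

  integrate-neg : ∀ κ T is → integrate κ (λ js → - T js) is ≈ - integrate κ T is
  integrate-neg κ T []       = refl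
  integrate-neg κ T (i ∷ is) = trans (weighted-cong (κ i) (λ j → integrate-neg κ _ is)) (weighted-neg (κ i) _)

  integrate-0 : ∀ κ is → integrate κ (λ _ → 0#) is ≈ 0#
  integrate-0 κ []       = refl
  integrate-0 κ (i ∷ is) = trans (weighted-cong (κ i) (λ j → integrate-0 κ is)) (weighted-0 (κ i))

  δ-weighted : ∀ u ws (F : I → Functional) is → δ u (λ js → weighted ws (λ j → F j js)) is ≈ weighted ws (λ j → δ u (F j) is)
  δ-weighted u []             F is = δ-0 u is
  δ-weighted u ((w , j) ∷ ws) F is = trans (δ-+ u _ _ is) (+-cong (δ-* u w (F j) is) (δ-weighted u ws F is))

  integrate-δ : ∀ κ u T is → integrate κ (δ u T) is ≈ δ (λ i → weighted (κ i) u) (integrate κ T) is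
  integrate-δ κ u T []       = refl
  integrate-δ κ u T (i ∷ is) = begin
    weighted (κ i) (λ j → integrate κ (λ js → u j * T js - δ u (T ∘ (j ∷_)) js) is)
      ≈⟨ weighted-cong (κ i) (λ j → trans (integrate-+ κ _ _ is) (+-cong (integrate-* κ (u j) T is) (integrate-neg κ _ is))) ⟩
    weighted (κ i) (λ j → u j * integrate κ T is - integrate κ (δ u (T ∘ (j ∷_))) is)
      ≈⟨ weighted-+ (κ i) _ _ ⟩
    weighted (κ i) (λ j → u j * integrate κ T is) + weighted (κ i) (λ j → - integrate κ (δ u (T ∘ (j ∷_))) is)
      ≈⟨ +-cong (trans (weighted-cong (κ i) (λ j → *-comm _ _)) (trans (weighted-* (κ i) _ u) (*-comm _ _)))
                (trans (weighted-neg (κ i) _) (-‿cong (weighted-cong (κ i) (λ j → integrate-δ κ u _ is)))) ⟩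
    U i * integrate κ T is - weighted (κ i) (λ j → δ U (integrate κ (T ∘ (j ∷_))) is)
      ≈⟨ +-congˡ (-‿cong (δ-weighted U (κ i) _ is)) ⟨
    U i * integrate κ T is - δ U (λ js → weighted (κ i) (λ j → integrate κ (T ∘ (j ∷_)) js)) is ∎
    where U = λ i → weighted (κ i) u

  integrate-ε : ∀ κ is → integrate κ ε is ≈ ε is
  integrate-ε κ []       = refl
  integrate-ε κ (i ∷ is) = trans (weighted-cong (κ i) (λ j → integrate-0 κ is)) (weighted-0 (κ i))

  -- Multilinearity in the rows. It is used in both directions of reading: a row is written as a
  -- telescoping sum of differences, and a difference as a two-term combination of rows.
  integrate-alternant : ∀ κ u n is → integrate κ (alternant u n) is ≈ alternant (λ k i → weighted (κ i) (u k)) n is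
  integrate-alternant κ u zero    is = integrate-ε κ is
  integrate-alternant κ u (suc n) is = trans (integrate-δ κ (u n) _ is) (δ-congʳ _ (integrate-alternant κ u n) is)

-- Partitions with zero parts, their beta numbers and conjugates.

-- Trailing zeros are allowed, so removing cells never changes the number of rows. The index bounds
-- the first part, which is what an induction over the rows needs from the row above.
data Descending : ℕ → List ℕ → Set where
  []  : ∀ {b} → Descending b []
  _∷_ : ∀ {b x xs} → x ≤ b → Descending x xs → Descending b (x ∷ xs)

beta : List ℕ → List ℕ
beta []       = []
beta (x ∷ xs) = (x ℕ.+ suc (length xs)) ∷ beta xs

beta-bounded : ∀ {b xs} → Descending b xs → All (_≤ b ℕ.+ length xs) (beta xs)
beta-bounded []                    = []
beta-bounded {b} {x ∷ xs} (x≤b ∷ d) =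
  ℕₚ.+-monoˡ-≤ (suc (length xs)) x≤b ∷
  All.map (λ p≤ → ℕₚ.≤-trans p≤ (ℕₚ.+-mono-≤ x≤b (ℕₚ.n≤1+n _))) (beta-bounded d)

conj-accept : ∀ {x xs j} → j ℕ.< x → conj (x ∷ xs) j ≡ suc (conj xs j)
conj-accept {x} {xs} {j} j<x = ≡.cong length (filter-accept (λ y → suc j ≤? y) {x} {xs} j<x)

conj-zero : ∀ {b xs j} → Descending b xs → b ≤ j → conj xs j ≡ 0
conj-zero []        b≤j = ≡.refl
conj-zero {xs = x ∷ xs} {j} (x≤b ∷ d) b≤j =
  ≡.trans (≡.cong length (filter-reject (λ y → suc j ≤? y) {x} {xs} (ℕₚ.≤⇒≯ (ℕₚ.≤-trans x≤b b≤j))))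
          (conj-zero d (ℕₚ.≤-trans x≤b b≤j))

-- Evaluation of the Jacobi-Trudi determinant as a product over hooks.

module Hypergeometric {c ℓ} (R : CommutativeRing c ℓ)
  (q a : CommutativeRing.Carrier R) (geo : ℕ → CommutativeRing.Carrier R) where

  open CommutativeRing R hiding (zero)
  open import Algebra.Properties.Semiring.Exp semiring using (_^_; ^-homo-*; ^-congʳ)
  open import Relation.Binary.Reasoning.Setoid setoid
  open IntegerSolver R
  open Alternant R ℕ

  -- h i m = ∏_{t = 1}^{m} (qⁱ + a qᵗ) / (1 − qᵗ)
  h : ℕ → ℕ → Carrier
  h i zero    = 1#
  h i (suc m) = h i m * ((q ^ i + a * q ^ suc m) * geo m)

  h⁻ : ℕ → ℕ → Carrier
  h⁻ i zero    = 0#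
  h⁻ i (suc m) = h i m

  -- The rows of the Jacobi–Trudi determinant; the row index p = λ_i − i + ℓ + 1 is
  -- one more than the usual beta number, so that p = 0 gives the zero row.
  entry : ℕ → ℕ → ℕ → Carrier
  entry i k p = h⁻ i (p ∸ k)

  jacobiTrudi : ℕ → List ℕ → Carrier
  jacobiTrudi i xs = alternant (entry i) (length xs) (beta xs)

  -- The rows are numbered from `i`, which fixes the numerators. The leg of a first-row cell is read
  -- off the remaining rows alone, so that the recursion never refers to the whole shape.
  hookProduct : ℕ → List ℕ → Carrier
  hookProduct i []       = 1#
  hookProduct i (x ∷ xs) =
    productTo (λ j → q ^ i + a * q ^ suc j) x * productTo (λ j → geo (x ∸ suc j ℕ.+ conj xs j)) x * hookProduct (suc i) xs

  productTo-cong : ∀ {f g} n → (∀ j → j ℕ.< n → f j ≈ g j) → productTo f n ≈ productTo g n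
  productTo-cong zero    f≈g = refl
  productTo-cong (suc n) f≈g = *-cong (productTo-cong n (λ j j<n → f≈g j (ℕₚ.m<n⇒m<1+n j<n))) (f≈g n ℕₚ.≤-refl)

  productTo-* : ∀ f g n → productTo (λ j → f j * g j) n ≈ productTo f n * productTo g n
  productTo-* f g zero    = sym (*-identityˡ 1#)
  productTo-* f g (suc n) = trans (*-congʳ (productTo-* f g n))
    (solve 4 (λ x y z w → (x :* y) :* (z :* w) := (x :* z) :* (y :* w)) refl _ _ _ _)

  productTo-1 : ∀ {f} n → (∀ j → j ℕ.< n → f j ≈ 1#) → productTo f n ≈ 1#
  productTo-1 zero    f≈1 = refl
  productTo-1 (suc n) f≈1 = trans (*-cong (productTo-1 n (λ j j<n → f≈1 j (ℕₚ.m<n⇒m<1+n j<n))) (f≈1 n ℕₚ.≤-refl)) (*-identityˡ 1#)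

  productTo-suc : ∀ f n → productTo f (suc n) ≈ f 0 * productTo (λ j → f (suc j)) n
  productTo-suc f zero    = *-comm _ _
  productTo-suc f (suc n) = trans (*-congʳ (productTo-suc f n)) (*-assoc _ _ _)

  product∷-cong : ∀ {f g ps} → All (λ p → f p ≈ g p) ps → product∷ f ps ≈ product∷ g ps
  product∷-cong []       = refl
  product∷-cong (e ∷ es) = *-cong e (product∷-cong es)

  product∷-* : ∀ f g ps → product∷ (λ p → f p * g p) ps ≈ product∷ f ps * product∷ g ps
  product∷-* f g []       = sym (*-identityˡ 1#)
  product∷-* f g (p ∷ ps) = trans (*-congˡ (product∷-* f g ps))
    (solve 4 (λ x y z w → (x :* y) :* (z :* w) := (x :* z) :* (y :* w)) refl _ _ _ _)

  product∷-1 : ∀ {f ps} → All (λ p → f p ≈ 1#) ps → product∷ f ps ≈ 1#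
  product∷-1 []       = refl
  product∷-1 (e ∷ es) = trans (*-cong e (product∷-1 es)) (*-identityˡ 1#)

  -- Hook lengths of the first row together with the differences of beta numbers exhaust
  -- an initial interval: walk along the rim, one row or one column at a time.
  HookIdentity : ℕ → List ℕ → Set _
  HookIdentity x xs = ∀ φ → productTo φ (x ℕ.+ length xs) ≈
    productTo (λ j → φ (x ∸ suc j ℕ.+ conj xs j)) x * product∷ (λ p → φ (x ℕ.+ length xs ∸ p)) (beta xs)

  -- Lengthening the first row by a cell raises its old hooks and all the differences by one. The
  -- value 0 that becomes free (`φ` is taken at one less than the hook length) belongs to the new
  -- last cell, whose arm and leg are empty.
  hookIdentity-column : ∀ {x xs} → Descending x xs → HookIdentity x xs → HookIdentity (suc x) xs
  hookIdentity-column {x} {xs} d ih φ = begin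
    productTo φ (suc x ℕ.+ length xs)
      ≈⟨ productTo-suc φ (x ℕ.+ length xs) ⟩
    φ 0 * productTo (λ j → φ (suc j)) (x ℕ.+ length xs)
      ≈⟨ *-congˡ (ih (λ j → φ (suc j))) ⟩
    φ 0 * (productTo (λ j → φ (suc (x ∸ suc j ℕ.+ conj xs j))) x * product∷ (λ p → φ (suc (x ℕ.+ length xs ∸ p))) (beta xs))
      ≈⟨ solve 3 (λ f y z → f :* (y :* z) := (y :* f) :* z) refl _ _ _ ⟩
    (productTo (λ j → φ (suc (x ∸ suc j ℕ.+ conj xs j))) x * φ 0) * product∷ (λ p → φ (suc (x ℕ.+ length xs ∸ p))) (beta xs)
      ≈⟨ *-cong (*-cong (productTo-cong x (λ j j<x → reflexive (≡.cong (λ m → φ (m ℕ.+ conj xs j)) (≡.sym (ℕₚ.+-∸-assoc 1 j<x)))))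
                        (reflexive (≡.cong φ (≡.sym (≡.cong₂ ℕ._+_ (ℕₚ.n∸n≡0 x) (conj-zero d ℕₚ.≤-refl))))))
                (product∷-cong (All.map (λ p≤ → reflexive (≡.cong φ (≡.sym (ℕₚ.+-∸-assoc 1 p≤)))) (beta-bounded d))) ⟩
    productTo (λ j → φ (suc x ∸ suc j ℕ.+ conj xs j)) (suc x) * product∷ (λ p → φ (suc x ℕ.+ length xs ∸ p)) (beta xs) ∎

  -- Doubling the first row raises every leg, and every difference to a lower row, by one. The value
  -- 0 that becomes free belongs to the difference between the two equal rows.
  hookIdentity-row : ∀ {x xs} → Descending x xs → HookIdentity x xs → HookIdentity x (x ∷ xs)
  hookIdentity-row {x} {xs} d ih φ = begin
    productTo φ (x ℕ.+ suc (length xs))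
      ≡⟨ ≡.cong (productTo φ) (ℕₚ.+-suc x (length xs)) ⟩
    productTo φ (suc (x ℕ.+ length xs))
      ≈⟨ productTo-suc φ (x ℕ.+ length xs) ⟩
    φ 0 * productTo (λ j → φ (suc j)) (x ℕ.+ length xs)
      ≈⟨ *-congˡ (ih (λ j → φ (suc j))) ⟩
    φ 0 * (productTo (λ j → φ (suc (x ∸ suc j ℕ.+ conj xs j))) x * product∷ (λ p → φ (suc (x ℕ.+ length xs ∸ p))) (beta xs))
      ≈⟨ solve 3 (λ f y z → f :* (y :* z) := y :* (f :* z)) refl _ _ _ ⟩
    productTo (λ j → φ (suc (x ∸ suc j ℕ.+ conj xs j))) x * (φ 0 * product∷ (λ p → φ (suc (x ℕ.+ length xs ∸ p))) (beta xs))
      ≈⟨ *-cong (productTo-cong x (λ j j<x → reflexive (≡.cong φ (≡.sym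
                   (≡.trans (≡.cong (x ∸ suc j ℕ.+_) (conj-accept {x} {xs} j<x)) (ℕₚ.+-suc _ _))))))
                (*-cong (reflexive (≡.cong φ (≡.sym (ℕₚ.n∸n≡0 (x ℕ.+ suc (length xs))))))
                   (product∷-cong (All.map (λ {p} p≤ → reflexive (≡.cong φ (≡.sym
                     (≡.trans (≡.cong (_∸ p) (ℕₚ.+-suc x (length xs))) (ℕₚ.+-∸-assoc 1 p≤))))) (beta-bounded d)))) ⟩
    productTo (λ j → φ (x ∸ suc j ℕ.+ conj (x ∷ xs) j)) x * product∷ (λ p → φ (x ℕ.+ suc (length xs) ∸ p)) (beta (x ∷ xs)) ∎

  hookIdentity : ∀ x xs → Descending x xs → HookIdentity x xs
  hookIdentity zero    []       []        φ = sym (*-identityˡ 1#)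
  hookIdentity (suc x) []       []          = hookIdentity-column [] (hookIdentity x [] [])
  hookIdentity zero    (y ∷ ys) (z≤n ∷ d)   = hookIdentity-row d (hookIdentity zero ys d)
  hookIdentity (suc x) (y ∷ ys) (y≤1+x ∷ d) =
    [ (λ y<1+x → hookIdentity-column (ℕₚ.≤-pred y<1+x ∷ d) (hookIdentity x (y ∷ ys) (ℕₚ.≤-pred y<1+x ∷ d)))
    , (λ y≡1+x → ≡.subst (λ z → HookIdentity z (y ∷ ys)) y≡1+x (hookIdentity-row d (hookIdentity y ys d)))
    ]′ (ℕₚ.m≤n⇒m<n∨m≡n y≤1+x)

  module Evaluation (geo-inverse : ∀ m → geo m * (1# - q ^ suc m) ≈ 1#) where

    -- Since `q ^ suc i + a * q ^ t` is `q` times `q ^ i + a * q ^ (t − 1)`, raising `i` moves the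
    -- range of exponents from 1, ..., m + 1 to 0, ..., m. All numerators but the one at 0 are then
    -- shared with `h i m`.
    h-shift : ∀ i m → h (suc i) (suc m) ≈ q ^ suc m * (q ^ i + a) * (h i m * geo m)
    h-shift i zero = solve 4 (λ Q q a g → con 1ℤ :* ((q :* Q :+ a :* (q :* con 1ℤ)) :* g) := (q :* con 1ℤ) :* (Q :+ a) :* (con 1ℤ :* g))
      refl (q ^ i) q a (geo 0)
    h-shift i (suc m) = trans (*-congʳ (h-shift i m))
      (solve 7 (λ X Q q a g f h → (X :* (Q :+ a) :* (h :* g)) :* ((q :* Q :+ a :* (q :* X)) :* f) :=
                  (q :* X) :* (Q :+ a) :* (h :* ((Q :+ a :* X) :* g) :* f))
        refl (q ^ suc m) (q ^ i) q a (geo m) (geo (suc m)) (h i m))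

    h-step : ∀ i m → (1# - q ^ suc m) * h i (suc m) ≈ (q ^ i + a * q ^ suc m) * h i m
    h-step i m = trans (solve 4 (λ x h y g → x :* (h :* (y :* g)) := y :* h :* (g :* x)) refl _ (h i m) _ (geo m))
      (trans (*-congˡ (geo-inverse m)) (*-identityʳ _))

    -- For positive index, with X = q^(m+1), Z = q^z and Q = q^i, both terms are multiples of
    -- `h i m * geo m`, and what is left is (1 - XZ)(Q + aX) - (Q + aXZ)(1 - X) = X(1 - Z)(Q + a),
    -- whose right-hand side is supplied by `h-shift`. At `z = 0` it is zero, and this is what kills
    -- the first row.
    h-contiguous : ∀ i m z → (1# - q ^ (m ℕ.+ z)) * h i m - (q ^ i + a * q ^ (m ℕ.+ z)) * h⁻ i m ≈ (1# - q ^ z) * h (suc i) m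
    h-contiguous i zero    z = solve 2 (λ x y → (con 1ℤ :- x) :* con 1ℤ :- y :* con 0ℤ := (con 1ℤ :- x) :* con 1ℤ) refl _ _
    h-contiguous i (suc m) z = begin
      (1# - q ^ (suc m ℕ.+ z)) * (h i m * ((q ^ i + a * X) * geo m)) - (q ^ i + a * q ^ (suc m ℕ.+ z)) * h i m
        ≈⟨ +-cong (*-congʳ (+-congˡ (-‿cong (^-homo-* q (suc m) z))))
             (-‿cong (*-cong (+-congˡ (*-congˡ (^-homo-* q (suc m) z)))
                -- Inserting `geo m * (1 − X)`, which is 1, brings the second term over the
                -- denominator of the first.
                (trans (sym (*-identityʳ _)) (*-congˡ (sym (geo-inverse m)))))) ⟩
      (1# - X * q ^ z) * (h i m * ((q ^ i + a * X) * geo m)) - (q ^ i + a * (X * q ^ z)) * (h i m * (geo m * (1# - X)))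
        ≈⟨ solve 6 (λ X Z Q a h g → (con 1ℤ :- X :* Z) :* (h :* ((Q :+ a :* X) :* g)) :- (Q :+ a :* (X :* Z)) :* (h :* (g :* (con 1ℤ :- X)))
                       := (con 1ℤ :- Z) :* (X :* (Q :+ a) :* (h :* g))) refl X (q ^ z) (q ^ i) a (h i m) (geo m) ⟩
      (1# - q ^ z) * (X * (q ^ i + a) * (h i m * geo m))
        ≈⟨ *-congˡ (h-shift i m) ⟨
      (1# - q ^ z) * h (suc i) (suc m) ∎
      where X = q ^ suc m

    -- For `p = suc k + m` and `suc y = p + z` the sum `m + z` is `y ∸ k`, free of the row, so the
    -- coefficients in `h-contiguous` are those of a column operation. The number `z = suc y ∸ p` is
    -- free of the column, so `1 − q^z` comes out as a row factor. For `p ≤ k` all entries are zero.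
    entry-columnOperation : ∀ i y k {p} → p ≤ suc y →
      (1# - q ^ (y ∸ k)) * entry i k p - (q ^ i + a * q ^ (y ∸ k)) * entry i (suc k) p ≈ (1# - q ^ (suc y ∸ p)) * entry (suc i) k p
    entry-columnOperation i y k {p} p≤1+y with p ≤? k
    ... | yes p≤k rewrite ℕₚ.m≤n⇒m∸n≡0 p≤k | ℕₚ.m≤n⇒m∸n≡0 (ℕₚ.m≤n⇒m≤1+n p≤k) =
      solve 3 (λ x y z → x :* con 0ℤ :- y :* con 0ℤ := z :* con 0ℤ) refl _ _ _
    ... | no p≰k with ℕₚ.m≤n⇒∃[o]m+o≡n (ℕₚ.≰⇒> p≰k)
    ...   | m , ≡.refl with ℕₚ.m≤n⇒∃[o]m+o≡n p≤1+y
    ...     | z , ≡.refl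
      rewrite ℕₚ.m+n∸m≡n (k ℕ.+ m) z | ℕₚ.+-assoc k m z | ℕₚ.m+n∸m≡n k (m ℕ.+ z)
            | ≡.sym (ℕₚ.+-suc k m) | ℕₚ.m+n∸m≡n k (suc m) | ℕₚ.+-suc k m | ℕₚ.m+n∸m≡n k m = h-contiguous i m z

    -- `suc y` is the index of the first row. The column operations kill it everywhere except in the
    -- leftmost column `n`, which they do not touch; of the expansion along that column only the
    -- term taking the first row survives, the other minors having a zero row.
    alternant-entry : ∀ i y n {ps} → n ≤ y → All (_≤ suc y) ps →
      productTo (λ k → 1# - q ^ (y ∸ k)) n * alternant (entry i) (suc n) (suc y ∷ ps) ≈
      h i (y ∸ n) * (product∷ (λ p → 1# - q ^ (suc y ∸ p)) ps * alternant (entry (suc i)) n ps)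
    alternant-entry i y n {ps} n≤y ps≤ = begin
      productTo α n * alternant (entry i) (suc n) (suc y ∷ ps)
        ≈⟨ alternant-columnOperation (entry i) α β n (suc y ∷ ps) ⟨
      entry i n (suc y) * alternant v n ps - δ (entry i n) (λ js → alternant v n (suc y ∷ js)) ps
        ≈⟨ +-cong (*-cong (reflexive (≡.cong (h⁻ i) (ℕₚ.+-∸-assoc 1 n≤y)))
                    (alternant-rowScale {P = _≤ suc y} (λ k {p} → entry-columnOperation i y k {p}) n ps≤))
             (-‿cong (trans (δ-congʳ _ (alternant-zeroRow v-0 n []) ps) (δ-0 _ ps))) ⟩
      h i (y ∸ n) * (product∷ (λ p → 1# - q ^ (suc y ∸ p)) ps * alternant (entry (suc i)) n ps) - 0#
        ≈⟨ solve 1 (λ x → x :- con 0ℤ := x) refl _ ⟩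
      h i (y ∸ n) * (product∷ (λ p → 1# - q ^ (suc y ∸ p)) ps * alternant (entry (suc i)) n ps) ∎
      where
      α β : ℕ → Carrier
      α k = 1# - q ^ (y ∸ k)
      β k = q ^ i + a * q ^ (y ∸ k)
      v : ℕ → ℕ → Carrier
      v k p = α k * entry i k p - β k * entry i (suc k) p
      v-0 : ∀ k → v k (suc y) ≈ 0#
      v-0 k = trans (entry-columnOperation i y k ℕₚ.≤-refl)
        (trans (*-congʳ (trans (+-congˡ (-‿cong (^-congʳ q (ℕₚ.n∸n≡0 y)))) (-‿inverseʳ 1#))) (zeroˡ _))

    h-product : ∀ i m → h i m ≈ productTo (λ j → q ^ i + a * q ^ suc j) m * productTo geo m
    h-product i zero    = sym (*-identityˡ 1#)
    h-product i (suc m) = trans (*-congʳ (h-product i m))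
      (solve 4 (λ x y z w → x :* y :* (z :* w) := x :* z :* (y :* w)) refl _ _ _ _)

    geo-inverse′ : ∀ {m} → 0 ℕ.< m → geo (ℕ.pred m) * (1# - q ^ m) ≈ 1#
    geo-inverse′ {suc m} _ = geo-inverse m

    -- The top `n` factors are listed downwards, which is the order of the factors that the columns
    -- 0, ..., n - 1 pick up.
    productTo-reverse : ∀ φ x n → productTo φ (x ℕ.+ n) ≈ productTo φ x * productTo (λ k → φ (ℕ.pred (x ℕ.+ n ∸ k))) n
    productTo-reverse φ x zero    = trans (reflexive (≡.cong (productTo φ) (ℕₚ.+-identityʳ x))) (sym (*-identityʳ _))
    productTo-reverse φ x (suc n) = begin
      productTo φ (x ℕ.+ suc n)
        ≡⟨ ≡.cong (productTo φ) (ℕₚ.+-suc x n) ⟩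
      productTo φ (x ℕ.+ n) * φ (x ℕ.+ n)
        ≈⟨ *-congʳ (productTo-reverse φ x n) ⟩
      productTo φ x * productTo (λ k → φ (ℕ.pred (x ℕ.+ n ∸ k))) n * φ (x ℕ.+ n)
        ≈⟨ solve 3 (λ x y z → x :* y :* z := x :* (z :* y)) refl _ _ _ ⟩
      productTo φ x * (φ (x ℕ.+ n) * productTo (λ k → φ (ℕ.pred (x ℕ.+ n ∸ k))) n)
        ≈⟨ *-congˡ (productTo-suc (λ k → φ (ℕ.pred (suc (x ℕ.+ n) ∸ k))) n) ⟨
      productTo φ x * productTo (λ k → φ (ℕ.pred (suc (x ℕ.+ n) ∸ k))) (suc n)
        ≡⟨ ≡.cong (λ m → productTo φ x * productTo (λ k → φ (ℕ.pred (m ∸ k))) (suc n)) (ℕₚ.+-suc x n) ⟨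
      productTo φ x * productTo (λ k → φ (ℕ.pred (x ℕ.+ suc n ∸ k))) (suc n) ∎

    -- Nothing is divided: `G` inverts the column factors `U` and completes the denominators of
    -- `h i x` to `productTo geo (x + n)`. The hook identity at `φ = geo` splits this product into
    -- the hooks `H` and the differences `V`, and `V` is inverse to the row factors `W`.
    jacobiTrudi≈hookProduct : ∀ i {b xs} → Descending b xs → jacobiTrudi i xs ≈ hookProduct i xs
    jacobiTrudi≈hookProduct i []                      = refl
    jacobiTrudi≈hookProduct i {xs = x ∷ xs} (_ ∷ d) = begin
      A
        ≈⟨ *-identityˡ _ ⟨
      1# * A
        ≈⟨ *-congʳ units ⟨
      G * U * A
        ≈⟨ *-assoc _ _ _ ⟩
      G * (U * A)
        ≡⟨ ≡.cong (λ p → G * (U * alternant (entry i) (suc n) (p ∷ beta xs))) (ℕₚ.+-suc x n) ⟩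
      G * (U * alternant (entry i) (suc n) (suc (x ℕ.+ n) ∷ beta xs))
        ≈⟨ *-congˡ (alternant-entry i (x ℕ.+ n) n (ℕₚ.m≤n+m n x) (All.map ℕₚ.m≤n⇒m≤1+n (beta-bounded d))) ⟩
      G * (h i (x ℕ.+ n ∸ n) * (W * alternant (entry (suc i)) n (beta xs)))
        ≈⟨ *-congˡ (*-cong (trans (reflexive (≡.cong (h i) (ℕₚ.m+n∸n≡m x n))) (h-product i x))
                           (*-congˡ (jacobiTrudi≈hookProduct (suc i) d))) ⟩
      G * (N * productTo geo x * (W * hookProduct (suc i) xs))
        ≈⟨ solve 5 (λ a b c d e → a :* (b :* c :* (d :* e)) := b :* ((c :* a) :* d) :* e) refl _ _ _ _ _ ⟩
      N * ((productTo geo x * G) * W) * hookProduct (suc i) xs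
        ≈⟨ *-congʳ (*-congˡ (*-congʳ (trans (sym (productTo-reverse geo x n)) (hookIdentity x xs d geo)))) ⟩
      N * ((H * V) * W) * hookProduct (suc i) xs
        ≈⟨ *-congʳ (*-congˡ (trans (*-assoc _ _ _) (trans (*-congˡ VW) (*-identityʳ _)))) ⟩
      N * H * hookProduct (suc i) xs ∎
      where
      n = length xs
      A = jacobiTrudi i (x ∷ xs)
      G = productTo (λ k → geo (ℕ.pred (x ℕ.+ n ∸ k))) n
      U = productTo (λ k → 1# - q ^ (x ℕ.+ n ∸ k)) n
      W = product∷ (λ p → 1# - q ^ (suc (x ℕ.+ n) ∸ p)) (beta xs)
      V = product∷ (λ p → geo (x ℕ.+ n ∸ p)) (beta xs)
      N = productTo (λ j → q ^ i + a * q ^ suc j) x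
      H = productTo (λ j → geo (x ∸ suc j ℕ.+ conj xs j)) x
      units : G * U ≈ 1#
      units = trans (sym (productTo-* _ _ n))
        (productTo-1 n (λ k k<n → geo-inverse′ (ℕₚ.m<n⇒0<n∸m (ℕₚ.<-≤-trans k<n (ℕₚ.m≤n+m n x)))))
      VW : V * W ≈ 1#
      VW = trans (sym (product∷-* _ _ (beta xs)))
        (product∷-1 (All.map (λ {p} p≤ → trans (*-congˡ (+-congˡ (-‿cong (^-congʳ q (ℕₚ.+-∸-assoc 1 p≤))))) (geo-inverse _)) (beta-bounded d)))

-- Horizontal and vertical strips.

firstPart : List ℕ → ℕ
firstPart []      = 0
firstPart (x ∷ _) = x

interval : ℕ → ℕ → List ℕ
interval l x = map (l ℕ.+_) (downFrom (suc x ∸ l))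

horizontalStrips : List ℕ → List (List ℕ)
horizontalStrips []       = [] ∷ []
horizontalStrips (x ∷ xs) = concatMap (λ y → map (y ∷_) (horizontalStrips xs)) (interval (firstPart xs) x)

-- Each part is lowered by at most one independently of the others, as multilinearity dictates; the
-- result need not be decreasing.
verticalStrips : List ℕ → List (List ℕ)
verticalStrips []           = [] ∷ []
verticalStrips (zero ∷ xs)  = map (0 ∷_) (verticalStrips xs)
verticalStrips (suc x ∷ xs) = map (suc x ∷_) (verticalStrips xs) ++ map (x ∷_) (verticalStrips xs)

data Horizontal : List ℕ → List ℕ → Set where
  []  : Horizontal [] []
  _∷_ : ∀ {x y xs ys} → firstPart xs ≤ y × y ≤ x → Horizontal xs ys → Horizontal (x ∷ xs) (y ∷ ys)

data Vertical : List ℕ → List ℕ → Set where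
  []   : Vertical [] []
  keep : ∀ {x xs ys} → Vertical xs ys → Vertical (x ∷ xs) (x ∷ ys)
  drop : ∀ {x xs ys} → Vertical xs ys → Vertical (suc x ∷ xs) (x ∷ ys)

interval-sound : ∀ l x → All (λ y → l ≤ y × y ≤ x) (interval l x)
interval-sound l x = Allₚ.map⁺ (All.tabulate λ {d} d∈ → ℕₚ.m≤m+n l d , bound (∈-downFrom⁻ d∈))
  where
  bound : ∀ {d} → d ℕ.< suc x ∸ l → l ℕ.+ d ≤ x
  bound {d} d< = ℕₚ.≤-pred (≡.subst₂ _≤_ (ℕₚ.+-suc l d) (ℕₚ.m+[n∸m]≡n (ℕₚ.<⇒≤ (ℕₚ.m∸n≢0⇒n<m {suc x} {l} (ℕₚ.m<n⇒n≢0 d<))))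
              (ℕₚ.+-monoʳ-≤ l d<))

interval-complete : ∀ {l x y} → l ≤ y → y ≤ x → y ∈ interval l x
interval-complete {l} {x} {y} l≤y y≤x = ≡.subst (_∈ interval l x) (ℕₚ.m+[n∸m]≡n l≤y)
  (∈-map⁺ (l ℕ.+_) (∈-downFrom⁺ (ℕₚ.∸-monoˡ-< (s≤s y≤x) l≤y)))

interval-unique : ∀ l x → Unique (interval l x)
interval-unique l x = Unique.map⁺ (ℕₚ.+-cancelˡ-≡ l _ _) (Unique.downFrom⁺ (suc x ∸ l))

horizontalStrips-sound : ∀ xs → All (Horizontal xs) (horizontalStrips xs)
horizontalStrips-sound []       = [] ∷ []
horizontalStrips-sound (x ∷ xs) = Allₚ.concat⁺ (Allₚ.map⁺ {xs = interval (firstPart xs) x} (All.map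
  (λ b → Allₚ.map⁺ {xs = horizontalStrips xs} (All.map (b ∷_) (horizontalStrips-sound xs))) (interval-sound (firstPart xs) x)))

horizontalStrips-complete : ∀ {xs ys} → Horizontal xs ys → ys ∈ horizontalStrips xs
horizontalStrips-complete []                               = here ≡.refl
horizontalStrips-complete {x ∷ xs} {y ∷ ys} ((l , u) ∷ h) =
  ∈-concatMap⁺ (λ y → map (y ∷_) (horizontalStrips xs))
    (lose (interval-complete l u) (∈-map⁺ (y ∷_) (horizontalStrips-complete h)))

verticalStrips-sound : ∀ xs → All (Vertical xs) (verticalStrips xs)
verticalStrips-sound []           = [] ∷ []
verticalStrips-sound (zero ∷ xs)  = Allₚ.map⁺ {xs = verticalStrips xs} (All.map keep (verticalStrips-sound xs))
verticalStrips-sound (suc x ∷ xs) = Allₚ.++⁺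
  (Allₚ.map⁺ {xs = verticalStrips xs} (All.map keep (verticalStrips-sound xs)))
  (Allₚ.map⁺ {xs = verticalStrips xs} (All.map drop (verticalStrips-sound xs)))

verticalStrips-complete : ∀ {xs ys} → Vertical xs ys → ys ∈ verticalStrips xs
verticalStrips-complete []                       = here ≡.refl
verticalStrips-complete {zero ∷ xs}  (keep v)  = ∈-map⁺ (0 ∷_) (verticalStrips-complete v)
verticalStrips-complete {suc x ∷ xs} (keep v)  = ∈-++⁺ˡ (∈-map⁺ (suc x ∷_) (verticalStrips-complete v))
verticalStrips-complete {suc x ∷ xs} (drop v)  = ∈-++⁺ʳ _ (∈-map⁺ (x ∷_) (verticalStrips-complete v))

horizontal-length : ∀ {xs ys} → Horizontal xs ys → length ys ≡ length xs
horizontal-length []      = ≡.refl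
horizontal-length (_ ∷ h) = ≡.cong suc (horizontal-length h)

horizontal-descending : ∀ {b xs ys} → firstPart xs ≤ b → Horizontal xs ys → Descending b ys
horizontal-descending b []            = []
horizontal-descending b ((l , u) ∷ h) = ℕₚ.≤-trans u b ∷ horizontal-descending l h

vertical-length : ∀ {xs ys} → Vertical xs ys → length ys ≡ length xs
vertical-length []       = ≡.refl
vertical-length (keep v) = ≡.cong suc (vertical-length v)
vertical-length (drop v) = ≡.cong suc (vertical-length v)

vertical-sum : ∀ {xs ys} → Vertical xs ys → sum ys ≤ sum xs
vertical-sum []                 = z≤n
vertical-sum (keep {x} v)       = ℕₚ.+-monoʳ-≤ x (vertical-sum v)
vertical-sum (drop {x} v)       = ℕₚ.+-mono-≤ (ℕₚ.n≤1+n x) (vertical-sum v)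

descending-first : ∀ {b xs} → Descending b xs → firstPart xs ≤ b
descending-first []        = z≤n
descending-first (x≤b ∷ _) = x≤b

map-∷-disjoint : ∀ {x y : ℕ} {xss yss : List (List ℕ)} → x ≢ y → ∀ {zs} → zs ∈ map (x ∷_) xss × zs ∈ map (y ∷_) yss → ⊥
map-∷-disjoint {x} {y} x≢y (∈x , ∈y) =
  let _ , _ , eqˣ = ∈-map⁻ (x ∷_) ∈x ; _ , _ , eqʸ = ∈-map⁻ (y ∷_) ∈y
  in x≢y (∷-injectiveˡ (≡.trans (≡.sym eqˣ) eqʸ))

verticalStrips-unique : ∀ xs → Unique (verticalStrips xs)
verticalStrips-unique []           = [] ∷ []
verticalStrips-unique (zero ∷ xs)  = Unique.map⁺ ∷-injectiveʳ (verticalStrips-unique xs)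
verticalStrips-unique (suc x ∷ xs) = Unique.++⁺
  (Unique.map⁺ ∷-injectiveʳ (verticalStrips-unique xs)) (Unique.map⁺ ∷-injectiveʳ (verticalStrips-unique xs))
  (map-∷-disjoint {suc x} {x} {verticalStrips xs} {verticalStrips xs} ℕₚ.1+n≢n)

horizontalStrips-unique : ∀ xs → Unique (horizontalStrips xs)
horizontalStrips-unique []       = [] ∷ []
horizontalStrips-unique (x ∷ xs) = Unique.concat⁺
  (Allₚ.map⁺ (All.universal (λ y → Unique.map⁺ ∷-injectiveʳ (horizontalStrips-unique xs)) (interval (firstPart xs) x)))
  (AllPairsₚ.map⁺ (AllPairs.map (λ {y} {z} y≢z {_} → map-∷-disjoint {y} {z} {horizontalStrips xs} {horizontalStrips xs} y≢z) (interval-unique (firstPart xs) x)))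

verticalStrips-zeros : ∀ {ys} → sum ys ≡ 0 → verticalStrips ys ≡ ys ∷ []
verticalStrips-zeros {[]}        e = ≡.refl
verticalStrips-zeros {zero ∷ ys} e = ≡.cong (map (0 ∷_)) (verticalStrips-zeros e)

-- If the parts of a partition are lowered by at most one each, the order can only fail by some `y`
-- being followed by `suc y`. These two parts have the same beta number.
data Ascent : List ℕ → Set where
  here  : ∀ {y ys} → Ascent (y ∷ suc y ∷ ys)
  there : ∀ {y ys} → Ascent ys → Ascent (y ∷ ys)

vertical-ascent : ∀ {b xs ys} → Descending b xs → Vertical xs ys → Descending b ys ⊎ Ascent ys
vertical-ascent d [] = inj₁ []
vertical-ascent {xs = x ∷ xs} (x≤b ∷ d) (keep v) with vertical-ascent d v
... | inj₁ d′ = inj₁ (x≤b ∷ d′)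
... | inj₂ a  = inj₂ (there a)
vertical-ascent {xs = suc x ∷ xs} (x≤b ∷ d) (drop v) with vertical-ascent d v
... | inj₂ a            = inj₂ (there a)
... | inj₁ []           = inj₁ (ℕₚ.≤-trans (ℕₚ.n≤1+n x) x≤b ∷ [])
... | inj₁ (y≤1+x ∷ d′) = [ (λ y<1+x → inj₁ (ℕₚ.≤-trans (ℕₚ.n≤1+n x) x≤b ∷ ℕₚ.≤-pred y<1+x ∷ d′)) , (λ { ≡.refl → inj₂ here }) ]′
                            (ℕₚ.m≤n⇒m<n∨m≡n y≤1+x)

-- Finite sums over lists.

module Sums {c ℓ} (R : CommutativeRing c ℓ) where
  open CommutativeRing R hiding (zero)
  open IntegerSolver R

  sumOver : ∀ {b} {B : Set b} → (B → Carrier) → List B → Carrier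
  sumOver f []       = 0#
  sumOver f (x ∷ xs) = f x + sumOver f xs

  sumOver-cong : ∀ {b} {B : Set b} {f g : B → Carrier} {xs} → All (λ x → f x ≈ g x) xs → sumOver f xs ≈ sumOver g xs
  sumOver-cong []       = refl
  sumOver-cong (e ∷ es) = +-cong e (sumOver-cong es)

  sumOver-++ : ∀ {b} {B : Set b} (f : B → Carrier) xs {ys} → sumOver f (xs ++ ys) ≈ sumOver f xs + sumOver f ys
  sumOver-++ f []       = sym (+-identityˡ _)
  sumOver-++ f (x ∷ xs) = trans (+-congˡ (sumOver-++ f xs)) (sym (+-assoc _ _ _))

  sumOver-map : ∀ {b d} {B : Set b} {D : Set d} (f : D → Carrier) (g : B → D) xs → sumOver f (map g xs) ≈ sumOver (f ∘ g) xs
  sumOver-map f g []       = refl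
  sumOver-map f g (x ∷ xs) = +-congˡ (sumOver-map f g xs)

  sumOver-concatMap : ∀ {b d} {B : Set b} {D : Set d} (f : D → Carrier) (g : B → List D) xs →
                      sumOver f (concatMap g xs) ≈ sumOver (λ x → sumOver f (g x)) xs
  sumOver-concatMap f g []       = refl
  sumOver-concatMap f g (x ∷ xs) = trans (sumOver-++ f (g x)) (+-congˡ (sumOver-concatMap f g xs))

  sumOver-* : ∀ {b} {B : Set b} w (f : B → Carrier) xs → sumOver (λ x → w * f x) xs ≈ w * sumOver f xs
  sumOver-* w f []       = sym (zeroʳ w)
  sumOver-* w f (x ∷ xs) = trans (+-congˡ (sumOver-* w f xs)) (sym (distribˡ w _ _))

-- The strip recursion for the Jacobi-Trudi determinant.

module Recursion {c ℓ} (R : CommutativeRing c ℓ)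
  (q a : CommutativeRing.Carrier R) (geo : ℕ → CommutativeRing.Carrier R) where

  open CommutativeRing R hiding (zero)
  open import Algebra.Properties.Semiring.Exp semiring using (_^_; ^-homo-*; ^-congʳ)
  open import Relation.Binary.Reasoning.Setoid setoid
  open IntegerSolver R
  open Alternant R ℕ
  open Sums R
  open Hypergeometric R q a geo

  -- The index 0 is left out: it stands for the zero row, at which the telescoping sum ends.
  initial : Kernel
  initial zero    = []
  initial (suc m) = (1# , suc m) ∷ initial m

  weighted-telescope : ∀ (f : ℕ → Carrier) → f 0 ≈ 0# → ∀ p → weighted (initial p) (λ m → f m - f (ℕ.pred m)) ≈ f p
  weighted-telescope f f0 zero    = sym f0
  weighted-telescope f f0 (suc m) = trans (+-congˡ (weighted-telescope f f0 m))
    (solve 2 (λ x y → con 1ℤ :* (x :- y) :+ y := x) refl _ _)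

  -- The square of index pairs is peeled border by border: the corner is on the diagonal, and the
  -- two sides meeting there are negatives of each other.
  weighted-antisymmetric : ∀ (f : ℕ → ℕ → Carrier) → (∀ m → f m m ≈ 0#) → (∀ m n → f m n ≈ - f n m) →
    ∀ p → weighted (initial p) (λ m → weighted (initial p) (f m)) ≈ 0#
  weighted-antisymmetric f diag anti zero    = refl
  weighted-antisymmetric f diag anti (suc m) = begin
    1# * (1# * f M M + weighted (initial m) (f M)) + weighted (initial m) (λ k → 1# * f k M + weighted (initial m) (f k))
      ≈⟨ +-cong (*-congˡ (+-congʳ (*-congˡ (diag M)))) (weighted-+ (initial m) _ _) ⟩
    1# * (1# * 0# + weighted (initial m) (f M)) + (weighted (initial m) (λ k → 1# * f k M) + weighted (initial m) (λ k → weighted (initial m) (f k)))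
      ≈⟨ +-congˡ (+-cong (trans (weighted-cong (initial m) (λ k → trans (*-identityˡ _) (anti k M))) (weighted-neg (initial m) (f M)))
                         (weighted-antisymmetric f diag anti m)) ⟩
    1# * (1# * 0# + weighted (initial m) (f M)) + (- weighted (initial m) (f M) + 0#)
      ≈⟨ solve 1 (λ x → con 1ℤ :* (con 1ℤ :* con 0ℤ :+ x) :+ (:- x :+ con 0ℤ) := con 0ℤ) refl _ ⟩
    0# ∎
    where M = suc m

  weighted-interval : ∀ F l n d →
    weighted (initial (l ℕ.+ n ℕ.+ d)) F ≈ weighted (initial (l ℕ.+ n)) F + sumOver (λ y → F (y ℕ.+ suc n)) (map (l ℕ.+_) (downFrom d))
  weighted-interval F l n zero    = trans (reflexive (≡.cong (λ p → weighted (initial p) F) (ℕₚ.+-identityʳ (l ℕ.+ n)))) (sym (+-identityʳ _))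
  weighted-interval F l n (suc d) = begin
    weighted (initial (l ℕ.+ n ℕ.+ suc d)) F
      ≡⟨ ≡.cong (λ p → weighted (initial p) F) (ℕₚ.+-suc (l ℕ.+ n) d) ⟩
    1# * F (suc (l ℕ.+ n ℕ.+ d)) + weighted (initial (l ℕ.+ n ℕ.+ d)) F
      ≈⟨ +-cong (trans (*-identityˡ _) (reflexive (≡.cong F eq))) (weighted-interval F l n d) ⟩
    F (l ℕ.+ d ℕ.+ suc n) + (weighted (initial (l ℕ.+ n)) F + sumOver (λ y → F (y ℕ.+ suc n)) (map (l ℕ.+_) (downFrom d)))
      ≈⟨ solve 3 (λ x y z → x :+ (y :+ z) := y :+ (x :+ z)) refl _ _ _ ⟩
    weighted (initial (l ℕ.+ n)) F + sumOver (λ y → F (y ℕ.+ suc n)) (map (l ℕ.+_) (downFrom (suc d))) ∎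
    where
    eq : suc (l ℕ.+ n ℕ.+ d) ≡ l ℕ.+ d ℕ.+ suc n
    eq = ≡.trans (≡.cong suc (≡.trans (ℕₚ.+-assoc l n d) (≡.trans (≡.cong (l ℕ.+_) (ℕₚ.+-comm n d)) (≡.sym (ℕₚ.+-assoc l d n)))))
                 (≡.sym (ℕₚ.+-suc (l ℕ.+ d) n))

  -- For alternating T the full summation range 0 < m ≤ p collapses to the interlacing one:
  -- the contribution of m below the next row's bound cancels by antisymmetry.
  integrate-initial-head : ∀ {T} → Alternating T → ∀ xs →
    weighted (initial (firstPart xs ℕ.+ length xs)) (λ m → integrate initial (T ∘ (m ∷_)) (beta xs)) ≈ 0#
  integrate-initial-head alt []       = refl
  integrate-initial-head alt (x ∷ xs) = weighted-antisymmetric _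
    (λ m → trans (integrate-cong initial (alt .vanish [] m) (beta xs)) (integrate-0 initial (beta xs)))
    (λ m n → trans (integrate-cong initial (alt .swap [] m n) (beta xs)) (integrate-neg initial _ (beta xs)))
    (x ℕ.+ suc (length xs))

  -- Let p₁ and p₂ be the first two beta numbers. Choices m₁ ≤ p₂ for the first row have the same
  -- range as those for the second and cancel. The others, p₂ < m₁ ≤ p₁, are the beta numbers of the
  -- new parts between `firstPart xs` and `x`, which is the interlacing condition of a horizontal
  -- strip.
  integrate-initial : ∀ {T b xs} → Alternating T → Descending b xs →
    integrate initial T (beta xs) ≈ sumOver (T ∘ beta) (horizontalStrips xs)
  integrate-initial alt [] = sym (+-identityʳ _)
  integrate-initial {T} {xs = x ∷ xs} alt (_ ∷ d) = begin
    weighted (initial (x ℕ.+ suc n)) F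
      ≡⟨ ≡.cong (λ p → weighted (initial p) F) eq ⟩
    weighted (initial (l ℕ.+ n ℕ.+ (suc x ∸ l))) F
      ≈⟨ weighted-interval F l n (suc x ∸ l) ⟩
    weighted (initial (l ℕ.+ n)) F + sumOver (λ y → F (y ℕ.+ suc n)) (interval l x)
      ≈⟨ +-congʳ (integrate-initial-head alt xs) ⟩
    0# + sumOver (λ y → F (y ℕ.+ suc n)) (interval l x)
      ≈⟨ +-identityˡ _ ⟩
    sumOver (λ y → F (y ℕ.+ suc n)) (interval l x)
      ≈⟨ sumOver-cong (All.universal (λ y → trans (integrate-initial (alternating-∷ (y ℕ.+ suc n) alt) d) (sym (row y))) (interval l x)) ⟩
    sumOver (λ y → sumOver (T ∘ beta) (map (y ∷_) (horizontalStrips xs))) (interval l x)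
      ≈⟨ sumOver-concatMap (T ∘ beta) _ (interval l x) ⟨
    sumOver (T ∘ beta) (horizontalStrips (x ∷ xs)) ∎
    where
    n = length xs
    l = firstPart xs
    F = λ m → integrate initial (T ∘ (m ∷_)) (beta xs)
    l≤1+x : l ≤ suc x
    l≤1+x = ℕₚ.m≤n⇒m≤1+n (descending-first d)
    eq : x ℕ.+ suc n ≡ l ℕ.+ n ℕ.+ (suc x ∸ l)
    eq = ≡.trans (ℕₚ.+-suc x n) (≡.trans (≡.cong (ℕ._+ n) (≡.sym (ℕₚ.m+[n∸m]≡n l≤1+x)))
      (≡.trans (ℕₚ.+-assoc l (suc x ∸ l) n) (≡.trans (≡.cong (l ℕ.+_) (ℕₚ.+-comm (suc x ∸ l) n)) (≡.sym (ℕₚ.+-assoc l n (suc x ∸ l))))))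
    row : ∀ y → sumOver (T ∘ beta) (map (y ∷_) (horizontalStrips xs)) ≈ sumOver (T ∘ ((y ℕ.+ suc n) ∷_) ∘ beta) (horizontalStrips xs)
    row y = trans (sumOver-map (T ∘ beta) (y ∷_) (horizontalStrips xs))
      (sumOver-cong (All.map (λ {ys} e → reflexive (≡.cong (λ m → T ((y ℕ.+ suc m) ∷ beta ys)) (horizontal-length e))) (horizontalStrips-sound xs)))

  -- The row form of `h_m + a h_(m−1)`: passing to `ℕ.pred p` removes one cell of the row at the
  -- price `a`.
  down : Kernel
  down p = (1# , p) ∷ (a , ℕ.pred p) ∷ []

  VanishesAtZero : Functional → Set _
  VanishesAtZero T = ∀ pre → T (pre ++ 0 ∷ []) ≈ 0#

  -- The kernel would also lower a zero part to -1; this shows that such terms drop out. The rows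
  -- below are zero too. If the next one is kept, its index collides with the lowered one; if it is
  -- lowered as well, the argument moves on, until the last row receives the index 0.
  integrate-down-zeros : ∀ {T ys} → Alternating T → VanishesAtZero T → Descending 0 ys →
    integrate down (T ∘ (length ys ∷_)) (beta ys) ≈ 0#
  integrate-down-zeros alt T0 [] = T0 []
  integrate-down-zeros {T} {ys = 0 ∷ ys} alt T0 (z≤n ∷ d) = begin
    1# * integrate down (T ∘ (suc m ∷_) ∘ (suc m ∷_)) (beta ys) + (a * integrate down (T ∘ (suc m ∷_) ∘ (m ∷_)) (beta ys) + 0#)
      ≈⟨ +-cong (*-congˡ (trans (integrate-cong down (alt .vanish [] (suc m)) (beta ys)) (integrate-0 down (beta ys))))
                (+-congʳ (*-congˡ (integrate-down-zeros (alternating-∷ (suc m) alt) (λ pre → T0 (suc m ∷ pre)) d))) ⟩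
    1# * 0# + (a * 0# + 0#)
      ≈⟨ solve 1 (λ a → con 1ℤ :* con 0ℤ :+ (a :* con 0ℤ :+ con 0ℤ) := con 0ℤ) refl a ⟩
    0# ∎
    where m = length ys

  integrate-down : ∀ {T b xs} → Alternating T → VanishesAtZero T → Descending b xs →
    integrate down T (beta xs) ≈ sumOver (λ ys → a ^ (sum xs ∸ sum ys) * T (beta ys)) (verticalStrips xs)
  integrate-down {T} alt T0 [] = sym (trans (+-identityʳ _) (*-identityˡ _))
  integrate-down {T} {xs = zero ∷ xs} alt T0 (_ ∷ d) = begin
    1# * integrate down (T ∘ (suc m ∷_)) (beta xs) + (a * integrate down (T ∘ (m ∷_)) (beta xs) + 0#)
      ≈⟨ +-cong (*-congˡ (integrate-down (alternating-∷ (suc m) alt) (λ pre → T0 (suc m ∷ pre)) d))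
                (+-congʳ (*-congˡ (integrate-down-zeros alt T0 d))) ⟩
    1# * S + (a * 0# + 0#)
      ≈⟨ solve 2 (λ x a → con 1ℤ :* x :+ (a :* con 0ℤ :+ con 0ℤ) := x) refl _ _ ⟩
    S
      ≈⟨ sumOver-cong (All.map (λ {ys} v → *-congˡ (reflexive (≡.cong (λ m → T (suc m ∷ beta ys)) (≡.sym (vertical-length v))))) (verticalStrips-sound xs)) ⟩
    sumOver (λ ys → a ^ (sum xs ∸ sum ys) * T (beta (0 ∷ ys))) (verticalStrips xs)
      ≈⟨ sumOver-map _ (0 ∷_) (verticalStrips xs) ⟨
    sumOver (λ ys → a ^ (sum xs ∸ sum ys) * T (beta ys)) (map (0 ∷_) (verticalStrips xs)) ∎
    where
    m = length xs
    S = sumOver (λ ys → a ^ (sum xs ∸ sum ys) * T (suc m ∷ beta ys)) (verticalStrips xs)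
  integrate-down {T} {xs = suc x ∷ xs} alt T0 (_ ∷ d) = begin
    1# * integrate down (T ∘ (suc (x ℕ.+ suc m) ∷_)) (beta xs) + (a * integrate down (T ∘ ((x ℕ.+ suc m) ∷_)) (beta xs) + 0#)
      ≈⟨ +-cong (*-identityˡ _) (+-identityʳ _) ⟩
    integrate down (T ∘ (suc (x ℕ.+ suc m) ∷_)) (beta xs) + a * integrate down (T ∘ ((x ℕ.+ suc m) ∷_)) (beta xs)
      ≈⟨ +-cong (integrate-down (alternating-∷ _ alt) (λ pre → T0 (_ ∷ pre)) d)
                (trans (*-congˡ (integrate-down (alternating-∷ _ alt) (λ pre → T0 (_ ∷ pre)) d)) (sym (sumOver-* a _ (verticalStrips xs)))) ⟩
    sumOver (λ ys → a ^ (sum xs ∸ sum ys) * T (suc (x ℕ.+ suc m) ∷ beta ys)) (verticalStrips xs) +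
    sumOver (λ ys → a * (a ^ (sum xs ∸ sum ys) * T ((x ℕ.+ suc m) ∷ beta ys))) (verticalStrips xs)
      ≈⟨ +-cong (sumOver-cong (All.map (λ {ys} v → *-cong (^-congʳ a (≡.sym (ℕₚ.[m+n]∸[m+o]≡n∸o (suc x) (sum xs) (sum ys))))
                   (reflexive (≡.cong (λ m → T (suc (x ℕ.+ suc m) ∷ beta ys)) (≡.sym (vertical-length v))))) (verticalStrips-sound xs)))
                (sumOver-cong (All.map (λ {ys} v → trans (sym (*-assoc _ _ _)) (*-cong (^-congʳ a (exponent {ys} (vertical-sum v)))
                   (reflexive (≡.cong (λ m → T ((x ℕ.+ suc m) ∷ beta ys)) (≡.sym (vertical-length v)))))) (verticalStrips-sound xs))) ⟩
    sumOver (λ ys → G (suc x ∷ ys)) (verticalStrips xs) + sumOver (λ ys → G (x ∷ ys)) (verticalStrips xs)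
      ≈⟨ +-cong (sumOver-map G (suc x ∷_) (verticalStrips xs)) (sumOver-map G (x ∷_) (verticalStrips xs)) ⟨
    sumOver G (map (suc x ∷_) (verticalStrips xs)) + sumOver G (map (x ∷_) (verticalStrips xs))
      ≈⟨ sumOver-++ G (map (suc x ∷_) (verticalStrips xs)) ⟨
    sumOver G (verticalStrips (suc x ∷ xs)) ∎
    where
    m = length xs
    G = λ ys → a ^ (sum (suc x ∷ xs) ∸ sum ys) * T (beta ys)
    exponent : ∀ {ys} → sum ys ≤ sum xs → suc (sum xs ∸ sum ys) ≡ suc x ℕ.+ sum xs ∸ (x ℕ.+ sum ys)
    exponent {ys} s = ≡.sym (≡.trans
      (≡.cong (_∸ (x ℕ.+ sum ys)) (≡.sym (ℕₚ.+-suc x (sum xs))))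
      (≡.trans (ℕₚ.[m+n]∸[m+o]≡n∸o x (suc (sum xs)) (sum ys)) (ℕₚ.+-∸-assoc 1 s)))

  ascent-vanish : ∀ {T ys} → Alternating T → Ascent ys → T (beta ys) ≈ 0#
  ascent-vanish {T} alt (here {y} {ys}) = trans
    (reflexive (≡.cong (λ p → T (p ∷ (suc y ℕ.+ suc (length ys)) ∷ beta ys)) (ℕₚ.+-suc y (suc (length ys)))))
    (alt .vanish [] (suc y ℕ.+ suc (length ys)) (beta ys))
  ascent-vanish alt (there {y} {ys} asc) = ascent-vanish (alternating-∷ (y ℕ.+ suc (length ys)) alt) asc

  hookProduct-zeros : ∀ i {ys} → sum ys ≡ 0 → hookProduct i ys ≈ 1#
  hookProduct-zeros i {[]}        e = refl
  hookProduct-zeros i {zero ∷ ys} e =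
    trans (*-cong (*-identityˡ 1#) (hookProduct-zeros (suc i) {ys} e)) (*-identityˡ 1#)

  stripSum : List ℕ → Carrier
  stripSum ys = sumOver (λ zs → a ^ (sum ys ∸ sum zs) * jacobiTrudi 0 zs) (verticalStrips ys)

  module _ (geo-inverse : ∀ m → geo m * (1# - q ^ suc m) ≈ 1#)
           (q-cancel : ∀ {x y} → q * x ≈ q * y → x ≈ y) where

    open Evaluation geo-inverse

    ^-cancel : ∀ n {x y} → q ^ n * x ≈ q ^ n * y → x ≈ y
    ^-cancel zero    e = trans (sym (*-identityˡ _)) (trans e (*-identityˡ _))
    ^-cancel (suc n) e = ^-cancel n (q-cancel (trans (sym (*-assoc _ _ _)) (trans e (*-assoc _ _ _))))

    productTo-cancel : ∀ n {x y} → productTo (λ k → q ^ suc k) n * x ≈ productTo (λ k → q ^ suc k) n * y → x ≈ y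
    productTo-cancel zero    e = trans (sym (*-identityˡ _)) (trans e (*-identityˡ _))
    productTo-cancel (suc n) e = ^-cancel (suc n) (productTo-cancel n (trans (sym (*-assoc _ _ _)) (trans e (*-assoc _ _ _))))

    difference : ℕ → ℕ → Carrier
    difference k p = entry 0 k p - entry 0 k (ℕ.pred p)

    -- A rearrangement of `h-step` at `i = 0`. The last factor has the form to which
    -- `weighted (down p)` computes.
    h-difference : ∀ m z → q ^ z * (h 0 m - h⁻ 0 m) ≈ q ^ (z ℕ.+ m) * (1# * h 0 m + (a * h⁻ 0 m + 0#))
    h-difference zero    z = trans (*-congʳ (^-congʳ q (≡.sym (ℕₚ.+-identityʳ z))))
      (solve 2 (λ x a → x :* (con 1ℤ :- con 0ℤ) := x :* (con 1ℤ :* con 1ℤ :+ (a :* con 0ℤ :+ con 0ℤ))) refl _ a)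
    h-difference (suc m) z = begin
      q ^ z * (h 0 (suc m) - h 0 m)
        ≈⟨ solve 4 (λ Z X h′ h → Z :* (h′ :- h) := Z :* (((con 1ℤ :- X) :* h′ :- h) :+ X :* h′)) refl (q ^ z) X _ _ ⟩
      q ^ z * (((1# - X) * h 0 (suc m) - h 0 m) + X * h 0 (suc m))
        ≈⟨ *-congˡ (+-congʳ (+-congʳ (h-step 0 m))) ⟩
      q ^ z * (((1# + a * X) * h 0 m - h 0 m) + X * h 0 (suc m))
        ≈⟨ solve 5 (λ Z X h′ h a → Z :* (((con 1ℤ :+ a :* X) :* h :- h) :+ X :* h′) := (Z :* X) :* (con 1ℤ :* h′ :+ (a :* h :+ con 0ℤ)))
             refl (q ^ z) X _ _ a ⟩
      q ^ z * X * (1# * h 0 (suc m) + (a * h 0 m + 0#))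
        ≈⟨ *-congʳ (^-homo-* q z (suc m)) ⟨
      q ^ (z ℕ.+ suc m) * (1# * h 0 (suc m) + (a * h 0 m + 0#)) ∎
      where X = q ^ suc m

    -- The exponent of `q` in the relation for `h` is `p − k − 1` and mixes row and column.
    -- Multiplying by `q ^ suc k` separates them: the left-hand power depends on the column only,
    -- the right-hand one on the row only, so both can be taken out of the determinant. By
    -- `product∷-beta` their quotient is `q ^ sum ys`.
    difference-down : ∀ k p → q ^ suc k * difference k p ≈ q ^ p * weighted (down p) (entry 0 k)
    difference-down k p with p ≤? k
    ... | yes p≤k rewrite ℕₚ.m≤n⇒m∸n≡0 p≤k | ℕₚ.m≤n⇒m∸n≡0 (ℕₚ.≤-trans (ℕₚ.pred[n]≤n {p}) p≤k) =
      solve 3 (λ x y a → x :* (con 0ℤ :- con 0ℤ) := y :* (con 1ℤ :* con 0ℤ :+ (a :* con 0ℤ :+ con 0ℤ))) refl _ _ a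
    ... | no p≰k with ℕₚ.m≤n⇒∃[o]m+o≡n (ℕₚ.≰⇒> p≰k)
    ...   | m , ≡.refl
      rewrite ≡.sym (ℕₚ.+-suc k m) | ℕₚ.m+n∸m≡n k (suc m) | ℕₚ.+-suc k m | ℕₚ.m+n∸m≡n k m = h-difference m (suc k)

    product∷-beta : ∀ ys → product∷ (q ^_) (beta ys) ≈ q ^ sum ys * productTo (λ k → q ^ suc k) (length ys)
    product∷-beta []       = sym (*-identityˡ _)
    product∷-beta (y ∷ ys) = begin
      q ^ (y ℕ.+ suc n) * product∷ (q ^_) (beta ys)
        ≈⟨ *-cong (^-homo-* q y (suc n)) (product∷-beta ys) ⟩
      q ^ y * q ^ suc n * (q ^ sum ys * productTo (λ k → q ^ suc k) n)
        ≈⟨ solve 4 (λ a b c d → a :* b :* (c :* d) := (a :* c) :* (d :* b)) refl _ _ _ _ ⟩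
      (q ^ y * q ^ sum ys) * (productTo (λ k → q ^ suc k) n * q ^ suc n)
        ≈⟨ *-congʳ (^-homo-* q y (sum ys)) ⟨
      q ^ (y ℕ.+ sum ys) * (productTo (λ k → q ^ suc k) n * q ^ suc n) ∎
      where n = length ys

    entry-zero : ∀ k → entry 0 k 0 ≈ 0#
    entry-zero k = reflexive (≡.cong (h⁻ 0) (ℕₚ.0∸n≡0 k))

    stripSum-zeros : ∀ {b ys} → Descending b ys → sum ys ≡ 0 → stripSum ys ≈ 1#
    stripSum-zeros {ys = ys} d e = trans (reflexive (≡.cong (sumOver (λ zs → a ^ (sum ys ∸ sum zs) * jacobiTrudi 0 zs)) (verticalStrips-zeros {ys} e)))
      (trans (+-identityʳ _) (trans (*-cong (^-congʳ a (ℕₚ.n∸n≡0 (sum ys)))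
        (trans (jacobiTrudi≈hookProduct 0 d) (hookProduct-zeros 0 {ys} e))) (*-identityˡ 1#)))

    -- `Q` collects the column factors `q ^ suc k`. As `q` is not invertible among power series, `Q`
    -- is carried along on both sides and cancelled at the end.
    jacobiTrudi-recursion : ∀ {b xs} → Descending b xs →
      jacobiTrudi 0 xs ≈ sumOver (λ ys → q ^ sum ys * stripSum ys) (horizontalStrips xs)
    jacobiTrudi-recursion {b} {xs} d = productTo-cancel n (begin
      Q * alternant (entry 0) n (beta xs)
        ≈⟨ *-congˡ (alternant-cong (λ k p → sym (weighted-telescope (entry 0 k) (entry-zero k) p)) n (beta xs)) ⟩
      Q * alternant (λ k p → weighted (initial p) (difference k)) n (beta xs)
        ≈⟨ *-congˡ (sym (integrate-alternant initial difference n (beta xs))) ⟩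
      Q * integrate initial (alternant difference n) (beta xs)
        ≈⟨ *-congˡ (integrate-initial (alternant-alternating difference n) d) ⟩
      Q * sumOver (λ ys → alternant difference n (beta ys)) (horizontalStrips xs)
        ≈⟨ sumOver-* Q _ (horizontalStrips xs) ⟨
      sumOver (λ ys → Q * alternant difference n (beta ys)) (horizontalStrips xs)
        ≈⟨ sumOver-cong (All.map (λ v → strip v) (horizontalStrips-sound xs)) ⟩
      sumOver (λ ys → Q * (q ^ sum ys * stripSum ys)) (horizontalStrips xs)
        ≈⟨ sumOver-* Q _ (horizontalStrips xs) ⟩
      Q * sumOver (λ ys → q ^ sum ys * stripSum ys) (horizontalStrips xs) ∎)
      where
      n = length xs
      Q = productTo (λ k → q ^ suc k) n
      strip : ∀ {ys} → Horizontal xs ys → Q * alternant difference n (beta ys) ≈ Q * (q ^ sum ys * stripSum ys)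
      strip {ys} v = begin
        Q * alternant difference n (beta ys)
          ≈⟨ alternant-columnScale (λ k → q ^ suc k) difference n (beta ys) ⟨
        alternant (λ k p → q ^ suc k * difference k p) n (beta ys)
          ≈⟨ alternant-rowScale {P = λ _ → ⊤} {v = λ k p → weighted (down p) (entry 0 k)} {w = q ^_}
               (λ k {p} _ → difference-down k p) n (All.universal (λ _ → tt) (beta ys)) ⟩
        product∷ (q ^_) (beta ys) * alternant (λ k p → weighted (down p) (entry 0 k)) n (beta ys)
          ≈⟨ *-cong (product∷-beta ys) (sym (integrate-alternant down (entry 0) n (beta ys))) ⟩
        q ^ sum ys * productTo (λ k → q ^ suc k) (length ys) * integrate down (alternant (entry 0) n) (beta ys)
          ≈⟨ *-cong (*-congˡ (reflexive (≡.cong (productTo (λ k → q ^ suc k)) (horizontal-length v))))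
               (integrate-down (alternant-alternating (entry 0) n) (λ pre → alternant-zeroRow entry-zero n pre [])
                  (horizontal-descending (descending-first d) v)) ⟩
        q ^ sum ys * Q * sumOver (λ zs → a ^ (sum ys ∸ sum zs) * alternant (entry 0) n (beta zs)) (verticalStrips ys)
          ≈⟨ *-congˡ (sumOver-cong (All.map (λ {zs} w → *-congˡ (reflexive (≡.cong (λ m → alternant (entry 0) m (beta zs))
               (≡.sym (≡.trans (vertical-length w) (horizontal-length v)))))) (verticalStrips-sound ys))) ⟩
        q ^ sum ys * Q * stripSum ys
          ≈⟨ solve 3 (λ x y z → x :* y :* z := y :* (x :* z)) refl _ _ _ ⟩
        Q * (q ^ sum ys * stripSum ys) ∎

-- Formal power series over a commutative ring.

module PowerSeries {c ℓ} (S : CommutativeRing c ℓ) where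

  open CommutativeRing S hiding (zero)
  open import Relation.Binary.Reasoning.Setoid setoid
  open IntegerSolver S

  Series : Set c
  Series = ℕ → Carrier

  _≋_ : Series → Series → Set ℓ
  f ≋ g = ∀ n → f n ≈ g n

  sumTo : ℕ → Series → Carrier
  sumTo zero    f = f 0
  sumTo (suc n) f = sumTo n f + f (suc n)

  _⊕_ _⊗_ : Series → Series → Series
  (f ⊕ g) n = f n + g n
  (f ⊗ g) n = sumTo n (λ i → f i * g (n ∸ i))

  scalar : Carrier → Series
  scalar s zero    = s
  scalar s (suc n) = 0#

  tail : Series → Series
  tail f n = f (suc n)

  sumTo-cong : ∀ n {f g} → (∀ i → i ≤ n → f i ≈ g i) → sumTo n f ≈ sumTo n g
  sumTo-cong zero    f≈g = f≈g 0 z≤n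
  sumTo-cong (suc n) f≈g = +-cong (sumTo-cong n (λ i i≤n → f≈g i (ℕₚ.m≤n⇒m≤1+n i≤n))) (f≈g (suc n) ℕₚ.≤-refl)

  sumTo-0 : ∀ n → sumTo n (λ _ → 0#) ≈ 0#
  sumTo-0 zero    = refl
  sumTo-0 (suc n) = trans (+-congʳ (sumTo-0 n)) (+-identityˡ 0#)

  sumTo-+ : ∀ n f g → sumTo n (f ⊕ g) ≈ sumTo n f + sumTo n g
  sumTo-+ zero    f g = refl
  sumTo-+ (suc n) f g = trans (+-congʳ (sumTo-+ n f g))
    (solve 4 (λ a b c d → (a :+ b) :+ (c :+ d) := (a :+ c) :+ (b :+ d)) refl _ _ _ _)

  sumTo-* : ∀ n s f → sumTo n (λ i → s * f i) ≈ s * sumTo n f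
  sumTo-* zero    s f = refl
  sumTo-* (suc n) s f = trans (+-congʳ (sumTo-* n s f)) (sym (distribˡ s _ _))

  sumTo-suc : ∀ n f → sumTo (suc n) f ≈ f 0 + sumTo n (tail f)
  sumTo-suc zero    f = refl
  sumTo-suc (suc n) f = trans (+-congʳ (sumTo-suc n f)) (+-assoc _ _ _)

  ⊗-cong : ∀ {f f′ g g′} → f ≋ f′ → g ≋ g′ → (f ⊗ g) ≋ (f′ ⊗ g′)
  ⊗-cong f≋ g≋ n = sumTo-cong n (λ i _ → *-cong (f≋ i) (g≋ (n ∸ i)))

  ⊗-front : ∀ f g n → (f ⊗ g) (suc n) ≈ f 0 * g (suc n) + (tail f ⊗ g) n
  ⊗-front f g n = sumTo-suc n _

  -- The mirror image of `⊗-front`; matching the two turns commutativity into an induction on the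
  -- degree.
  ⊗-back : ∀ f g n → (f ⊗ g) (suc n) ≈ (f ⊗ tail g) n + f (suc n) * g 0
  ⊗-back f g n = +-cong (sumTo-cong n (λ i i≤n → *-congˡ (reflexive (≡.cong g (ℕₚ.+-∸-assoc 1 i≤n)))))
                        (*-congˡ (reflexive (≡.cong g (ℕₚ.n∸n≡0 n))))

  ⊗-comm : ∀ f g → (f ⊗ g) ≋ (g ⊗ f)
  ⊗-comm f g zero    = *-comm _ _
  ⊗-comm f g (suc n) = begin
    (f ⊗ g) (suc n)                       ≈⟨ ⊗-front f g n ⟩
    f 0 * g (suc n) + (tail f ⊗ g) n      ≈⟨ +-cong (*-comm _ _) (⊗-comm (tail f) g n) ⟩
    g (suc n) * f 0 + (g ⊗ tail f) n      ≈⟨ +-comm _ _ ⟩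
    (g ⊗ tail f) n + g (suc n) * f 0      ≈⟨ ⊗-back g f n ⟨
    (g ⊗ f) (suc n)                       ∎

  ⊗-distribʳ : ∀ f g h → ((g ⊕ h) ⊗ f) ≋ ((g ⊗ f) ⊕ (h ⊗ f))
  ⊗-distribʳ f g h n = trans (sumTo-cong n (λ i _ → distribʳ _ _ _)) (sumTo-+ n _ _)

  ⊗-distribˡ : ∀ f g h → (f ⊗ (g ⊕ h)) ≋ ((f ⊗ g) ⊕ (f ⊗ h))
  ⊗-distribˡ f g h n = trans (sumTo-cong n (λ i _ → distribˡ _ _ _)) (sumTo-+ n _ _)

  ⊗-homogeneousˡ : ∀ s f g n → ((λ i → s * f i) ⊗ g) n ≈ s * (f ⊗ g) n
  ⊗-homogeneousˡ s f g n = trans (sumTo-cong n (λ i _ → *-assoc _ _ _)) (sumTo-* n s _)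

  ⊗-assoc : ∀ f g h → ((f ⊗ g) ⊗ h) ≋ (f ⊗ (g ⊗ h))
  ⊗-assoc f g h zero    = *-assoc _ _ _
  ⊗-assoc f g h (suc n) = begin
    ((f ⊗ g) ⊗ h) (suc n)
      ≈⟨ ⊗-front (f ⊗ g) h n ⟩
    f 0 * g 0 * h (suc n) + (tail (f ⊗ g) ⊗ h) n
      ≈⟨ +-congˡ (⊗-cong {g = h} (⊗-front f g) (λ _ → refl) n) ⟩
    f 0 * g 0 * h (suc n) + (((λ i → f 0 * tail g i) ⊕ (tail f ⊗ g)) ⊗ h) n
      ≈⟨ +-congˡ (⊗-distribʳ h _ _ n) ⟩
    f 0 * g 0 * h (suc n) + (((λ i → f 0 * tail g i) ⊗ h) n + ((tail f ⊗ g) ⊗ h) n)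
      ≈⟨ +-congˡ (+-cong (⊗-homogeneousˡ (f 0) (tail g) h n) (⊗-assoc (tail f) g h n)) ⟩
    f 0 * g 0 * h (suc n) + (f 0 * (tail g ⊗ h) n + (tail f ⊗ (g ⊗ h)) n)
      ≈⟨ solve 5 (λ a b c d e → a :* b :* c :+ (a :* d :+ e) := a :* (b :* c :+ d) :+ e) refl _ _ _ _ _ ⟩
    f 0 * (g 0 * h (suc n) + (tail g ⊗ h) n) + (tail f ⊗ (g ⊗ h)) n
      ≈⟨ +-congʳ (*-congˡ (⊗-front g h n)) ⟨
    f 0 * (g ⊗ h) (suc n) + (tail f ⊗ (g ⊗ h)) n
      ≈⟨ ⊗-front f (g ⊗ h) n ⟨
    (f ⊗ (g ⊗ h)) (suc n) ∎

  ⊗-scalar : ∀ s f n → (scalar s ⊗ f) n ≈ s * f n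
  ⊗-scalar s f zero    = refl
  ⊗-scalar s f (suc n) = trans (⊗-front (scalar s) f n)
    (trans (+-congˡ (trans (sumTo-cong n (λ i _ → zeroˡ _)) (sumTo-0 n))) (+-identityʳ _))

  ⊗-identityˡ : ∀ f → (scalar 1# ⊗ f) ≋ f
  ⊗-identityˡ f n = trans (⊗-scalar 1# f n) (*-identityˡ _)

  seriesRing : CommutativeRing c ℓ
  seriesRing = record
    { Carrier = Series
    ; _≈_     = _≋_
    ; _+_     = _⊕_
    ; _*_     = _⊗_
    ; -_      = λ f n → - f n
    ; 0#      = λ _ → 0#
    ; 1#      = scalar 1#
    ; isCommutativeRing = record
      { isRing = record
        { +-isAbelianGroup = record
          { isGroup = record
            { isMonoid = record
              { isSemigroup = record
                { isMagma = record
                  { isEquivalence = record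
                    { refl  = λ _ → refl
                    ; sym   = λ e n → sym (e n)
                    ; trans = λ d e n → trans (d n) (e n)
                    }
                  ; ∙-cong = λ d e n → +-cong (d n) (e n)
                  }
                ; assoc = λ f g h n → +-assoc _ _ _
                }
              ; identity = (λ f n → +-identityˡ _) , (λ f n → +-identityʳ _)
              }
            ; inverse = (λ f n → -‿inverseˡ _) , (λ f n → -‿inverseʳ _)
            ; ⁻¹-cong = λ e n → -‿cong (e n)
            }
          ; comm = λ f g n → +-comm _ _
          }
        ; *-cong     = ⊗-cong
        ; *-assoc    = ⊗-assoc
        ; *-identity = ⊗-identityˡ , (λ f n → trans (⊗-comm f (scalar 1#) n) (⊗-identityˡ f n))
        ; distrib    = ⊗-distribˡ , ⊗-distribʳ
        }
      ; *-comm = ⊗-comm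
      }
    }

  module Ser = CommutativeRing seriesRing
  open import Algebra.Properties.Semiring.Exp Ser.semiring using (_^_)
  open import Algebra.Properties.Semiring.Exp semiring using () renaming (_^_ to _S^_)

  X : Series
  X zero          = 0#
  X (suc zero)    = 1#
  X (suc (suc _)) = 0#

  X-zero : ∀ f → (X ⊗ f) 0 ≈ 0#
  X-zero f = zeroˡ _

  X-suc : ∀ f n → (X ⊗ f) (suc n) ≈ f n
  X-suc f n = begin
    (X ⊗ f) (suc n)                        ≈⟨ ⊗-front X f n ⟩
    0# * f (suc n) + (tail X ⊗ f) n        ≈⟨ +-cong (zeroˡ _) (⊗-cong {tail X} {scalar 1#} {f} tail-X (λ _ → refl) n) ⟩
    0# + (scalar 1# ⊗ f) n                 ≈⟨ trans (+-identityˡ _) (⊗-identityˡ f n) ⟩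
    f n                                    ∎
    where
    tail-X : tail X ≋ scalar 1#
    tail-X zero    = refl
    tail-X (suc _) = refl

  X-cancel : ∀ {f g} → (X ⊗ f) ≋ (X ⊗ g) → f ≋ g
  X-cancel {f} {g} e n = trans (sym (X-suc f n)) (trans (e (suc n)) (X-suc g n))

  X^-< : ∀ m f {n} → n ℕ.< m → ((X ^ m) ⊗ f) n ≈ 0#
  X^-< (suc m) f {n} n<m = trans (⊗-assoc X (X ^ m) f n) (go n n<m)
    where
    go : ∀ n → n ℕ.< suc m → (X ⊗ ((X ^ m) ⊗ f)) n ≈ 0#
    go zero    _         = X-zero ((X ^ m) ⊗ f)
    go (suc n) (s≤s n<m) = trans (X-suc ((X ^ m) ⊗ f) n) (X^-< m f n<m)

  X^-+ : ∀ m f n → ((X ^ m) ⊗ f) (m ℕ.+ n) ≈ f n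
  X^-+ zero    f n = ⊗-identityˡ f n
  X^-+ (suc m) f n = trans (⊗-assoc X (X ^ m) f (suc m ℕ.+ n)) (trans (X-suc ((X ^ m) ⊗ f) (m ℕ.+ n)) (X^-+ m f n))

  X^-coefficient : ∀ m n → (X ^ m) n ≈ (if n ≡ᵇ m then 1# else 0#)
  X^-coefficient zero    zero    = refl
  X^-coefficient zero    (suc n) = refl
  X^-coefficient (suc m) zero    = X-zero (X ^ m)
  X^-coefficient (suc m) (suc n) = trans (X-suc (X ^ m) n) (X^-coefficient m n)

  scalar-^ : ∀ s m f n → ((scalar s ^ m) ⊗ f) n ≈ ((s S^ m) * f n)
  scalar-^ s zero    f n = ⊗-scalar 1# f n
  scalar-^ s (suc m) f n = trans (⊗-assoc (scalar s) (scalar s ^ m) f n)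
    (trans (⊗-scalar s ((scalar s ^ m) ⊗ f) n) (trans (*-congˡ (scalar-^ s m f n)) (sym (*-assoc _ _ _))))

  geometric : ℕ → Series
  geometric m n = if ⌊ suc m ∣? n ⌋ then 1# else 0#

  -- Below `suc m` only 0 is divisible by `suc m`, which gives the constant term; from there on
  -- divisibility is periodic.
  geometric-fixpoint : ∀ m → geometric m ≋ (scalar 1# ⊕ ((X ^ suc m) ⊗ geometric m))
  geometric-fixpoint m n with n ℕ.<? suc m
  geometric-fixpoint m zero | yes n<1+m with suc m ∣? 0
  ... | yes _ = sym (trans (+-congˡ (X^-< (suc m) (geometric m) n<1+m)) (+-identityʳ _))
  ... | no ∤  = ⊥-elim (∤ (suc m ∣0))
  geometric-fixpoint m (suc n) | yes n<1+m with suc m ∣? suc n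
  ... | yes ∣ = ⊥-elim (ℕₚ.<⇒≱ n<1+m (∣⇒≤ ∣))
  ... | no _  = sym (trans (+-congˡ (X^-< (suc m) (geometric m) n<1+m)) (+-identityʳ _))
  geometric-fixpoint m n | no n≮1+m with ℕₚ.m≤n⇒∃[o]m+o≡n (ℕₚ.≮⇒≥ n≮1+m)
  ... | k , ≡.refl = sym (trans (+-identityˡ _) (trans (X^-+ (suc m) (geometric m) k) (periodic k)))
    where
    periodic : ∀ k → geometric m k ≈ geometric m (suc m ℕ.+ k)
    periodic k with suc m ∣? k | suc m ∣? (suc m ℕ.+ k)
    ... | yes _ | yes _ = refl
    ... | no _  | no _  = refl
    ... | yes d | no ∤  = ⊥-elim (∤ (∣m∣n⇒∣m+n ∣-refl d))
    ... | no ∤  | yes d = ⊥-elim (∤ (∣m+n∣m⇒∣n d ∣-refl))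

  geometric-inverse : ∀ m → (geometric m ⊗ (scalar 1# ⊕ λ n → - (X ^ suc m) n)) ≋ scalar 1#
  geometric-inverse m n = begin
    (G ⊗ (scalar 1# ⊕ λ n → - Y n)) n
      ≈⟨ distr n ⟩
    G n - (Y ⊗ G) n
      ≈⟨ +-congʳ (geometric-fixpoint m n) ⟩
    scalar 1# n + (Y ⊗ G) n - (Y ⊗ G) n
      ≈⟨ solve 2 (λ x y → x :+ y :- y := x) refl _ _ ⟩
    scalar 1# n ∎
    where
    G Y : Series
    G = geometric m
    Y = X ^ suc m
    module SS = IntegerSolver seriesRing
    distr : (G ⊗ (scalar 1# ⊕ λ n → - Y n)) ≋ (λ n → G n - (Y ⊗ G) n)
    distr = SS.solve 2 (λ g y → g SS.:* (SS.con 1ℤ SS.:- y) SS.:= g SS.:- y SS.:* g) Ser.refl G Y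

-- Products over cells, compared with products row by row.

cellsFrom : ℕ → List ℕ → List (ℕ × ℕ)
cellsFrom i []       = []
cellsFrom i (x ∷ xs) = map (λ j → i , j) (upTo x) ++ cellsFrom (suc i) xs

-- The worker of cells is local to it, hence the placeholder: it is solved by the use in cells≡cellsFrom.
worker≡cellsFrom : ∀ μ i xs → _ ≡ cellsFrom i xs

cells≡cellsFrom : ∀ μ → cells μ ≡ cellsFrom 0 μ
cells≡cellsFrom []       = ≡.refl
-- The local worker also depends on the outer list. Abstracting over that list and the counter makes
-- the arguments of the placeholder distinct variables, so that unification has a unique solution.
cells≡cellsFrom (x ∷ xs) with x ∷ xs | 1
... | μ | i = ≡.cong (map (λ j → 0 , j) (upTo x) ++_) (worker≡cellsFrom μ i xs)

worker≡cellsFrom μ i []       = ≡.refl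
worker≡cellsFrom μ i (x ∷ xs) = ≡.cong (map (λ j → i , j) (upTo x) ++_) (worker≡cellsFrom μ (suc i) xs)

cellsFrom-suc : ∀ i xs → cellsFrom (suc i) xs ≡ map (λ c → suc (proj₁ c) , proj₂ c) (cellsFrom i xs)
cellsFrom-suc i []       = ≡.refl
cellsFrom-suc i (x ∷ xs) = ≡.trans (≡.cong₂ _++_ (map-∘ (upTo x)) (cellsFrom-suc (suc i) xs)) (≡.sym (map-++ _ (map (λ j → i , j) (upTo x)) _))

cellsFrom-bounded : ∀ {b xs} i → Descending b xs → All (λ c → proj₂ c ℕ.< b) (cellsFrom i xs)
cellsFrom-bounded i []                             = []
cellsFrom-bounded {b} {x ∷ xs} i (x≤b ∷ d) = Allₚ.++⁺
  (Allₚ.map⁺ (All.map (λ j<x → ℕₚ.<-≤-trans j<x x≤b) (Allₚ.all-upTo x)))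
  (All.map (λ j<x → ℕₚ.<-≤-trans j<x x≤b) (cellsFrom-bounded (suc i) d))

hookPred-∷ : ∀ x xs {c} → proj₂ c ℕ.< x → hookPred (x ∷ xs) (suc (proj₁ c) , proj₂ c) ≡ hookPred xs c
hookPred-∷ x xs {i , j} j<x = ≡.cong (λ m → (part xs i ∸ suc j) ℕ.+ (m ∸ suc (suc i))) (conj-accept {x} {xs} j<x)

module CellProducts {c ℓ} (R : CommutativeRing c ℓ)
  (q a : CommutativeRing.Carrier R) (geo : ℕ → CommutativeRing.Carrier R) where

  open CommutativeRing R hiding (zero)
  open import Algebra.Properties.Semiring.Exp semiring using (_^_)
  open import Relation.Binary.Reasoning.Setoid setoid
  open IntegerSolver R
  open Hypergeometric R q a geo using (hookProduct; productTo-cong)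
  open Alternant R ℕ using (productTo)
  open Alternant R (ℕ × ℕ) using (product∷)

  product∷-++ : ∀ f cs ds → product∷ f (cs ++ ds) ≈ product∷ f cs * product∷ f ds
  product∷-++ f []       ds = sym (*-identityˡ _)
  product∷-++ f (c ∷ cs) ds = trans (*-congˡ (product∷-++ f cs ds)) (sym (*-assoc _ _ _))

  product∷-map : ∀ f g cs → product∷ f (map g cs) ≈ product∷ (f ∘ g) cs
  product∷-map f g []       = refl
  product∷-map f g (c ∷ cs) = *-congˡ (product∷-map f g cs)

  product∷-cong : ∀ {f g cs} → All (λ c → f c ≈ g c) cs → product∷ f cs ≈ product∷ g cs
  product∷-cong []       = refl
  product∷-cong (e ∷ es) = *-cong e (product∷-cong es)

  product∷-row : ∀ f i x → product∷ f (map (λ j → i , j) (upTo x)) ≈ productTo (λ j → f (i , j)) x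
  product∷-row f i zero    = refl
  product∷-row f i (suc x) = begin
    product∷ f (map (λ j → i , j) (upTo (suc x)))
      ≡⟨ ≡.cong (λ js → product∷ f (map (λ j → i , j) js)) (≡.sym (upTo-∷ʳ x)) ⟩
    product∷ f (map (λ j → i , j) (upTo x ∷ʳ x))
      ≡⟨ ≡.cong (product∷ f) (map-++ _ (upTo x) _) ⟩
    product∷ f (map (λ j → i , j) (upTo x) ++ (i , x) ∷ [])
      ≈⟨ product∷-++ f (map (λ j → i , j) (upTo x)) _ ⟩
    product∷ f (map (λ j → i , j) (upTo x)) * (f (i , x) * 1#)
      ≈⟨ *-cong (product∷-row f i x) (*-identityʳ _) ⟩
    productTo (λ j → f (i , j)) (suc x) ∎

  numerator : ℕ × ℕ → Carrier
  numerator (i , j) = q ^ i + a * q ^ suc j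

  -- The numerators count rows from `i`, but the hooks from 0, because `hookPred` looks rows up in
  -- the list it is given. Hooks of the lower rows are unaffected by the first row, which is at
  -- least as long and so adds one to both the conjugate part and the row index.
  product∷≈hookProduct : ∀ {b xs} i → Descending b xs →
    product∷ numerator (cellsFrom i xs) * product∷ (geo ∘ hookPred xs) (cellsFrom 0 xs) ≈ hookProduct i xs
  product∷≈hookProduct i [] = *-identityˡ 1#
  product∷≈hookProduct {xs = x ∷ xs} i (_ ∷ d) = begin
    product∷ numerator (cellsFrom i (x ∷ xs)) * product∷ (geo ∘ hookPred (x ∷ xs)) (cellsFrom 0 (x ∷ xs))
      ≈⟨ *-cong (trans (product∷-++ numerator (map (λ j → i , j) (upTo x)) _) (*-congʳ (product∷-row numerator i x)))
                (trans (product∷-++ (geo ∘ hookPred (x ∷ xs)) (map (λ j → 0 , j) (upTo x)) _)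
                  (*-cong (trans (product∷-row (geo ∘ hookPred (x ∷ xs)) 0 x) firstRow) laterRows)) ⟩
    N * product∷ numerator (cellsFrom (suc i) xs) * (H * product∷ (geo ∘ hookPred xs) (cellsFrom 0 xs))
      ≈⟨ solve 4 (λ a b c d → a :* b :* (c :* d) := a :* c :* (b :* d)) refl _ _ _ _ ⟩
    N * H * (product∷ numerator (cellsFrom (suc i) xs) * product∷ (geo ∘ hookPred xs) (cellsFrom 0 xs))
      ≈⟨ *-congˡ (product∷≈hookProduct (suc i) d) ⟩
    N * H * hookProduct (suc i) xs ∎
    where
    N = productTo (λ j → numerator (i , j)) x
    H = productTo (λ j → geo (x ∸ suc j ℕ.+ conj xs j)) x
    firstRow : productTo (λ j → geo (hookPred (x ∷ xs) (0 , j))) x ≈ H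
    firstRow = productTo-cong x (λ j j<x → reflexive (≡.cong (λ m → geo (x ∸ suc j ℕ.+ (m ∸ 1))) (conj-accept {x} {xs} j<x)))
    laterRows : product∷ (geo ∘ hookPred (x ∷ xs)) (cellsFrom 1 xs) ≈ product∷ (geo ∘ hookPred xs) (cellsFrom 0 xs)
    laterRows = begin
      product∷ (geo ∘ hookPred (x ∷ xs)) (cellsFrom 1 xs)
        ≡⟨ ≡.cong (product∷ _) (cellsFrom-suc 0 xs) ⟩
      product∷ (geo ∘ hookPred (x ∷ xs)) (map _ (cellsFrom 0 xs))
        ≈⟨ product∷-map _ _ (cellsFrom 0 xs) ⟩
      product∷ (λ c → geo (hookPred (x ∷ xs) (suc (proj₁ c) , proj₂ c))) (cellsFrom 0 xs)
        ≈⟨ product∷-cong (All.map (λ j<x → reflexive (≡.cong geo (hookPred-∷ x xs j<x))) (cellsFrom-bounded 0 d)) ⟩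
      product∷ (geo ∘ hookPred xs) (cellsFrom 0 xs) ∎

-- Tableaux over the interleaved alphabet: peeling off and restoring the least letter.

module Tableaux where

  open import Data.Nat using (_+_)

  open Equivalence using (to; from)
  open Sums ℤₚ.+-*-commutativeRing using (sumOver)

  -- The cardinality is an integer because it will be a coefficient of a determinant, whose
  -- expansion has signs. That it is not negative is part of what gets proved.
  HasCard : ∀ {a p} {A : Set a} → (A → Set p) → ℤ → Set _
  HasCard {A = A} P z = Σ (List A) λ L → Unique L × (∀ x → (x ∈ L) ⇔ P x) × + length L ≡ z

  hasCard-empty : ∀ {a p} {A : Set a} {P : A → Set p} → (∀ x → ¬ P x) → HasCard P 0ℤ
  hasCard-empty ¬P = [] , [] , (λ x → mk⇔ (λ ()) (λ p → ⊥-elim (¬P x p))) , ≡.refl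

  hasCard-singleton : ∀ {a p} {A : Set a} {P : A → Set p} x → P x → (∀ y → P y → y ≡ x) → HasCard P 1ℤ
  hasCard-singleton x px unique =
    x ∷ [] , [] ∷ [] , (λ y → mk⇔ (λ { (here ≡.refl) → px }) (λ py → here (unique y py))) , ≡.refl

  unique-map : ∀ {a b} {A : Set a} {B : Set b} {f : A → B} {xs} →
               (∀ {x y} → x ∈ xs → y ∈ xs → f x ≡ f y → x ≡ y) → Unique xs → Unique (map f xs)
  unique-map inj []       = []
  unique-map inj (x∉ ∷ u) =
    Allₚ.map⁺ (All.tabulate λ y∈ fx≡fy → All.lookup x∉ y∈ (inj (here ≡.refl) (there y∈) fx≡fy)) ∷
    unique-map (λ x∈ y∈ → inj (there x∈) (there y∈)) u

  hasCard-bijection : ∀ {a b p r} {A : Set a} {B : Set b} {P : A → Set p} {Q : B → Set r} {z} (f : A → B) (g : B → A) →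
    (∀ {x} → P x → Q (f x)) → (∀ {y} → Q y → P (g y)) →
    (∀ {x} → P x → g (f x) ≡ x) → (∀ {y} → Q y → f (g y) ≡ y) →
    HasCard P z → HasCard Q z
  hasCard-bijection {P = P} {Q} f g P⇒Q Q⇒P gf fg (L , u , L⇔P , len) =
    map f L ,
    unique-map (λ {x} {y} x∈ y∈ fx≡fy → ≡.trans (≡.sym (gf (to (L⇔P x) x∈))) (≡.trans (≡.cong g fx≡fy) (gf (to (L⇔P y) y∈)))) u ,
    (λ y → mk⇔ (λ y∈ → sound y (∈-map⁻ f y∈))
               (λ qy → ≡.subst (_∈ map f L) (fg qy) (∈-map⁺ f (from (L⇔P (g y)) (Q⇒P qy))))) ,
    ≡.trans (≡.cong +_ (length-map f L)) len
    where
    sound : ∀ y → Σ _ (λ x → x ∈ L × y ≡ f x) → Q y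
    sound y (x , x∈ , ≡.refl) = P⇒Q (to (L⇔P x) x∈)

  hasCard-⇔ : ∀ {a p r} {A : Set a} {P : A → Set p} {Q : A → Set r} {z} → (∀ {x} → P x → Q x) → (∀ {x} → Q x → P x) → HasCard P z → HasCard Q z
  hasCard-⇔ P⇒Q Q⇒P = hasCard-bijection (λ x → x) (λ x → x) P⇒Q Q⇒P (λ _ → ≡.refl) (λ _ → ≡.refl)

  -- `κ` recovers the index from the element, which makes the pieces disjoint.
  hasCard-⋃ : ∀ {a i p} {A : Set a} {I : Set i} (Q : I → A → Set p) (κ : A → I) {z : I → ℤ} →
    (∀ {i x} → Q i x → κ x ≡ i) → ∀ {is} → Unique is → All (λ i → HasCard (Q i) (z i)) is →
    HasCard (λ x → κ x ∈ is × Q (κ x) x) (sumOver z is)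
  hasCard-⋃ Q κ Q⇒κ []           []       = hasCard-empty (λ x ())
  hasCard-⋃ Q κ {z} Q⇒κ {i ∷ is} (i∉ ∷ u) ((L , uL , L⇔ , len) ∷ cs) with hasCard-⋃ Q κ {z} Q⇒κ u cs
  ... | (M , uM , M⇔ , lenM) =
    L ++ M ,
    Unique.++⁺ uL uM (λ { {x} (x∈L , x∈M) → All.lookup i∉ (proj₁ (to (M⇔ x) x∈M)) (≡.sym (Q⇒κ (to (L⇔ x) x∈L))) }) ,
    (λ x → mk⇔ (λ x∈ → [ (λ x∈L → inL x (to (L⇔ x) x∈L)) , (λ x∈M → inM x (to (M⇔ x) x∈M)) ]′ (∈-++⁻ L x∈))
               (λ { (here eq , q) → ∈-++⁺ˡ (from (L⇔ x) (≡.subst (λ j → Q j x) eq q))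
                  ; (there k∈ , q) → ∈-++⁺ʳ L (from (M⇔ x) (k∈ , q)) })) ,
    ≡.trans (≡.cong +_ (length-++ L)) (≡.cong₂ ℤ._+_ len lenM)
    where
    inL : ∀ x → Q i x → κ x ∈ i ∷ is × Q (κ x) x
    inL x q = here (Q⇒κ q) , ≡.subst (λ j → Q j x) (≡.sym (Q⇒κ q)) q
    inM : ∀ x → κ x ∈ is × Q (κ x) x → κ x ∈ i ∷ is × Q (κ x) x
    inM x (k∈ , q) = there k∈ , q

  -- A code t stands for the letter t of the alphabet 0 < 1̄ < 1 < 2̄ < 2 < …; in phase p = true the
  -- least letter may repeat in rows but not in columns, in phase p = false it is the other way round.
  -- Deleting the least letter and renumbering exchanges the two phases.
  Rel : Bool → ℕ → ℕ → Set
  Rel p zero    zero    = p ≡ true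
  Rel p zero    (suc b) = ⊥
  Rel p (suc a) zero    = ⊤
  Rel p (suc a) (suc b) = Rel (not p) a b

  Row : Bool → List ℕ → Set
  Row p = Linked (Rel p)

  data Above (p : Bool) : List ℕ → List ℕ → Set where
    []  : ∀ {r} → Above p r []
    _∷_ : ∀ {t u r s} → Rel (not p) t u → Above p r s → Above p (t ∷ r) (u ∷ s)

  Tableau : Bool → List (List ℕ) → Set
  Tableau p T = All (Row p) T × Linked (Above p) T

  shape : List (List ℕ) → List ℕ
  shape = map length

  -- In phase `false` the least letter is an overlined 1 whose value has already been paid for on
  -- leaving phase `true`; hence it counts 0 for the value and 1 for the overlines.
  valueWeight overWeight : Bool → ℕ → ℕ
  valueWeight true  zero    = 0
  valueWeight true  (suc t) = suc (valueWeight false t)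
  valueWeight false zero    = 0
  valueWeight false (suc t) = valueWeight true t
  overWeight true  zero    = 0
  overWeight true  (suc t) = overWeight false t
  overWeight false zero    = 1
  overWeight false (suc t) = overWeight true t

  total : (ℕ → ℕ) → List (List ℕ) → ℕ
  total w T = sum (map (sum ∘ map w) T)

  stripRow : List ℕ → List ℕ
  stripRow []          = []
  stripRow (zero ∷ r)  = []
  stripRow (suc t ∷ r) = t ∷ stripRow r

  -- The least letters stand at the end of a row, so its length `x` is all that `stripRow` forgets.
  -- The clause for `zero` with a nonempty row is a default value outside the range `length s ≤ x`.
  glueRow : ℕ → List ℕ → List ℕ
  glueRow x       []      = replicate x 0
  glueRow zero    (t ∷ r) = []
  glueRow (suc x) (t ∷ r) = suc t ∷ glueRow x r

  strip : List (List ℕ) → List (List ℕ)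
  strip = map stripRow

  glue : List ℕ → List (List ℕ) → List (List ℕ)
  glue = zipWith glueRow

  row-tail : ∀ {p t r} → Row p (t ∷ r) → Row p r
  row-tail [-]     = []
  row-tail (_ ∷ l) = l

  zeros-row : ∀ {p r} → Row p (0 ∷ r) → 0 ∷ r ≡ replicate (suc (length r)) 0
  zeros-row [-]                    = ≡.refl
  zeros-row {r = zero ∷ r} (_ ∷ l) = ≡.cong (0 ∷_) (zeros-row l)

  glueRow-stripRow : ∀ {p r} → Row p r → glueRow (length r) (stripRow r) ≡ r
  glueRow-stripRow {r = []}        _ = ≡.refl
  glueRow-stripRow {r = zero ∷ r}  l = ≡.sym (zeros-row l)
  glueRow-stripRow {r = suc t ∷ r} l = ≡.cong (suc t ∷_) (glueRow-stripRow (row-tail l))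

  length-stripRow : ∀ r → length (stripRow r) ≤ length r
  length-stripRow []          = z≤n
  length-stripRow (zero ∷ r)  = z≤n
  length-stripRow (suc t ∷ r) = s≤s (length-stripRow r)

  stripRow-glueRow : ∀ {x s} → length s ≤ x → stripRow (glueRow x s) ≡ s
  stripRow-glueRow {zero}  {[]}    _       = ≡.refl
  stripRow-glueRow {suc x} {[]}    _       = ≡.refl
  stripRow-glueRow {suc x} {t ∷ s} (s≤s l) = ≡.cong (t ∷_) (stripRow-glueRow l)

  length-glueRow : ∀ {x s} → length s ≤ x → length (glueRow x s) ≡ x
  length-glueRow {zero}  {[]}    _       = ≡.refl
  length-glueRow {suc x} {[]}    _       = ≡.cong suc (length-glueRow {x} {[]} z≤n)
  length-glueRow {suc x} {t ∷ s} (s≤s l) = ≡.cong suc (length-glueRow {x} {s} l)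

  row-stripRow : ∀ {p r} → Row p r → Row (not p) (stripRow r)
  row-stripRow {r = []}                     _       = []
  row-stripRow {r = zero ∷ r}               _       = []
  row-stripRow {r = suc t ∷ []}             _       = [-]
  row-stripRow {r = suc t ∷ zero ∷ r}       _       = [-]
  row-stripRow {r = suc t ∷ suc u ∷ r}      (e ∷ l) = e ∷ row-stripRow l

  -- In phase `false` the least letter occurs at most once in a row.
  stripRow-drop : ∀ {r} → Row false r → length r ≤ suc (length (stripRow r))
  stripRow-drop {[]}              _        = z≤n
  stripRow-drop {zero ∷ []}       _        = s≤s z≤n
  stripRow-drop {zero ∷ zero ∷ r} (() ∷ _)
  stripRow-drop {suc t ∷ r}       l        = s≤s (stripRow-drop (row-tail l))

  row-zeros : ∀ {p} x → (p ≡ false → x ≤ 1) → Row p (replicate x 0)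
  row-zeros         zero          _ = []
  row-zeros         (suc zero)    _ = [-]
  row-zeros {true}  (suc (suc x)) _ = ≡.refl ∷ row-zeros (suc x) (λ ())
  row-zeros {false} (suc (suc x)) h with h ≡.refl
  ... | s≤s ()

  row-glueRow : ∀ {p x s} → length s ≤ x → (p ≡ false → x ≤ suc (length s)) → Row (not p) s → Row p (glueRow x s)
  row-glueRow {x = x}           {[]}        _       h _       = row-zeros x h
  row-glueRow {x = suc zero}    {t ∷ []}    _       h _       = [-]
  row-glueRow {x = suc zero}    {t ∷ _ ∷ _} (s≤s ()) h _
  row-glueRow {x = suc (suc x)} {t ∷ []}    _       h _       = tt ∷ row-zeros (suc x) (λ e → ℕₚ.≤-pred (h e))
  row-glueRow {x = suc (suc x)} {t ∷ u ∷ s} (s≤s l) h (e ∷ r) = e ∷ row-glueRow l (λ e → ℕₚ.≤-pred (h e)) r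

  above-stripRow : ∀ {p r s} → Above p r s → Above (not p) (stripRow r) (stripRow s)
  above-stripRow []                                       = []
  above-stripRow {r = zero ∷ _}  {zero ∷ _}  (_ ∷ c)      = []
  above-stripRow {r = suc t ∷ _} {zero ∷ _}  (_ ∷ c)      = []
  above-stripRow {r = suc t ∷ _} {suc u ∷ _} (e ∷ c)      = e ∷ above-stripRow c

  above-length : ∀ {p r s} → Above p r s → length s ≤ length r
  above-length []      = z≤n
  above-length (_ ∷ c) = s≤s (above-length c)

  -- In phase `true` nothing can stand below a least letter. This is the source of the lower bound
  -- on the row lengths of a filling by the next part of λ.
  above-horizontal : ∀ {r s} → Above true r s → length s ≤ length (stripRow r)
  above-horizontal []                                  = z≤n
  above-horizontal {zero ∷ _}  {zero ∷ _} (() ∷ _)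
  above-horizontal {suc t ∷ _} (_ ∷ c)                 = s≤s (above-horizontal c)

  above-zeros : ∀ x y → y ≤ x → Above false (replicate x 0) (replicate y 0)
  above-zeros x       zero    _       = []
  above-zeros (suc x) (suc y) (s≤s h) = ≡.refl ∷ above-zeros x y h

  above-glueRow : ∀ {p x y r s} → length r ≤ x → length s ≤ y → y ≤ x → (p ≡ true → y ≤ length r) →
                  Above (not p) r s → Above p (glueRow x r) (glueRow y s)
  above-glueRow {false} {x} {y} {[]} {[]} lr ls y≤x h []      = above-zeros x y y≤x
  above-glueRow {true}  {x} {y} {[]} {[]} lr ls y≤x h []      with z≤n ← h ≡.refl = []
  above-glueRow {y = zero} {_ ∷ _} {[]} lr ls y≤x h c = []
  above-glueRow {x = suc x} {suc y} {_ ∷ r} {[]} (s≤s lr) ls (s≤s y≤x) h [] = tt ∷ above-glueRow {r = r} lr z≤n y≤x (λ e → ℕₚ.≤-pred (h e)) []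
  above-glueRow {x = suc x} {suc y} {_ ∷ _} {_ ∷ _} (s≤s lr) (s≤s ls) (s≤s y≤x) h (e ∷ c) =
    e ∷ above-glueRow lr ls y≤x (λ e → ℕₚ.≤-pred (h e)) c

  glue-strip : ∀ {p T} → All (Row p) T → glue (shape T) (strip T) ≡ T
  glue-strip []       = ≡.refl
  glue-strip (r ∷ rs) = ≡.cong₂ _∷_ (glueRow-stripRow r) (glue-strip rs)

  data Fits : List ℕ → List (List ℕ) → Set where
    []  : Fits [] []
    _∷_ : ∀ {x xs s T} → length s ≤ x → Fits xs T → Fits (x ∷ xs) (s ∷ T)

  strip-glue : ∀ {xs T} → Fits xs T → strip (glue xs T) ≡ T
  strip-glue []      = ≡.refl
  strip-glue (l ∷ f) = ≡.cong₂ _∷_ (stripRow-glueRow l) (strip-glue f)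

  shape-glue : ∀ {xs T} → Fits xs T → shape (glue xs T) ≡ xs
  shape-glue []      = ≡.refl
  shape-glue (_∷_ {s = s} l f) = ≡.cong₂ _∷_ (length-glueRow {s = s} l) (shape-glue f)

  horizontal-fits : ∀ {xs} T → Horizontal xs (shape T) → Fits xs T
  horizontal-fits []      []            = []
  horizontal-fits (s ∷ T) ((_ , u) ∷ h) = u ∷ horizontal-fits T h

  vertical-fits : ∀ {xs} T → Vertical xs (shape T) → Fits xs T
  vertical-fits []      []       = []
  vertical-fits (s ∷ T) (keep v) = ℕₚ.≤-refl ∷ vertical-fits T v
  vertical-fits (s ∷ T) (drop v) = ℕₚ.n≤1+n _ ∷ vertical-fits T v

  tableau-strip : ∀ {p T} → Tableau p T → Tableau (not p) (strip T)
  tableau-strip (rows , columns) = Allₚ.map⁺ (All.map row-stripRow rows) , above columns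
    where
    above : ∀ {p T} → Linked (Above p) T → Linked (Above (not p)) (strip T)
    above []      = []
    above [-]     = [-]
    above (c ∷ l) = above-stripRow c ∷ above l

  tableau-horizontal : ∀ {T} → Tableau true T → Horizontal (shape T) (shape (strip T))
  tableau-horizontal {T} (_ , columns) = go T columns
    where
    go : ∀ T → Linked (Above true) T → Horizontal (shape T) (shape (strip T))
    go []          []      = []
    go (r ∷ [])    [-]     = (z≤n , length-stripRow r) ∷ []
    go (r ∷ s ∷ T) (c ∷ l) = (above-horizontal c , length-stripRow r) ∷ go (s ∷ T) l

  vertical-∷ : ∀ {x y xs ys} → y ≤ x → x ≤ suc y → Vertical xs ys → Vertical (x ∷ xs) (y ∷ ys)
  vertical-∷ y≤x x≤1+y v = [ (λ x<1+y → ≡.subst (λ z → Vertical (z ∷ _) _) (ℕₚ.≤-antisym y≤x (ℕₚ.≤-pred x<1+y)) (keep v))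
                           , (λ { ≡.refl → drop v }) ]′ (ℕₚ.m≤n⇒m<n∨m≡n x≤1+y)

  tableau-vertical : ∀ {T} → Tableau false T → Vertical (shape T) (shape (strip T))
  tableau-vertical (rows , _) = go rows
    where
    go : ∀ {T} → All (Row false) T → Vertical (shape T) (shape (strip T))
    go []             = []
    go {r ∷ T} (l ∷ rows) = vertical-∷ (length-stripRow r) (stripRow-drop l) (go rows)

  tableau-glue-horizontal : ∀ {xs} T → Horizontal xs (shape T) → Tableau false T → Tableau true (glue xs T)
  tableau-glue-horizontal []          []                        ([] , [])             = [] , []
  tableau-glue-horizontal (s ∷ [])    ((_ , u) ∷ [])            (r ∷ [] , _)          = row-glueRow u (λ ()) r ∷ [] , [-]
  tableau-glue-horizontal (s ∷ t ∷ T) ((l , u) ∷ h@((_ , v) ∷ _)) (r ∷ rows , c ∷ columns) =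
    let rows′ , columns′ = tableau-glue-horizontal (t ∷ T) h (rows , columns)
    in row-glueRow u (λ ()) r ∷ rows′ , above-glueRow u v (ℕₚ.≤-trans l u) (λ _ → l) c ∷ columns′

  vertical-first : ∀ {x y xs ys} → Vertical (x ∷ xs) (y ∷ ys) → y ≤ x × x ≤ suc y
  vertical-first (keep v) = ℕₚ.≤-refl , ℕₚ.n≤1+n _
  vertical-first (drop v) = ℕₚ.n≤1+n _ , ℕₚ.≤-refl

  vertical-rest : ∀ {x y xs ys} → Vertical (x ∷ xs) (y ∷ ys) → Vertical xs ys
  vertical-rest (keep v) = v
  vertical-rest (drop v) = v

  tableau-glue-vertical : ∀ {b xs} T → Descending b xs → Vertical xs (shape T) → Tableau true T → Tableau false (glue xs T)
  tableau-glue-vertical []       d       []                  ([] , [])    = [] , []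
  tableau-glue-vertical {xs = x ∷ []} (s ∷ []) d v (r ∷ [] , _)  =
    let l , u = vertical-first v in row-glueRow l (λ _ → u) r ∷ [] , [-]
  tableau-glue-vertical {xs = x ∷ y ∷ xs} (s ∷ t ∷ T) (_ ∷ d@(y≤x ∷ _)) v (r ∷ rows , c ∷ columns) =
    let rows′ , columns′ = tableau-glue-vertical (t ∷ T) d (vertical-rest v) (rows , columns)
        l , u = vertical-first v
        l′ , _ = vertical-first (vertical-rest v)
    in row-glueRow l (λ _ → u) r ∷ rows′ , above-glueRow l l′ y≤x (λ ()) c ∷ columns′
  tableau-glue-vertical {xs = x ∷ []} (s ∷ t ∷ T) d v _ with () ← vertical-rest v
  tableau-glue-vertical {xs = x ∷ y ∷ xs} (s ∷ []) d v _ with () ← vertical-rest v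

  sum-map-zeros : ∀ (w : ℕ → ℕ) x → sum (map w (replicate x 0)) ≡ x ℕ.* w 0
  sum-map-zeros w zero    = ≡.refl
  sum-map-zeros w (suc x) = ≡.cong (w 0 ℕ.+_) (sum-map-zeros w x)

  glueRow-weight : ∀ (w w′ : ℕ → ℕ) {c} → (∀ t → w (suc t) ≡ c + w′ t) → ∀ {x s} → length s ≤ x →
    sum (map w (glueRow x s)) ≡ length s ℕ.* c + (x ∸ length s) ℕ.* w 0 + sum (map w′ s)
  glueRow-weight w w′ ws {x} {[]} _ = ≡.trans (sum-map-zeros w x) (≡.sym (ℕₚ.+-identityʳ _))
  glueRow-weight w w′ {c} ws {suc x} {t ∷ s} (s≤s l) =
    ≡.trans (≡.cong₂ _+_ (ws t) (glueRow-weight w w′ ws {x} {s} l))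
      (solve 5 (λ c t a b d → (c :+ t) :+ (a :+ b :+ d) := (c :+ a :+ b) :+ (t :+ d)) ≡.refl
        c (w′ t) (length s ℕ.* c) ((x ∸ length s) ℕ.* w 0) (sum (map w′ s)))
    where open +-*-Solver

  -- One computation for both weights in both phases: `c` is what a letter gains by being raised,
  -- and `w 0` is what a new least letter counts. The inequality is proved alongside, since the
  -- truncated differences add up over the rows only because of it.
  glue-weight : ∀ (w w′ : ℕ → ℕ) {c} → (∀ t → w (suc t) ≡ c + w′ t) → ∀ {xs T} → Fits xs T →
    total w (glue xs T) ≡ sum (shape T) ℕ.* c + (sum xs ∸ sum (shape T)) ℕ.* w 0 + total w′ T × sum (shape T) ≤ sum xs
  glue-weight w w′ ws []                               = ≡.refl , z≤n
  glue-weight w w′ {c} ws (_∷_ {x} {xs} {s} {T} l f) =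
    ≡.trans (≡.cong₂ _+_ (glueRow-weight w w′ ws {x} {s} l) ih)
      (≡.trans (solve 8 (λ c w a b d e f g → (a :* c :+ b :* w :+ d) :+ (e :* c :+ f :* w :+ g) := (a :+ e) :* c :+ (b :+ f) :* w :+ (d :+ g)) ≡.refl
         c (w 0) (length s) (x ∸ length s) (sum (map w′ s)) (sum (shape T)) (sum xs ∸ sum (shape T)) (total w′ T))
        (≡.cong (λ m → (length s + sum (shape T)) ℕ.* c + m ℕ.* w 0 + (sum (map w′ s) + total w′ T)) difference)) ,
    ℕₚ.+-mono-≤ l le
    where
    open +-*-Solver
    ih = proj₁ (glue-weight w w′ ws f)
    le = proj₂ (glue-weight w w′ ws f)
    difference : (x ∸ length s) + (sum xs ∸ sum (shape T)) ≡ (x + sum xs) ∸ (length s + sum (shape T))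
    difference = ≡.sym (≡.trans (≡.sym (ℕₚ.∸-+-assoc (x + sum xs) (length s) _))
      (≡.trans (≡.cong (_∸ sum (shape T)) (≡.trans (≡.cong (_∸ length s) (ℕₚ.+-comm x (sum xs))) (≡.trans (ℕₚ.+-∸-assoc (sum xs) l) (ℕₚ.+-comm (sum xs) _))))
        (ℕₚ.+-∸-assoc (x ∸ length s) le)))

  value-glue-horizontal : ∀ {xs T} → Fits xs T → total (valueWeight true) (glue xs T) ≡ sum (shape T) + total (valueWeight false) T
  value-glue-horizontal {xs} {T} f = ≡.trans (proj₁ (glue-weight _ _ {1} (λ t → ≡.refl) f))
    (≡.cong (_+ total (valueWeight false) T) (≡.trans (≡.cong₂ _+_ (ℕₚ.*-identityʳ _) (ℕₚ.*-zeroʳ (sum xs ∸ sum (shape T)))) (ℕₚ.+-identityʳ _)))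

  over-glue-horizontal : ∀ {xs T} → Fits xs T → total (overWeight true) (glue xs T) ≡ total (overWeight false) T
  over-glue-horizontal {xs} {T} f = ≡.trans (proj₁ (glue-weight _ _ {0} (λ t → ≡.refl) f))
    (≡.cong (_+ total (overWeight false) T) (≡.cong₂ _+_ (ℕₚ.*-zeroʳ (sum (shape T))) (ℕₚ.*-zeroʳ (sum xs ∸ sum (shape T)))))

  value-glue-vertical : ∀ {xs T} → Fits xs T → total (valueWeight false) (glue xs T) ≡ total (valueWeight true) T
  value-glue-vertical {xs} {T} f = ≡.trans (proj₁ (glue-weight _ _ {0} (λ t → ≡.refl) f))
    (≡.cong (_+ total (valueWeight true) T) (≡.cong₂ _+_ (ℕₚ.*-zeroʳ (sum (shape T))) (ℕₚ.*-zeroʳ (sum xs ∸ sum (shape T)))))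

  over-glue-vertical : ∀ {xs T} → Fits xs T → total (overWeight false) (glue xs T) ≡ sum xs ∸ sum (shape T) + total (overWeight true) T
  over-glue-vertical {xs} {T} f = ≡.trans (proj₁ (glue-weight _ _ {0} (λ t → ≡.refl) f))
    (≡.cong (_+ total (overWeight true) T) (≡.cong₂ _+_ (ℕₚ.*-zeroʳ (sum (shape T))) (ℕₚ.*-identityʳ _)))

  tableau-¬ascent : ∀ {p T} → Linked (Above p) T → ¬ Ascent (shape T)
  tableau-¬ascent {T = r ∷ []}    _       (there ())
  tableau-¬ascent {T = r ∷ s ∷ T} (c ∷ l) asc = go asc ≡.refl
    where
    go : ∀ {ys} → Ascent ys → ys ≡ shape (r ∷ s ∷ T) → ⊥
    go here        eq = ℕₚ.<-irrefl (≡.trans (∷-injectiveˡ eq) ≡.refl)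
      (≡.subst (_≤ length r) (≡.sym (∷-injectiveˡ (∷-injectiveʳ eq))) (above-length c))
    go (there asc) eq = tableau-¬ascent l (≡.subst Ascent (∷-injectiveʳ eq) asc)

open Tableaux

-- Coefficients of the determinant count tableaux.

module GeneratingFunction where

  module ℤ[[a]] = PowerSeries ℤₚ.+-*-commutativeRing
  module ℤ[[a]][[q]] = PowerSeries ℤ[[a]].seriesRing

  -- With `q` outside and `a` inside, an element takes the exponents in the same order as `PS`, and
  -- the embedding `fromPS` is coefficientwise.
  R = ℤ[[a]][[q]].seriesRing
  open CommutativeRing R hiding (zero)
  open import Algebra.Properties.Semiring.Exp semiring using (_^_)

  q a : Carrier
  q = ℤ[[a]][[q]].X
  a = ℤ[[a]][[q]].scalar ℤ[[a]].X

  geo : ℕ → Carrier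
  geo = ℤ[[a]][[q]].geometric

  open Hypergeometric R q a geo
  open Recursion R q a geo
  open Sums R using (sumOver)
  open Sums ℤₚ.+-*-commutativeRing using () renaming (sumOver to sumOverℤ)
  open Alternant R (ℕ × ℕ) using (product∷)
  open import Relation.Binary.Reasoning.Setoid setoid

  fromPS : PS → Carrier
  fromPS f n k = + f n k

  +-sumTo : ∀ n f → + Defs.sumTo n f ≡ ℤ[[a]].sumTo n (λ i → + f i)
  +-sumTo zero    f = ≡.refl
  +-sumTo (suc n) f = ≡.cong (ℤ._+ + f (suc n)) (+-sumTo n f)

  sumTo-coefficient : ∀ n F k → ℤ[[a]][[q]].sumTo n F k ≡ ℤ[[a]].sumTo n (λ i → F i k)
  sumTo-coefficient zero    F k = ≡.refl
  sumTo-coefficient (suc n) F k = ≡.cong (ℤ._+ F (suc n) k) (sumTo-coefficient n F k)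

  fromPS-⊛ : ∀ f g → fromPS (f ⊛ g) ≈ fromPS f * fromPS g
  fromPS-⊛ f g n k = ≡.sym (≡.trans (sumTo-coefficient n _ k) (≡.sym (≡.trans (+-sumTo n _)
    (ℤ[[a]].sumTo-cong n (λ i _ → ≡.trans (+-sumTo k _) (ℤ[[a]].sumTo-cong k (λ j _ → ℤₚ.pos-* (f i j) (g (n ∸ i) (k ∸ j)))))))))

  fromPS-onePS : fromPS onePS ≈ 1#
  fromPS-onePS zero    zero    = ≡.refl
  fromPS-onePS zero    (suc k) = ≡.refl
  fromPS-onePS (suc n) k       = ≡.refl

  fromPS-geomPS : ∀ m → fromPS (geomPS m) ≈ geo m
  fromPS-geomPS m n k with ⌊ suc m ∣? n ⌋
  fromPS-geomPS m n zero    | true  = ≡.refl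
  fromPS-geomPS m n zero    | false = ≡.refl
  fromPS-geomPS m n (suc k) | true  = ≡.refl
  fromPS-geomPS m n (suc k) | false = ≡.refl

  fromPS-binomPS : ∀ u v → fromPS (binomPS u v) ≈ q ^ u + a * q ^ v
  fromPS-binomPS u v n k = ≡.sym (≡.trans (≡.cong₂ ℤ._+_ (ℤ[[a]][[q]].X^-coefficient u n k)
      (≡.trans (ℤ[[a]][[q]].⊗-scalar ℤ[[a]].X (q ^ v) n k) (ℤ[[a]].⊗-cong {ℤ[[a]].X} (λ _ → ≡.refl) (ℤ[[a]][[q]].X^-coefficient v n) k)))
      (value k))
    where
    module A = CommutativeRing ℤ[[a]].seriesRing
    value : ∀ k → (if n ≡ᵇ u then A.1# else A.0#) k ℤ.+ (ℤ[[a]].X A.* (if n ≡ᵇ v then A.1# else A.0#)) k ≡ fromPS (binomPS u v) n k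
    value zero with n ≡ᵇ u
    ... | true  = ≡.refl
    ... | false = ≡.refl
    value (suc k) with n ≡ᵇ u | n ≡ᵇ v
    value (suc zero)    | true  | true  = ≡.refl
    value (suc zero)    | true  | false = ≡.refl
    value (suc zero)    | false | true  = ≡.refl
    value (suc zero)    | false | false = ≡.refl
    value (suc (suc k)) | true  | true  = ≡.trans (ℤₚ.+-identityˡ _) (ℤ[[a]].X-suc A.1# (suc k))
    value (suc (suc k)) | true  | false = ≡.trans (ℤₚ.+-identityˡ _) (ℤ[[a]].X-suc A.0# (suc k))
    value (suc (suc k)) | false | true  = ≡.trans (ℤₚ.+-identityˡ _) (ℤ[[a]].X-suc A.1# (suc k))
    value (suc (suc k)) | false | false = ≡.trans (ℤₚ.+-identityˡ _) (ℤ[[a]].X-suc A.0# (suc k))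

  fromPS-prodPS : ∀ (F : ℕ × ℕ → PS) cs → fromPS (prodPS (map F cs)) ≈ product∷ (λ c → fromPS (F c)) cs
  fromPS-prodPS F []       = fromPS-onePS
  fromPS-prodPS F (c ∷ cs) = trans (fromPS-⊛ (F c) (prodPS (map F cs)))
    (*-congˡ {fromPS (F c)} {fromPS (prodPS (map F cs))} (fromPS-prodPS F cs))

  module Cells = CellProducts R q a geo

  product∷-≈ : ∀ {f g} cs → (∀ c → f c ≈ g c) → product∷ f cs ≈ product∷ g cs
  product∷-≈ cs f≈g = Cells.product∷-cong (All.universal f≈g cs)

  jacobiTrudi≈rhs : ∀ {b xs} → Descending b xs → jacobiTrudi 0 xs ≈ fromPS (rhs xs)
  jacobiTrudi≈rhs {xs = xs} d = begin
    jacobiTrudi 0 xs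
      ≈⟨ Evaluation.jacobiTrudi≈hookProduct ℤ[[a]][[q]].geometric-inverse 0 d ⟩
    hookProduct 0 xs
      ≈⟨ Cells.product∷≈hookProduct 0 d ⟨
    product∷ Cells.numerator (cellsFrom 0 xs) * product∷ (geo ∘ hookPred xs) (cellsFrom 0 xs)
      ≡⟨ ≡.cong (λ cs → product∷ Cells.numerator cs * product∷ (geo ∘ hookPred xs) cs) (cells≡cellsFrom xs) ⟨
    product∷ Cells.numerator cs * product∷ (geo ∘ hookPred xs) cs
      ≈⟨ *-cong (trans (fromPS-prodPS numeratorPS cs) (product∷-≈ cs (λ c → fromPS-binomPS (proj₁ c) (suc (proj₂ c)))))
                (trans (fromPS-prodPS hookPS cs) (product∷-≈ cs (λ c → fromPS-geomPS (hookPred xs c)))) ⟨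
    fromPS (prodPS (map numeratorPS cs)) * fromPS (prodPS (map hookPS cs))
      ≈⟨ fromPS-⊛ (prodPS (map numeratorPS cs)) (prodPS (map hookPS cs)) ⟨
    fromPS (rhs xs) ∎
    where
    cs = cells xs
    numeratorPS hookPS : ℕ × ℕ → PS
    numeratorPS c = binomPS (proj₁ c) (suc (proj₂ c))
    hookPS c = geomPS (hookPred xs c)

  jacobiTrudi-coefficients : ∀ {b xs} → Descending b xs → jacobiTrudi 0 xs ≈ sumOver (λ ys → q ^ sum ys * stripSum ys) (horizontalStrips xs)
  jacobiTrudi-coefficients d = jacobiTrudi-recursion ℤ[[a]][[q]].geometric-inverse
    (λ {f} {g} → ℤ[[a]][[q]].X-cancel {f} {g}) d

  sumOver-coefficient : ∀ {i} {I : Set i} (f : I → Carrier) is n k → sumOver f is n k ≡ sumOverℤ (λ i → f i n k) is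
  sumOver-coefficient f []       n k = ≡.refl
  sumOver-coefficient f (i ∷ is) n k = ≡.cong₂ ℤ._+_ (≡.refl {x = f i n k}) (sumOver-coefficient f is n k)

  Class : Bool → List ℕ → ℕ → ℕ → List (List ℕ) → Set
  Class p xs n k T = shape T ≡ xs × Tableau p T × total (valueWeight p) T ≡ n × total (overWeight p) T ≡ k

  -- Removing the overlined 1s lowers `k` by their number, which matches the power of `a`, and keeps
  -- `n`; so the hypothesis is asked for all `k` and all shapes, but at the same `n`.
  hasCard-vertical : ∀ {b ys n k} → Descending b ys →
    (∀ {b zs} k → Descending b zs → HasCard (Class true zs n k) (jacobiTrudi 0 zs n k)) →
    HasCard (Class false ys n k) (stripSum ys n k)
  hasCard-vertical {b} {ys} {n} {k} d ih = ≡.subst (HasCard _) (≡.sym (sumOver-coefficient _ (verticalStrips ys) n k))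
    (hasCard-bijection (glue ys) strip fwd bwd
      (λ {T} (z∈ , _) → strip-glue (vertical-fits T (All.lookup (verticalStrips-sound ys) z∈)))
      (λ { (≡.refl , (rows , _) , _) → glue-strip rows })
      (hasCard-⋃ Q shape proj₁ (verticalStrips-unique ys) (All.map piece (verticalStrips-sound ys))))
    where
    Q : List ℕ → List (List ℕ) → Set
    Q zs T = shape T ≡ zs × Tableau true T × total (valueWeight true) T ≡ n × sum ys ∸ sum zs ℕ.+ total (overWeight true) T ≡ k

    fwd : ∀ {T} → shape T ∈ verticalStrips ys × Q (shape T) T → Class false ys n k (glue ys T)
    fwd {T} (z∈ , _ , tab , v , o) =
      let s = All.lookup (verticalStrips-sound ys) z∈ ; f = vertical-fits T s in
      shape-glue f , tableau-glue-vertical T d s tab , ≡.trans (value-glue-vertical f) v , ≡.trans (over-glue-vertical f) o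

    bwd : ∀ {T} → Class false ys n k T → shape (strip T) ∈ verticalStrips ys × Q (shape (strip T)) (strip T)
    bwd {T} (≡.refl , tab , v , o) =
      let s = tableau-vertical tab ; f = vertical-fits (strip T) s ; e = glue-strip (proj₁ tab) in
      verticalStrips-complete s , ≡.refl , tableau-strip tab ,
      ≡.trans (≡.sym (≡.trans (≡.cong (total (valueWeight false)) (≡.sym e)) (value-glue-vertical f))) v ,
      ≡.trans (≡.sym (≡.trans (≡.cong (total (overWeight false)) (≡.sym e)) (over-glue-vertical f))) o

    base : ∀ {zs} k → Vertical ys zs → HasCard (Class true zs n k) (jacobiTrudi 0 zs n k)
    base {zs} k s = [ ih k
                    -- On a shape with an ascent the determinant has two equal rows, and there is no
                    -- tableau to count.
                    , (λ asc → ≡.subst (HasCard _) (≡.sym (ascent-vanish (Alternant.alternant-alternating R ℕ (entry 0) (length zs)) asc n k))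
                        (hasCard-empty (λ { T (≡.refl , (_ , columns) , _) → tableau-¬ascent columns asc })))
                    ]′ (vertical-ascent d s)

    piece : ∀ {zs} → Vertical ys zs → HasCard (Q zs) ((a ^ (sum ys ∸ sum zs) * jacobiTrudi 0 zs) n k)
    piece {zs} s with (sum ys ∸ sum zs) ≤? k
    ... | no t≰k = ≡.subst (HasCard _)
      (≡.sym (≡.trans (ℤ[[a]][[q]].scalar-^ ℤ[[a]].X (sum ys ∸ sum zs) (jacobiTrudi 0 zs) n k) (ℤ[[a]].X^-< (sum ys ∸ sum zs) (jacobiTrudi 0 zs n) (ℕₚ.≰⇒> t≰k))))
      (hasCard-empty (λ T (_ , _ , _ , o) → t≰k (≡.subst (sum ys ∸ sum zs ≤_) o (ℕₚ.m≤m+n (sum ys ∸ sum zs) _))))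
    ... | yes t≤k with ℕₚ.m≤n⇒∃[o]m+o≡n t≤k
    ...   | k′ , ≡.refl = ≡.subst (HasCard _)
      (≡.sym (≡.trans (ℤ[[a]][[q]].scalar-^ ℤ[[a]].X (sum ys ∸ sum zs) (jacobiTrudi 0 zs) n _) (ℤ[[a]].X^-+ (sum ys ∸ sum zs) (jacobiTrudi 0 zs n) k′)))
      (hasCard-⇔ (λ (e , t , v , o) → e , t , v , ≡.cong (sum ys ∸ sum zs ℕ.+_) o)
                 (λ (e , t , v , o) → e , t , v , ℕₚ.+-cancelˡ-≡ (sum ys ∸ sum zs) _ _ o) (base k′ s))

  empties : List ℕ → List (List ℕ)
  empties = map (λ _ → [])

  shape-empties : ∀ {ys} → sum ys ≡ 0 → shape (empties ys) ≡ ys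
  shape-empties {[]}        e = ≡.refl
  shape-empties {zero ∷ ys} e = ≡.cong (0 ∷_) (shape-empties e)

  empties-shape : ∀ {T} → sum (shape T) ≡ 0 → T ≡ empties (shape T)
  empties-shape {[]}     e = ≡.refl
  empties-shape {[] ∷ T} e = ≡.cong ([] ∷_) (empties-shape e)

  tableau-empties : ∀ {p} ys → Tableau p (empties ys)
  tableau-empties ys = Allₚ.map⁺ (All.universal (λ _ → []) ys) , columns ys
    where
    columns : ∀ {p} ys → Linked (Above p) (empties ys)
    columns []           = []
    columns (_ ∷ [])     = [-]
    columns (_ ∷ y ∷ ys) = [] ∷ columns (y ∷ ys)

  total-empties : ∀ w ys → total w (empties ys) ≡ 0
  total-empties w []       = ≡.refl
  total-empties w (_ ∷ ys) = total-empties w ys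

  -- The case in which the horizontal strip is the whole shape: then `n` does not drop, and the
  -- count has to be known outright.
  hasCard-zeros : ∀ {b ys} n k → Descending b ys → sum ys ≡ 0 → HasCard (Class false ys n k) (stripSum ys n k)
  hasCard-zeros {b} {ys} n k d e = ≡.subst (HasCard _) (≡.sym (stripSum-zeros ℤ[[a]][[q]].geometric-inverse (λ {f} {g} → ℤ[[a]][[q]].X-cancel {f} {g}) d e n k)) (go n k)
    where
    class-empties : ∀ {n k T} → Class false ys n k T → T ≡ empties ys
    class-empties (≡.refl , _) = empties-shape e
    value-0 : ∀ {n k T} → Class false ys n k T → n ≡ 0
    value-0 {T = T} cl@(_ , _ , v , _) = ≡.trans (≡.sym v) (≡.trans (≡.cong (total (valueWeight false)) (class-empties {T = T} cl)) (total-empties _ ys))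
    over-0 : ∀ {n k T} → Class false ys n k T → k ≡ 0
    over-0 {T = T} cl@(_ , _ , _ , o) = ≡.trans (≡.sym o) (≡.trans (≡.cong (total (overWeight false)) (class-empties {T = T} cl)) (total-empties _ ys))
    go : ∀ n k → HasCard (Class false ys n k) (1# n k)
    go zero    zero    = hasCard-singleton (empties ys)
      (shape-empties e , tableau-empties ys , total-empties (valueWeight false) ys , total-empties (overWeight false) ys)
      (λ T cl → class-empties {T = T} cl)
    go zero    (suc k) = hasCard-empty (λ T cl → ℕₚ.1+n≢0 (over-0 {T = T} cl))
    go (suc n) k       = hasCard-empty (λ T cl → ℕₚ.1+n≢0 (value-0 {T = T} cl))

  -- Strong induction on `n` for all shapes at once. A nonempty inner shape `ys` takes `sum ys > 0`
  -- away from `n` and leads through both phases to smaller degree; an empty one is settled by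
  -- `hasCard-zeros`.
  hasCard-tableaux : ∀ n {b xs} k → Descending b xs → HasCard (Class true xs n k) (jacobiTrudi 0 xs n k)
  hasCard-tableaux = <-rec (λ n → ∀ {b xs} k → Descending b xs → HasCard (Class true xs n k) (jacobiTrudi 0 xs n k)) step
    where
    step : ∀ n → (∀ {m} → m ℕ.< n → ∀ {b xs} k → Descending b xs → HasCard (Class true xs m k) (jacobiTrudi 0 xs m k)) →
           ∀ {b xs} k → Descending b xs → HasCard (Class true xs n k) (jacobiTrudi 0 xs n k)
    step n ih {b} {xs} k d = ≡.subst (HasCard _) (≡.sym (≡.trans (jacobiTrudi-coefficients d n k) (sumOver-coefficient _ (horizontalStrips xs) n k)))
      (hasCard-bijection (glue xs) strip fwd bwd
        (λ {T} (z∈ , _) → strip-glue (horizontal-fits T (All.lookup (horizontalStrips-sound xs) z∈)))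
        (λ { (≡.refl , (rows , _) , _) → glue-strip rows })
        (hasCard-⋃ Q shape proj₁ (horizontalStrips-unique xs) (All.map piece (horizontalStrips-sound xs))))
      where
      Q : List ℕ → List (List ℕ) → Set
      Q ys T = shape T ≡ ys × Tableau false T × sum ys ℕ.+ total (valueWeight false) T ≡ n × total (overWeight false) T ≡ k

      fwd : ∀ {T} → shape T ∈ horizontalStrips xs × Q (shape T) T → Class true xs n k (glue xs T)
      fwd {T} (z∈ , _ , tab , v , o) =
        let s = All.lookup (horizontalStrips-sound xs) z∈ ; f = horizontal-fits T s in
        shape-glue f , tableau-glue-horizontal T s tab , ≡.trans (value-glue-horizontal f) v , ≡.trans (over-glue-horizontal f) o

      bwd : ∀ {T} → Class true xs n k T → shape (strip T) ∈ horizontalStrips xs × Q (shape (strip T)) (strip T)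
      bwd {T} (≡.refl , tab , v , o) =
        let s = tableau-horizontal tab ; f = horizontal-fits (strip T) s ; e = glue-strip (proj₁ tab) in
        horizontalStrips-complete s , ≡.refl , tableau-strip tab ,
        ≡.trans (≡.sym (≡.trans (≡.cong (total (valueWeight true)) (≡.sym e)) (value-glue-horizontal f))) v ,
        ≡.trans (≡.sym (≡.trans (≡.cong (total (overWeight true)) (≡.sym e)) (over-glue-horizontal f))) o

      base : ∀ {ys} m → sum ys ℕ.+ m ≡ n → Descending b ys → HasCard (Class false ys m k) (stripSum ys m k)
      base {ys} m e d′ with sum ys ℕ.≟ 0
      ... | yes s≡0 = hasCard-zeros m k d′ s≡0
      ... | no  s≢0 = hasCard-vertical d′ (ih (≡.subst (m ℕ.<_) e (ℕₚ.m<n+m m (ℕₚ.n≢0⇒n>0 s≢0))))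

      piece : ∀ {ys} → Horizontal xs ys → HasCard (Q ys) ((q ^ sum ys * stripSum ys) n k)
      piece {ys} s with sum ys ≤? n
      ... | no t≰n = ≡.subst (HasCard _) (≡.sym (ℤ[[a]][[q]].X^-< (sum ys) (stripSum ys) (ℕₚ.≰⇒> t≰n) k))
        (hasCard-empty (λ T (_ , _ , v , _) → t≰n (≡.subst (sum ys ≤_) v (ℕₚ.m≤m+n (sum ys) _))))
      ... | yes t≤n with ℕₚ.m≤n⇒∃[o]m+o≡n t≤n
      ...   | m , e = ≡.subst (HasCard _)
        (≡.sym (≡.trans (≡.cong (λ z → (q ^ sum ys * stripSum ys) z k) (≡.sym e)) (ℤ[[a]][[q]].X^-+ (sum ys) (stripSum ys) m k)))
        (hasCard-⇔ (λ (eq , t , v , o) → eq , t , ≡.trans (≡.cong (sum ys ℕ.+_) v) e , o)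
                   (λ (eq , t , v , o) → eq , t , ℕₚ.+-cancelˡ-≡ (sum ys) _ _ (≡.trans v (≡.sym e)) , o)
                   (base m e (horizontal-descending (descending-first d) s)))

-- Plane overpartitions with prescribed row lengths as tableaux of shape λ.

module Fillings where

  open import Data.Nat using (_+_)
  open ≡ using (refl; sym; trans; cong; cong₂; subst)

  -- decode t is the cell with code suc t, so that code 0 remains for the cells of λ outside the filling.
  decode : ℕ → Cell
  decode zero          = 1 , true
  decode (suc zero)    = 1 , false
  decode (suc (suc t)) = suc (proj₁ (decode t)) , proj₂ (decode t)

  encode : Cell → ℕ
  encode (zero        , _)     = 0
  encode (suc zero    , true)  = 0
  encode (suc zero    , false) = 1
  encode (suc (suc v) , b)     = suc (suc (encode (suc v , b)))

  Positive : Cell → Set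
  Positive c = 1 ≤ proj₁ c

  decode-positive : ∀ t → Positive (decode t)
  decode-positive zero          = s≤s z≤n
  decode-positive (suc zero)    = s≤s z≤n
  decode-positive (suc (suc t)) = s≤s z≤n

  encode-suc : ∀ {v b} → 1 ≤ v → encode (suc v , b) ≡ suc (suc (encode (v , b)))
  encode-suc {suc v} _ = refl

  encode-decode : ∀ t → encode (decode t) ≡ t
  encode-decode zero          = refl
  encode-decode (suc zero)    = refl
  encode-decode (suc (suc t)) = trans (encode-suc (decode-positive t)) (cong (suc ∘ suc) (encode-decode t))

  decode-encode : ∀ {c} → Positive c → decode (encode c) ≡ c
  decode-encode {suc zero    , true}  _ = refl
  decode-encode {suc zero    , false} _ = refl
  decode-encode {suc (suc v) , b}     _ = cong (λ c → suc (proj₁ c) , proj₂ c) (decode-encode {suc v , b} (s≤s z≤n))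

  -- `Left` and `Over` are the two overline conditions for neighbouring cells, combined with the
  -- weak decrease. Both relations are transitive, which recovers the conditions for arbitrary pairs
  -- in a row or column.
  Left : Cell → Cell → Set
  Left c d = proj₁ d < proj₁ c ⊎ (proj₁ d ≡ proj₁ c × proj₂ c ≡ false)

  Over : Cell → Cell → Set
  Over c d = proj₁ d < proj₁ c ⊎ (proj₁ d ≡ proj₁ c × proj₂ d ≡ true)

  left-trans : ∀ {c d e} → Left c d → Left d e → Left c e
  left-trans (inj₁ x)            (inj₁ y)            = inj₁ (ℕₚ.<-trans y x)
  left-trans (inj₁ x)            (inj₂ (refl , _))   = inj₁ x
  left-trans (inj₂ (refl , b))   (inj₁ y)            = inj₁ y
  left-trans (inj₂ (refl , b))   (inj₂ (refl , _))   = inj₂ (refl , b)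

  over-trans : ∀ {c d e} → Over c d → Over d e → Over c e
  over-trans (inj₁ x)            (inj₁ y)            = inj₁ (ℕₚ.<-trans y x)
  over-trans (inj₁ x)            (inj₂ (refl , _))   = inj₁ x
  over-trans (inj₂ (refl , b))   (inj₁ y)            = inj₁ y
  over-trans (inj₂ (refl , b))   (inj₂ (refl , b′))  = inj₂ (refl , b′)

  <⊎≡⇒≤ : ∀ {v w} {A : Set} → w < v ⊎ (w ≡ v × A) → w ≤ v
  <⊎≡⇒≤ (inj₁ x)       = ℕₚ.<⇒≤ x
  <⊎≡⇒≤ (inj₂ (e , _)) = ℕₚ.≤-reflexive e

  -- Phase `false` governs the rows, because `decode` starts from code 1 and the letter 0 is already
  -- gone; accordingly phase `true` governs the columns in `rel⇒over`.
  rel⇒left : ∀ t u → Rel false t u → Left (decode t) (decode u)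
  rel⇒left (suc zero)    zero          _ = inj₂ (refl , refl)
  rel⇒left (suc zero)    (suc zero)    _ = inj₂ (refl , refl)
  rel⇒left (suc (suc t)) zero          _ = inj₁ (s≤s (decode-positive t))
  rel⇒left (suc (suc t)) (suc zero)    _ = inj₁ (s≤s (decode-positive t))
  rel⇒left (suc (suc t)) (suc (suc u)) r with rel⇒left t u r
  ... | inj₁ x       = inj₁ (s≤s x)
  ... | inj₂ (e , b) = inj₂ (cong suc e , b)
  rel⇒left zero zero ()

  1≮ : ∀ {t} {A : Set} → suc (proj₁ (decode t)) ≤ 1 → A
  1≮ {t} (s≤s x) = ⊥-elim (ℕₚ.<⇒≱ (decode-positive t) x)

  left⇒rel : ∀ t u → Left (decode t) (decode u) → Rel false t u
  left⇒rel zero          zero          (inj₁ (s≤s ()))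
  left⇒rel zero          zero          (inj₂ (_ , ()))
  left⇒rel zero          (suc zero)    (inj₁ (s≤s ()))
  left⇒rel zero          (suc zero)    (inj₂ (_ , ()))
  left⇒rel zero          (suc (suc u)) l = 1≮ {u} (<⊎≡⇒≤ l)
  left⇒rel (suc zero)    zero          _ = tt
  left⇒rel (suc zero)    (suc zero)    _ = refl
  left⇒rel (suc zero)    (suc (suc u)) l = 1≮ {u} (<⊎≡⇒≤ l)
  left⇒rel (suc (suc t)) zero          _ = tt
  left⇒rel (suc (suc t)) (suc zero)    _ = tt
  left⇒rel (suc (suc t)) (suc (suc u)) (inj₁ x)       = left⇒rel t u (inj₁ (ℕₚ.≤-pred x))
  left⇒rel (suc (suc t)) (suc (suc u)) (inj₂ (e , b)) = left⇒rel t u (inj₂ (ℕₚ.suc-injective e , b))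

  rel⇒over : ∀ t u → Rel true t u → Over (decode t) (decode u)
  rel⇒over zero          zero          _ = inj₂ (refl , refl)
  rel⇒over (suc zero)    zero          _ = inj₂ (refl , refl)
  rel⇒over (suc (suc t)) zero          _ = inj₁ (s≤s (decode-positive t))
  rel⇒over (suc (suc t)) (suc zero)    _ = inj₁ (s≤s (decode-positive t))
  rel⇒over (suc (suc t)) (suc (suc u)) r with rel⇒over t u r
  ... | inj₁ x       = inj₁ (s≤s x)
  ... | inj₂ (e , b) = inj₂ (cong suc e , b)
  rel⇒over (suc zero) (suc zero) ()

  over⇒rel : ∀ t u → Over (decode t) (decode u) → Rel true t u
  over⇒rel zero          zero          _ = refl
  over⇒rel zero          (suc zero)    (inj₁ (s≤s ()))
  over⇒rel zero          (suc zero)    (inj₂ (_ , ()))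
  over⇒rel zero          (suc (suc u)) l = 1≮ {u} (<⊎≡⇒≤ l)
  over⇒rel (suc zero)    zero          _ = tt
  over⇒rel (suc zero)    (suc zero)    (inj₁ (s≤s ()))
  over⇒rel (suc zero)    (suc zero)    (inj₂ (_ , ()))
  over⇒rel (suc zero)    (suc (suc u)) l = 1≮ {u} (<⊎≡⇒≤ l)
  over⇒rel (suc (suc t)) zero          _ = tt
  over⇒rel (suc (suc t)) (suc zero)    _ = tt
  over⇒rel (suc (suc t)) (suc (suc u)) (inj₁ x)       = over⇒rel t u (inj₁ (ℕₚ.≤-pred x))
  over⇒rel (suc (suc t)) (suc (suc u)) (inj₂ (e , b)) = over⇒rel t u (inj₂ (ℕₚ.suc-injective e , b))

  data RowOver : List Cell → List Cell → Set where
    []  : ∀ {r} → RowOver r []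
    _∷_ : ∀ {c d r s} → Over c d → RowOver r s → RowOver (c ∷ r) (d ∷ s)

  rowOver-trans : ∀ {r s t} → RowOver r s → RowOver s t → RowOver r t
  rowOver-trans _       []      = []
  rowOver-trans (_∷_ {c} {d} x o) (_∷_ {d = e} y p) = over-trans {c} {d} {e} x y ∷ rowOver-trans o p

  rowOver-length : ∀ {r s} → RowOver r s → length s ≤ length r
  rowOver-length []      = z≤n
  rowOver-length (_ ∷ o) = s≤s (rowOver-length o)

  GoodRow : List Cell → Set
  GoodRow r = All Positive r × Linked Left r

  Good : Filling → Set
  Good Π = All (λ r → 0 < length r) Π × All GoodRow Π × Linked RowOver Π

  -- `val` and `over` are defined by `with` and stay stuck on an abstract lookup. These functions of
  -- the lookup result can be carried through inductions over a row.
  value : Maybe Cell → ℕ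
  value (just (v , _)) = v
  value nothing        = 0

  overlined : Maybe Cell → Bool
  overlined (just (_ , b)) = b
  overlined nothing        = false

  val≡value : ∀ Π i j → val Π i j ≡ value (cellAt (rowAt Π i) j)
  val≡value Π i j with cellAt (rowAt Π i) j
  ... | just _  = refl
  ... | nothing = refl

  over≡overlined : ∀ Π i j → over Π i j ≡ overlined (cellAt (rowAt Π i) j)
  over≡overlined Π i j with cellAt (rowAt Π i) j
  ... | just _  = refl
  ... | nothing = refl

  all-rowAt⁻ : ∀ {P : List Cell → Set} Π → (∀ i → P (rowAt Π i)) → All P Π
  all-rowAt⁻ []      p = []
  all-rowAt⁻ (r ∷ Π) p = p 0 ∷ all-rowAt⁻ Π (p ∘ suc)

  all-rowAt⁺ : ∀ {P : List Cell → Set} {Π} → P [] → All P Π → ∀ i → P (rowAt Π i)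
  all-rowAt⁺ e []       i       = e
  all-rowAt⁺ e (p ∷ ps) zero    = p
  all-rowAt⁺ e (p ∷ ps) (suc i) = all-rowAt⁺ e ps i

  linked-rowAt⁻ : ∀ {Q : List Cell → List Cell → Set} Π → (∀ i → Q (rowAt Π i) (rowAt Π (suc i))) → Linked Q Π
  linked-rowAt⁻ []          q = []
  linked-rowAt⁻ (r ∷ [])    q = [-]
  linked-rowAt⁻ (r ∷ s ∷ Π) q = q 0 ∷ linked-rowAt⁻ (s ∷ Π) (q ∘ suc)

  rowOver-rowAt : ∀ {Π} → AllPairs RowOver Π → ∀ {i i′} → i′ < i → RowOver (rowAt Π i′) (rowAt Π i)
  rowOver-rowAt []        {i}                  _         = []
  rowOver-rowAt (os ∷ ps) {suc i} {zero}       _         = all-rowAt⁺ [] os i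
  rowOver-rowAt (os ∷ ps) {suc i} {suc i′}     (s≤s i′<i) = rowOver-rowAt ps i′<i

  goodRow : ∀ r → (∀ j → j < length r → 1 ≤ value (cellAt r j)) →
    (∀ j → suc j < length r → value (cellAt r (suc j)) ≤ value (cellAt r j)) →
    (∀ j → suc j < length r → overlined (cellAt r j) ≡ true → value (cellAt r (suc j)) ≢ value (cellAt r j)) → GoodRow r
  goodRow []       pos dec ov = [] , []
  goodRow (c ∷ []) pos dec ov = pos 0 (s≤s z≤n) ∷ [] , [-]
  goodRow ((v , b) ∷ (w , b′) ∷ r) pos dec ov =
    let ps , ls = goodRow ((w , b′) ∷ r) (λ j j< → pos (suc j) (s≤s j<)) (λ j j< → dec (suc j) (s≤s j<)) (λ j j< → ov (suc j) (s≤s j<))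
    in pos 0 (s≤s z≤n) ∷ ps , left b (ov 0 (s≤s (s≤s z≤n))) ∷ ls
    where
    left : ∀ b → (b ≡ true → w ≢ v) → Left (v , b) (w , b′)
    left true  ov = inj₁ (ℕₚ.≤∧≢⇒< (dec 0 (s≤s (s≤s z≤n))) (ov refl))
    left false ov = [ inj₁ , (λ e → inj₂ (e , refl)) ]′ (ℕₚ.m≤n⇒m<n∨m≡n (dec 0 (s≤s (s≤s z≤n))))

  rowOver : ∀ r s → length s ≤ length r → (∀ j → j < length s → value (cellAt s j) ≤ value (cellAt r j)) →
    (∀ j → j < length s → value (cellAt r j) ≡ value (cellAt s j) → overlined (cellAt s j) ≡ true) → RowOver r s
  rowOver r       []            _       dec ov = []
  rowOver (c ∷ r) (d ∷ s) (s≤s l) dec ov =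
    [ inj₁ , (λ e → inj₂ (e , ov 0 (s≤s z≤n) (sym e))) ]′ (ℕₚ.m≤n⇒m<n∨m≡n (dec 0 (s≤s z≤n))) ∷
    rowOver r s l (λ j j< → dec (suc j) (s≤s j<)) (λ j j< → ov (suc j) (s≤s j<))

  good : ∀ {Π} → IsPlaneOverpartition Π → Good Π
  good {Π} P =
    rowsNonempty ,
    all-rowAt⁻ Π (λ i → goodRow (rowAt Π i)
      (λ j j< → subst (1 ≤_) (val≡value Π i j) (positive i j j<))
      (λ j j< → ≡.subst₂ _≤_ (val≡value Π i (suc j)) (val≡value Π i j) (rowDecr i j j<))
      (λ j j< o e → rowOver′ i j (suc j) ℕₚ.≤-refl j< (trans (over≡overlined Π i j) o)
         (trans (val≡value Π i (suc j)) (trans e (sym (val≡value Π i j)))))) ,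
    linked-rowAt⁻ Π (λ i → rowOver (rowAt Π i) (rowAt Π (suc i)) (shapeDecr i)
      (λ j j< → ≡.subst₂ _≤_ (val≡value Π (suc i) j) (val≡value Π i j) (colDecr i j j<))
      (λ j j< e → trans (sym (over≡overlined Π (suc i) j)) (colOver (suc i) i j ℕₚ.≤-refl j<
         (trans (val≡value Π i j) (trans e (sym (val≡value Π (suc i) j)))))))
    where open IsPlaneOverpartition P renaming (rowOver to rowOver′)

  all-cellAt : ∀ {P : ℕ → Bool → Set} {r} → All (λ c → P (proj₁ c) (proj₂ c)) r → ∀ {j} → j < length r →
    P (value (cellAt r j)) (overlined (cellAt r j))
  all-cellAt (p ∷ ps) {zero}  _        = p
  all-cellAt (p ∷ ps) {suc j} (s≤s j<) = all-cellAt ps j<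

  cell : List Cell → ℕ → Cell
  cell r j = value (cellAt r j) , overlined (cellAt r j)

  left-cellAt : ∀ {r} → AllPairs Left r → ∀ {j j′} → j < j′ → j′ < length r → Left (cell r j) (cell r j′)
  left-cellAt (ls ∷ ps) {zero}  {suc j′} _          (s≤s j′<) = all-cellAt {λ v b → Left _ (v , b)} ls j′<
  left-cellAt (ls ∷ ps) {suc j} {suc j′} (s≤s j<j′) (s≤s j′<) = left-cellAt ps j<j′ j′<

  over-cellAt : ∀ {r s} → RowOver r s → ∀ {j} → j < length s → Over (cell r j) (cell s j)
  over-cellAt (o ∷ os) {zero}  _        = o
  over-cellAt (o ∷ os) {suc j} (s≤s j<) = over-cellAt os j<

  isPlaneOverpartition : ∀ {Π} → Good Π → IsPlaneOverpartition Π
  isPlaneOverpartition {Π} (nonempty , rows , columns) = record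
    { rowsNonempty = nonempty
    ; shapeDecr    = λ i → rowOver-length (above (ℕₚ.n<1+n i))
    ; positive     = λ i j j< → subst (1 ≤_) (sym (val≡value Π i j)) (all-cellAt {λ v _ → 1 ≤ v} (proj₁ (row i)) j<)
    ; rowDecr      = λ i j j< → ≡.subst₂ _≤_ (sym (val≡value Π i (suc j))) (sym (val≡value Π i j)) (<⊎≡⇒≤ (left i (ℕₚ.n<1+n j) j<))
    ; colDecr      = λ i j j< → ≡.subst₂ _≤_ (sym (val≡value Π (suc i) j)) (sym (val≡value Π i j)) (<⊎≡⇒≤ (over-cellAt (above (ℕₚ.n<1+n i)) j<))
    ; rowOver      = λ i j j′ j<j′ j′< o e → strict (left i j<j′ j′<) (trans (sym (over≡overlined Π i j)) o)
                       (trans (sym (val≡value Π i j′)) (trans e (val≡value Π i j)))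
    ; colOver      = λ i i′ j i′<i j< e → trans (over≡overlined Π i j) (forced (over-cellAt (above i′<i) j<)
                       (trans (sym (val≡value Π i j)) (trans (sym e) (val≡value Π i′ j))))
    }
    where
    row : ∀ i → GoodRow (rowAt Π i)
    row = all-rowAt⁺ ([] , []) rows
    above : ∀ {i i′} → i′ < i → RowOver (rowAt Π i′) (rowAt Π i)
    above = rowOver-rowAt (Linked⇒AllPairs rowOver-trans columns)
    left : ∀ i {j j′} → j < j′ → j′ < length (rowAt Π i) → Left (cell (rowAt Π i) j) (cell (rowAt Π i) j′)
    left i = left-cellAt (Linked⇒AllPairs (λ {c} {d} {e} → left-trans {c} {d} {e}) (proj₂ (row i)))
    strict : ∀ {v w b} → w < v ⊎ (w ≡ v × b ≡ false) → b ≡ true → w ≢ v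
    strict (inj₁ x)          _ e = ℕₚ.<⇒≢ x e
    strict (inj₂ (_ , refl)) () e
    forced : ∀ {v w b} → w < v ⊎ (w ≡ v × b ≡ true) → w ≡ v → b ≡ true
    forced (inj₁ x)       e = ⊥-elim (ℕₚ.<⇒≢ x e)
    forced (inj₂ (_ , b)) e = b

  -- `last` covers the only discrepancy in the number of rows: the last row has lower bound 0, may
  -- be empty, and is then absent from the filling.
  data Within : List ℕ → Filling → Set where
    []   : Within [] []
    last : ∀ {x} → Within (x ∷ []) []
    _∷_  : ∀ {x xs r Π} → firstPart xs ≤ length r × length r ≤ x → Within xs Π → Within (x ∷ xs) (r ∷ Π)

  Bounds : List ℕ → Filling → Set
  Bounds μ Π = ∀ i → part μ (suc i) ≤ rowLen Π i × rowLen Π i ≤ part μ i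

  part-0 : ∀ xs → part xs 0 ≡ firstPart xs
  part-0 []      = refl
  part-0 (_ ∷ _) = refl

  within : ∀ {μ Π} → All (0 <_) μ → All (λ r → 0 < length r) Π → Bounds μ Π → Within μ Π
  within {[]}         {[]}     _          _          b = []
  within {[]}         {r ∷ Π}  _          (0<r ∷ _)  b = ⊥-elim (ℕₚ.<⇒≱ 0<r (proj₂ (b 0)))
  within {x ∷ []}     {[]}     _          _          b = last
  within {x ∷ y ∷ xs} {[]}     (_ ∷ 0<y ∷ _) _       b = ⊥-elim (ℕₚ.<⇒≱ 0<y (proj₁ (b 0)))
  within {x ∷ xs}     {r ∷ Π}  (_ ∷ ps)   (_ ∷ ne)   b = (subst (_≤ length r) (part-0 xs) (proj₁ (b 0)) , proj₂ (b 0)) ∷ within ps ne (b ∘ suc)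

  bounds : ∀ {μ Π} → Within μ Π → Bounds μ Π
  bounds []       i       = z≤n , z≤n
  bounds last     i       = z≤n , z≤n
  bounds (_∷_ {xs = xs} {r = r} (l , u) w) zero    = subst (_≤ length r) (sym (part-0 xs)) l , u
  bounds (_ ∷ w)  (suc i) = bounds w i

  left-row : ∀ {r} → Row false r → Linked Left (map decode r)
  left-row []                  = []
  left-row [-]                 = [-]
  left-row {t ∷ u ∷ r} (e ∷ l) = rel⇒left t u e ∷ left-row l

  row-left : ∀ {r} → GoodRow r → Row false (map encode r)
  row-left ([] , [])                  = []
  row-left (_ ∷ [] , [-])             = [-]
  row-left {c ∷ d ∷ r} (p ∷ q ∷ ps , l ∷ ls) =
    left⇒rel (encode c) (encode d) (≡.subst₂ Left (sym (decode-encode p)) (sym (decode-encode q)) l) ∷ row-left (q ∷ ps , ls)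

  over-above : ∀ {r s} → Above false r s → RowOver (map decode r) (map decode s)
  over-above []                         = []
  over-above {t ∷ r} {u ∷ s} (e ∷ a)    = rel⇒over t u e ∷ over-above a

  above-over : ∀ {r s} → All Positive r → All Positive s → RowOver r s → Above false (map encode r) (map encode s)
  above-over _        _        []      = []
  above-over {c ∷ r} {d ∷ s} (p ∷ ps) (q ∷ qs) (o ∷ os) =
    over⇒rel (encode c) (encode d) (≡.subst₂ Over (sym (decode-encode p)) (sym (decode-encode q)) o) ∷ above-over ps qs os

  goodRow-decode : ∀ {r} → Row false r → GoodRow (map decode r)
  goodRow-decode {r} l = Allₚ.map⁺ (All.universal decode-positive r) , left-row l

  decodes : ∀ {r} → All Positive r → map decode (map encode r) ≡ r
  decodes []       = refl
  decodes (p ∷ ps) = cong₂ _∷_ (decode-encode p) (decodes ps)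

  encodes : ∀ r → map encode (map decode r) ≡ r
  encodes []      = refl
  encodes (t ∷ r) = cong₂ _∷_ (encode-decode t) (encodes r)

  prepend : List Cell → Filling → Filling
  prepend []      Π = Π
  prepend (c ∷ r) Π = (c ∷ r) ∷ Π

  fromTableau : List (List ℕ) → Filling
  fromTableau []      = []
  fromTableau (r ∷ T) = prepend (map decode (stripRow r)) (fromTableau T)

  toTableau : List ℕ → Filling → List (List ℕ)
  toTableau []       _       = []
  toTableau (x ∷ xs) []      = glueRow x [] ∷ toTableau xs []
  toTableau (x ∷ xs) (r ∷ Π) = glueRow x (map encode r) ∷ toTableau xs Π

  prepend-nonempty : ∀ {r Π} → 0 < length r → prepend r Π ≡ r ∷ Π
  prepend-nonempty {_ ∷ _} _ = refl

  length-decode : ∀ r → length (map decode (stripRow r)) ≡ length (stripRow r)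
  length-decode r = length-map decode (stripRow r)

  data Nested : List (List ℕ) → Filling → Set where
    []   : Nested [] []
    last : ∀ {r} → stripRow r ≡ [] → Nested (r ∷ []) []
    _∷_  : ∀ {r T Π} → 0 < length (map decode (stripRow r)) → Nested T Π → Nested (r ∷ T) (map decode (stripRow r) ∷ Π)

  -- Since the parts of λ are positive, only the last row of the filling can be empty.
  nested : ∀ {T} → All (λ r → 0 < length r) T → Linked (Above true) T → Nested T (fromTableau T)
  nested {[]}        _            _       = []
  nested {r ∷ []}    _            _       with stripRow r in e
  ... | []    = last e
  ... | t ∷ s = subst (λ z → Nested (r ∷ []) (map decode z ∷ [])) e (subst (λ z → 0 < length (map decode z)) (sym e) (s≤s z≤n) ∷ [])
  nested {r ∷ s ∷ T} (_ ∷ 0<s ∷ ps) (c ∷ l) =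
    subst (Nested (r ∷ s ∷ T)) (sym (prepend-nonempty 0<r)) (0<r ∷ nested (0<s ∷ ps) l)
    where
    0<r : 0 < length (map decode (stripRow r))
    0<r = subst (0 <_) (sym (length-decode r)) (ℕₚ.<-≤-trans 0<s (above-horizontal c))

  nested-good : ∀ {T Π} → Nested T Π → Tableau true T → Good Π
  nested-good []               _                                    = [] , [] , []
  nested-good (last _)         _                                    = [] , [] , []
  nested-good (p ∷ [])         (l ∷ [] , _)                         = p ∷ [] , goodRow-decode (row-stripRow l) ∷ [] , [-]
  nested-good (p ∷ (last _))   (l ∷ _ , _)                          = p ∷ [] , goodRow-decode (row-stripRow l) ∷ [] , [-]
  nested-good (p ∷ n@(_ ∷ _))  (l ∷ rows , c ∷ columns)             =
    let ps , gs , os = nested-good n (rows , columns)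
    in p ∷ ps , goodRow-decode (row-stripRow l) ∷ gs , over-above (above-stripRow c) ∷ os

  nested-within : ∀ {T Π} → Nested T Π → Linked (Above true) T → Within (shape T) Π
  nested-within []                    _       = []
  nested-within (last _)              _       = last
  nested-within (_∷_ {r = r} p [])    _       = (z≤n , subst (_≤ length r) (sym (length-decode r)) (length-stripRow r)) ∷ []
  nested-within (_∷_ {r = r} p n@(last _)) (c ∷ l) =
    (subst (_ ≤_) (sym (length-decode r)) (above-horizontal c) , subst (_≤ length r) (sym (length-decode r)) (length-stripRow r)) ∷ nested-within n l
  nested-within (_∷_ {r = r} p n@(_ ∷ _)) (c ∷ l) =
    (subst (_ ≤_) (sym (length-decode r)) (above-horizontal c) , subst (_≤ length r) (sym (length-decode r)) (length-stripRow r)) ∷ nested-within n l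

  nested-toTableau : ∀ {T Π} → Nested T Π → All (Row true) T → toTableau (shape T) Π ≡ T
  nested-toTableau []               _          = refl
  nested-toTableau (last {r} e)     (l ∷ [])   = cong (_∷ []) (trans (cong (glueRow (length r)) (sym e)) (glueRow-stripRow l))
  nested-toTableau (_∷_ {r = r} p n) (l ∷ rows) =
    cong₂ _∷_ (trans (cong (glueRow (length r)) (encodes (stripRow r))) (glueRow-stripRow l)) (nested-toTableau n rows)

  fromTableau-toTableau : ∀ {μ Π} → Within μ Π → Good Π → fromTableau (toTableau μ Π) ≡ Π
  fromTableau-toTableau []                  _ = refl
  fromTableau-toTableau (last {zero})       _ = refl
  fromTableau-toTableau (last {suc x})      _ = refl
  fromTableau-toTableau (_∷_ {x} {r = r} (_ , u) w) (p ∷ ps , (pos , _) ∷ gs , os) =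
    trans (cong₂ prepend (trans (cong (map decode) (stripRow-glueRow (subst (_≤ x) (sym (length-map encode r)) u))) (decodes pos))
                         (fromTableau-toTableau w (ps , gs , Linked.tail os)))
          (prepend-nonempty p)

  shape-toTableau : ∀ {μ Π} → Within μ Π → shape (toTableau μ Π) ≡ μ
  shape-toTableau []             = refl
  shape-toTableau (last {x})     = cong (_∷ []) (length-glueRow {x} {[]} z≤n)
  shape-toTableau (_∷_ {x} {r = r} (_ , u) w) =
    cong₂ _∷_ (length-glueRow {x} {map encode r} (subst (_≤ x) (sym (length-map encode r)) u)) (shape-toTableau w)

  -- A row with at least as many entries as the next part of λ has a nonzero letter above every cell
  -- of the next row, so no two zeros stand in one column. This is where the lower bound in the
  -- definition of `InB` enters.
  toTableau-tableau : ∀ {b μ Π} → Descending b μ → Within μ Π → Good Π → Tableau true (toTableau μ Π)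
  toTableau-tableau _  []         _ = [] , []
  toTableau-tableau _  (last {x}) _ = row-zeros x (λ ()) ∷ [] , [-]
  toTableau-tableau (_ ∷ d) (_∷_ {x} {r = r} (lo , u) w) (_ ∷ ps , g ∷ gs , os) =
    let rows , columns = toTableau-tableau d w (ps , gs , Linked.tail os)
    in row-glueRow u′ (λ ()) (row-left g) ∷ rows , column d lo w gs os columns
    where
    u′ : length (map encode r) ≤ x
    u′ = subst (_≤ x) (sym (length-map encode r)) u
    column : ∀ {xs Π} → Descending x xs → firstPart xs ≤ length r → Within xs Π → All GoodRow Π → Linked RowOver (r ∷ Π) →
             Linked (Above true) (toTableau xs Π) → Linked (Above true) (glueRow x (map encode r) ∷ toTableau xs Π)
    column d          lo []                          gs       os      c = [-]
    column (y≤x ∷ _)  lo (last {y})                  gs       os      c =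
      above-glueRow {r = map encode r} {s = []} u′ z≤n y≤x (λ _ → subst (y ≤_) (sym (length-map encode r)) lo) [] ∷ c
    column (y≤x ∷ _)  lo (_∷_ {y} {r = s} (_ , v) w) (h ∷ gs) (o ∷ _) c =
      above-glueRow u′ (subst (_≤ y) (sym (length-map encode s)) v) y≤x (λ _ → subst (y ≤_) (sym (length-map encode r)) lo)
        (above-over (proj₁ g) (proj₁ h) o) ∷ c

  weight-decode : ∀ t → valueWeight true (suc t) ≡ proj₁ (decode t)
  weight-decode zero          = refl
  weight-decode (suc zero)    = refl
  weight-decode (suc (suc t)) = cong suc (weight-decode t)

  countRow : List Cell → ℕ
  countRow r = length (filter (λ c → proj₂ c Bool.≟ true) r)

  countRow-decode : ∀ t r → countRow (decode t ∷ r) ≡ overWeight true (suc t) + countRow r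
  countRow-decode zero          r = refl
  countRow-decode (suc zero)    r = refl
  countRow-decode (suc (suc t)) r = trans (same (proj₂ (decode t))) (countRow-decode t r)
    where
    same : ∀ b {v w} → countRow ((v , b) ∷ r) ≡ countRow ((w , b) ∷ r)
    same true  = refl
    same false = refl

  weight-row : ∀ {r} → Row true r → sum (map proj₁ (map decode (stripRow r))) ≡ sum (map (valueWeight true) r)
  weight-row {[]}        _ = refl
  weight-row {zero ∷ r}  l = sym (trans (cong (sum ∘ map (valueWeight true)) (zeros-row l)) (trans (sum-map-zeros (valueWeight true) (suc (length r))) (ℕₚ.*-zeroʳ (suc (length r)))))
  weight-row {suc t ∷ r} l = cong₂ _+_ (sym (weight-decode t)) (weight-row (row-tail l))

  count-row : ∀ {r} → Row true r → countRow (map decode (stripRow r)) ≡ sum (map (overWeight true) r)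
  count-row {[]}        _ = refl
  count-row {zero ∷ r}  l = sym (trans (cong (sum ∘ map (overWeight true)) (zeros-row l)) (trans (sum-map-zeros (overWeight true) (suc (length r))) (ℕₚ.*-zeroʳ (suc (length r)))))
  count-row {suc t ∷ r} l = trans (countRow-decode t (map decode (stripRow r))) (cong₂ _+_ (refl {x = overWeight true (suc t)}) (count-row (row-tail l)))

  weight-prepend : ∀ r Π → weight (prepend r Π) ≡ sum (map proj₁ r) + weight Π
  weight-prepend []      Π = refl
  weight-prepend (_ ∷ _) Π = refl

  countOver-prepend : ∀ r Π → countOver (prepend r Π) ≡ countRow r + countOver Π
  countOver-prepend []      Π = refl
  countOver-prepend (_ ∷ _) Π = refl

  weight-fromTableau : ∀ {T} → All (Row true) T → weight (fromTableau T) ≡ total (valueWeight true) T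
  weight-fromTableau []                 = refl
  weight-fromTableau {r ∷ T} (l ∷ rows) = trans (weight-prepend (map decode (stripRow r)) (fromTableau T)) (cong₂ _+_ (weight-row l) (weight-fromTableau rows))

  countOver-fromTableau : ∀ {T} → All (Row true) T → countOver (fromTableau T) ≡ total (overWeight true) T
  countOver-fromTableau []                 = refl
  countOver-fromTableau {r ∷ T} (l ∷ rows) = trans (countOver-prepend (map decode (stripRow r)) (fromTableau T)) (cong₂ _+_ (count-row l) (countOver-fromTableau rows))

-- Transfer of the count from tableaux to fillings.

open Fillings
open GeneratingFunction using (Class; hasCard-tableaux; jacobiTrudi≈rhs)

isPartition-descending : ∀ {μ} → (∀ i → part μ (suc i) ℕ.≤ part μ i) → Descending (part μ 0) μ
isPartition-descending {[]}     _   = []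
isPartition-descending {x ∷ xs} dec = ℕₚ.≤-refl ∷ go xs (dec 0) (isPartition-descending (dec ∘ suc))
  where
  go : ∀ {x} xs → part xs 0 ℕ.≤ x → Descending (part xs 0) xs → Descending x xs
  go []      _   []      = []
  go (_ ∷ _) y≤x (_ ∷ d) = y≤x ∷ d

hasCard-fillings : ∀ {μ} n k → IsPartition μ →
  HasCard (λ Π → InB μ Π × weight Π ≡ n × countOver Π ≡ k) (+ rhs μ n k)
hasCard-fillings {μ} n k (positive , dec) = ≡.subst (HasCard _) (jacobiTrudi≈rhs d n k)
  (hasCard-bijection fromTableau (toTableau μ) fwd bwd
    (λ { {T} (≡.refl , (rows , columns) , _) → nested-toTableau (nested (Allₚ.map⁻ positive) columns) rows })
    (λ { (b , _) → fromTableau-toTableau (within′ b) (good (proj₁ b)) })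
    (hasCard-tableaux n k d))
  where
  d : Descending (part μ 0) μ
  d = isPartition-descending dec
  within′ : ∀ {Π} → InB μ Π → Within μ Π
  within′ (p , b) = within positive (IsPlaneOverpartition.rowsNonempty p) b
  fwd : ∀ {T} → Class true μ n k T → InB μ (fromTableau T) × weight (fromTableau T) ≡ n × countOver (fromTableau T) ≡ k
  fwd {T} (≡.refl , t@(rows , columns) , v , o) =
    (isPlaneOverpartition (nested-good ns t) , bounds (nested-within ns columns)) ,
    ≡.trans (weight-fromTableau rows) v , ≡.trans (countOver-fromTableau rows) o
    where ns = nested (Allₚ.map⁻ positive) columns
  bwd : ∀ {Π} → InB μ Π × weight Π ≡ n × countOver Π ≡ k → Class true μ n k (toTableau μ Π)
  bwd {Π} (b , v , o) =
    shape-toTableau w , t ,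
    ≡.trans (≡.sym (weight-fromTableau (proj₁ t))) (≡.trans (≡.cong weight e) v) ,
    ≡.trans (≡.sym (countOver-fromTableau (proj₁ t))) (≡.trans (≡.cong countOver e) o)
    where
    w = within′ b
    g = good (proj₁ b)
    t = toTableau-tableau d w g
    e = fromTableau-toTableau w g

theorem4 : (μ : List ℕ) → IsPartition μ → (n k : ℕ) →
    Σ (List Filling) (λ L → Unique L ×
    ((∀ Π → (Π ∈ L) ⇔ (InB μ Π × weight Π ≡ n × countOver Π ≡ k)) ×
    length L ≡ rhs μ n k))
theorem4 μ partition n k =
  let L , unique , complete , size = hasCard-fillings n k partition
  in L , unique , complete , ℤₚ.+-injective size
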